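{- For a positive integer $k$, let $A_k(n)$ be defined by $$\sum_{n=0}^{\infty}A_k(n)q^n=\frac{1}{(-q;q)_\infty(-q^k;q^k)_\infty}=(q;q^2)_\infty(q^k;q^{2k})_\infty,$$ equivalently $A_k(n)=a_e^k(n)-a_o^k(n)$, where $a_e^k(n)$ (resp. $a_o^k(n)$) is the number of partitions of $n$ into an even (resp. odd) number of parts in which the parts that are multiples of $k$ may appear in two colours. Then for all $n\ge 0$, $$A_5(10n+r)\equiv 0\pmod 2\quad\text{for } r\in\{2,6\},$$ $$A_5(25n+r)\equiv 0\pmod 5\quad\text{for } r\in\{14,19,24\}.$$
   Context: $(a;q)_\infty=\prod_{j\ge0}(1-aq^j)$ for $|q|<1$. -}

module Defs where

open import Data.Bool using (Bool; true; false; if_then_else_; _∧_)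
open import Data.Nat using (ℕ; zero; suc; _∸_; _≤ᵇ_; _≡ᵇ_; _%_; _/_; NonZero)
open import Data.Integer using (ℤ; +_; _-_)

Series : Set
Series = ℕ → ℤ

one : Series
one zero    = + 1
one (suc _) = + 0

-- Multiply a series by the factor (1 - q^j).
mulFactor : ℕ → Series → Series
mulFactor j c n = if j ≤ᵇ n then c n - c (n ∸ j) else c n

isOdd : ℕ → Bool
isOdd j = j % 2 ≡ᵇ 1

isOddMultiple : (k : ℕ) → .{{NonZero k}} → ℕ → Bool
isOddMultiple k j = (j % k ≡ᵇ 0) ∧ isOdd (j / k)

-- Partial product  ∏_{1 ≤ j ≤ N, j odd} (1 - q^j) · ∏_{1 ≤ j ≤ N, j = k·odd} (1 - q^j)
-- i.e. the truncation of (q;q^2)_∞ (q^k;q^{2k})_∞ to factors of exponent ≤ N.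
partialProd : (k : ℕ) → .{{NonZero k}} → ℕ → Series
partialProd k zero = one
partialProd k (suc N) =
  let c  = partialProd k N
      c₁ = if isOdd (suc N) then mulFactor (suc N) c else c
  in  if isOddMultiple k (suc N) then mulFactor (suc N) c₁ else c₁

-- A_k(n): the coefficient of q^n in (q;q^2)_∞ (q^k;q^{2k})_∞
-- = 1 / ((-q;q)_∞ (-q^k;q^k)_∞).  Factors with exponent > n do not affect it.
A : (k : ℕ) → .{{NonZero k}} → ℕ → ℤ
A k n = partialProd k n n

{-# OPTIONS --safe #-}
-- Write fₖ = ∏ (1 - qᵏʲ), let F be the generating function of A₅, ψ = ∑ q^(a(2a+1)) = f₂²/f₁ (Gauss),
-- J = ∑ (4a+1) q^(a(2a+1)) = f₁³ (Jacobi), both sums over a ∈ ℤ, and let P be Euler's pentagonal series for f₁.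
--
-- Modulo 5, f₂⁵ ≡ f₁₀ gives F ψ(q⁵) ≡ J ψ². Exponents of ψ are 0, 1, 3 modulo 5, the class 3 being q³ψ(q²⁵),
-- and those of J are 0, 1 modulo 5, so the class 4 of J ψ² is that of 2 (J ψ) q³ψ(q²⁵), where only the class 1
-- of J ψ matters. The coefficients of J ψ are sums over Gaussian integers, and dividing by the two primes above 5
-- shows that this class is -2 q J(q⁵)ψ(q⁵). Hence the class 4 of F is that of q⁴ ψ(q²⁵) J(q⁵), and the claim
-- follows from the classes of J.
--
-- Modulo 2, F f₄ f₁₀ ≡ ψ f₅ = ψ P(q⁵), whose coefficients count solutions of 3x² + 5y² = 24n + 8. For even n the
-- automorphism (1 + √-15)/4 of this form yields an involution with fixed points x = y, so that the even part
-- is P(q⁸) ≡ f₄². Hence F f₁₀ ≡ f₄ = P(q⁴) on even exponents, and 4b(3b+1)/2 is never 1 or 2 modulo 5.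
module Submission where

open import Defs
open import Algebra.Bundles using (CommutativeRing)
import Algebra.Properties.Ring
import Algebra.Properties.Semiring.Exp
import Algebra.Solver.Ring
open import Algebra.Solver.Ring.AlmostCommutativeRing using (fromCommutativeRing; _-Raw-AlmostCommutative⟶_)
open import Data.Bool using (Bool; true; false; if_then_else_; _∧_)
open import Data.Empty using (⊥-elim)
open import Data.Integer as ℤ using (ℤ; +_; -[1+_]; 0ℤ; 1ℤ)
import Data.Integer.DivMod as ℤ
import Data.Integer.Properties as ℤ
open import Data.Integer.Tactic.RingSolver using (solve-∀)
open import Data.List using (List; []; _∷_; _++_; map; cartesianProduct; cartesianProductWith; filter)
open import Data.List.Membership.Propositional using (_∈_)
open import Data.List.Membership.Propositional.Properties using (∈-filter⁺; ∈-filter⁻; ∈-map⁺; ∈-map⁻; ∈-cartesianProduct⁺; ∈-cartesianProduct⁻)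
open import Data.List.Membership.Propositional.Properties.WithK using (unique∧set⇒bag)
open import Data.List.Relation.Binary.BagAndSetEquality using (∼bag⇒↭)
open import Data.List.Relation.Binary.Permutation.Propositional as Perm using (_↭_)
open import Data.List.Relation.Unary.All as All using ([]; _∷_)
open import Data.List.Relation.Unary.AllPairs using ([]; _∷_)
open import Data.List.Relation.Unary.Any as Any using (Any; here; there; any?)
import Data.List.Relation.Unary.Any.Properties as AnyP
open import Data.List.Relation.Unary.Unique.Propositional using (Unique)
import Data.List.Relation.Unary.Unique.Propositional.Properties as Unique
open import Data.Maybe using (Maybe; just; nothing)
open import Data.Nat as ℕ using (ℕ; zero; suc; z≤n; s≤s; NonZero)
import Data.Nat.Divisibility as ℕ
import Data.Nat.DivMod as ℕ
open import Data.Nat.Primality using (prime?; euclidsLemma)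
import Data.Nat.Properties as ℕ
open import Data.Nat.Tactic.RingSolver using () renaming (solve-∀ to ℕ-solve-∀)
open import Data.Product using (_,_; proj₁; proj₂; _×_; ∃; swap)
open import Data.Sum as Sum using (_⊎_; inj₁; inj₂)
open import Data.Unit using (⊤; tt)
open import Function using (_∘_; _⟨_⟩_; id; mk⇔)
open import Relation.Binary.Definitions using (tri<; tri≈; tri>)
open import Relation.Binary.PropositionalEquality as ≡ using (_≡_; cong; cong₂; subst)
import Relation.Binary.Reasoning.Setoid
open import Relation.Nullary using (Dec; yes; no; does; ¬_; ¬?)
open import Relation.Nullary.Decidable using (dec-true; dec-false; from-yes; from-no; False; toWitnessFalse)

-- No limit is ever taken. For the coefficient of q^N one works modulo m and q^(N+1), where products
-- and theta series have finitely many relevant terms, and the classical identities follow from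
-- finite, division-free identities valid in every commutative ring. Division of series is replaced
-- by cancellation of a unit; if its exponents preserve a residue class, a vanishing known on that
-- class alone can be cancelled too. Why the class 1 of J ψ has the factor -2: the coefficient of
-- q^n is the sum of x over x² + y² = 8n + 2 with x, y ≡ 1 modulo 4. For n ≡ 1 modulo 5 this gives y
-- ≡ 2x or y ≡ -2x modulo 5. Dividing by the corresponding prime makes x equal to 2X - Y or to -2X -
-- Y in new coordinates, and by the symmetry of X and Y the two sums add up to -2 times the sum of
-- X. Points satisfying both conditions have 5 ∣ x and are invisible modulo 5. In the class 4 of F
-- the factor becomes 2 · (-2) ≡ 1.

tri : ℕ → ℕ
tri zero    = 0
tri (suc s) = tri s ℕ.+ suc s

n≤tri : ∀ n → n ℕ.≤ tri n
n≤tri zero    = z≤n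
n≤tri (suc n) = ℕ.m≤n+m (suc n) (tri n)

tri-double : ∀ n → 2 ℕ.* tri n ≡ n ℕ.* suc n
tri-double zero    = ≡.refl
tri-double (suc n) = ≡.trans (ℕ.*-distribˡ-+ 2 (tri n) (suc n)) (≡.trans (≡.cong (ℕ._+ 2 ℕ.* suc n) (tri-double n)) (lemma n))
  where
  lemma : ∀ n → n ℕ.* suc n ℕ.+ 2 ℕ.* suc n ≡ suc n ℕ.* suc (suc n)
  lemma = ℕ-solve-∀

tri-even : ∀ n → tri (2 ℕ.* n) ≡ n ℕ.* suc (2 ℕ.* n)
tri-even n = ℕ.*-cancelˡ-≡ _ _ 2 (≡.trans (tri-double (2 ℕ.* n)) (ℕ.*-assoc 2 n _))

tri-odd : ∀ n → tri (suc (2 ℕ.* n)) ≡ suc n ℕ.* suc (2 ℕ.* n)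
tri-odd n = ≡.trans (≡.cong (ℕ._+ suc (2 ℕ.* n)) (tri-even n)) (ℕ.+-comm _ (suc (2 ℕ.* n)))

-- Finite forms of the identities of Gauss, Euler and Jacobi

module FiniteIdentities {c ℓ} (R : CommutativeRing c ℓ)
  (morphism : ℤ.+-*-rawRing -Raw-AlmostCommutative⟶ fromCommutativeRing R) where

  open CommutativeRing R hiding (zero)
  open Algebra.Properties.Semiring.Exp semiring
  open Algebra.Properties.Ring ring using (-0#≈0#)
  open Relation.Binary.Reasoning.Setoid setoid

  private
    decide : ∀ a b → Maybe (_-Raw-AlmostCommutative⟶_.⟦_⟧ morphism a ≈ _-Raw-AlmostCommutative⟶_.⟦_⟧ morphism b)
    decide a b with a ℤ.≟ b
    ... | yes ≡.refl = just refl
    ... | no _       = nothing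

  open Algebra.Solver.Ring ℤ.+-*-rawRing (fromCommutativeRing R) morphism decide public
    using (Polynomial; solve; _:+_; _:*_; _:-_; :-_; _:=_; con; _:^_)

  -- Unlike con 1ℤ, this is interpreted definitionally as 1#.
  :1 : ∀ {n} → Polynomial n
  :1 = con ℤ.0ℤ :^ 0

  Σ< : (ℕ → Carrier) → ℕ → Carrier
  Σ< f zero    = 0#
  Σ< f (suc n) = Σ< f n + f n

  ∏< : (ℕ → Carrier) → ℕ → Carrier
  ∏< f zero    = 1#
  ∏< f (suc n) = ∏< f n * f n

  Σ<-cong : ∀ {f g} n → (∀ i → i ℕ.< n → f i ≈ g i) → Σ< f n ≈ Σ< g n
  Σ<-cong zero    h = refl
  Σ<-cong (suc n) h = +-cong (Σ<-cong n λ i i<n → h i (ℕ.m<n⇒m<1+n i<n)) (h n ℕ.≤-refl)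

  ∏<-cong : ∀ {f g} n → (∀ i → i ℕ.< n → f i ≈ g i) → ∏< f n ≈ ∏< g n
  ∏<-cong zero    h = refl
  ∏<-cong (suc n) h = *-cong (∏<-cong n λ i i<n → h i (ℕ.m<n⇒m<1+n i<n)) (h n ℕ.≤-refl)

  Σ<-+ : ∀ f g n → Σ< (λ i → f i + g i) n ≈ Σ< f n + Σ< g n
  Σ<-+ f g zero    = sym (+-identityˡ 0#)
  Σ<-+ f g (suc n) = trans (+-congʳ (Σ<-+ f g n))
    (solve 4 (λ a b p q → (a :+ b) :+ (p :+ q) := (a :+ p) :+ (b :+ q)) refl _ _ _ _)

  ∏<-* : ∀ f g n → ∏< (λ i → f i * g i) n ≈ ∏< f n * ∏< g n
  ∏<-* f g zero    = sym (*-identityˡ 1#)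
  ∏<-* f g (suc n) = trans (*-congʳ (∏<-* f g n))
    (solve 4 (λ a b p q → (a :* b) :* (p :* q) := (a :* p) :* (b :* q)) refl _ _ _ _)

  *-Σ< : ∀ u f n → u * Σ< f n ≈ Σ< (λ i → u * f i) n
  *-Σ< u f zero    = zeroʳ u
  *-Σ< u f (suc n) = trans (distribˡ u _ _) (+-congʳ (*-Σ< u f n))

  Σ<-telescope : ∀ (V : ℕ → Carrier) n → Σ< (λ s → V (suc s) - V s) n ≈ V n - V 0
  Σ<-telescope V zero    = sym (-‿inverseʳ (V 0))
  Σ<-telescope V (suc n) = trans (+-congʳ (Σ<-telescope V n))
    (solve 3 (λ a b p → (a :- b) :+ (p :- a) := p :- b) refl _ _ _)

  Σ<-stable : ∀ {f M} → (∀ i → M ℕ.≤ i → f i ≈ 0#) → ∀ n → M ℕ.≤ n → Σ< f n ≈ Σ< f M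
  Σ<-stable {f} {M} h n M≤n = ≡.subst (λ n → Σ< f n ≈ Σ< f M) (ℕ.m∸n+n≡m M≤n) (go (n ℕ.∸ M))
    where
    go : ∀ d → Σ< f (d ℕ.+ M) ≈ Σ< f M
    go zero    = refl
    go (suc d) = trans (+-cong (go d) (h _ (ℕ.m≤n+m M d))) (+-identityʳ _)

  ∏<-stable : ∀ {f M} → (∀ i → M ℕ.≤ i → f i ≈ 1#) → ∀ n → M ℕ.≤ n → ∏< f n ≈ ∏< f M
  ∏<-stable {f} {M} h n M≤n = ≡.subst (λ n → ∏< f n ≈ ∏< f M) (ℕ.m∸n+n≡m M≤n) (go (n ℕ.∸ M))
    where
    go : ∀ d → ∏< f (d ℕ.+ M) ≈ ∏< f M
    go zero    = refl
    go (suc d) = trans (*-cong (go d) (h _ (ℕ.m≤n+m M d))) (*-identityʳ _)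

  -- Stands for (∏ a below s)(∏ b below n) / (∏ b below s), the quotient in Shanks's method, without
  -- inverting a factor.
  mix : (a b : ℕ → Carrier) → ℕ → ℕ → Carrier
  mix a b s = ∏< (λ i → if does (i ℕ.<? s) then a i else b i)

  module _ (a b : ℕ → Carrier) where

    private
      pick : ℕ → ℕ → Carrier
      pick s i = if does (i ℕ.<? s) then a i else b i

      pick-< : ∀ {s i} → i ℕ.< s → pick s i ≈ a i
      pick-< {s} {i} i<s = reflexive (≡.cong (if_then a i else b i) (dec-true (i ℕ.<? s) i<s))

      pick-≥ : ∀ {s i} → s ℕ.≤ i → pick s i ≈ b i
      pick-≥ {s} {i} s≤i = reflexive (≡.cong (if_then a i else b i) (dec-false (i ℕ.<? s) (ℕ.≤⇒≯ s≤i)))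

    mix-suc : ∀ {s n} → s ℕ.≤ n → mix a b s (suc n) ≈ mix a b s n * b n
    mix-suc s≤n = *-congˡ (pick-≥ s≤n)

    mix-diagonal : ∀ n → mix a b n n ≈ ∏< a n
    mix-diagonal n = ∏<-cong n (λ i → pick-<)

    mix-zero : ∀ n → mix a b 0 n ≈ ∏< b n
    mix-zero n = ∏<-cong n (λ i _ → pick-≥ z≤n)

    -- Moving the switch point past `s` exchanges a single factor; multiplying crosswise replaces
    -- the division of neighbouring quotients.
    mix-swap : ∀ {s n} → s ℕ.< n → mix a b (suc s) n * b s ≈ mix a b s n * a s
    mix-swap {s} {suc n} (s≤s s≤n) with ℕ.m≤n⇒m<n∨m≡n s≤n
    ... | inj₁ s<n = begin
      mix a b (suc s) n * pick (suc s) n * b s  ≈⟨ *-congʳ (*-congˡ (pick-≥ s<n)) ⟩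
      mix a b (suc s) n * b n * b s             ≈⟨ solve 3 (λ x y z → x :* y :* z := x :* z :* y) refl _ _ _ ⟩
      mix a b (suc s) n * b s * b n             ≈⟨ *-congʳ (mix-swap s<n) ⟩
      mix a b s n * a s * b n                   ≈⟨ solve 3 (λ x y z → x :* y :* z := x :* z :* y) refl _ _ _ ⟩
      mix a b s n * b n * a s                   ≈⟨ *-congʳ (*-congˡ (sym (pick-≥ s≤n))) ⟩
      mix a b s n * pick s n * a s              ∎
    ... | inj₂ ≡.refl = begin
      mix a b (suc s) s * pick (suc s) s * b s  ≈⟨ *-congʳ (*-cong same (pick-< (ℕ.n<1+n s))) ⟩
      mix a b s s * a s * b s                   ≈⟨ solve 3 (λ x y z → x :* y :* z := x :* z :* y) refl _ _ _ ⟩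
      mix a b s s * b s * a s                   ≈⟨ *-congʳ (*-congˡ (sym (pick-≥ {s} ℕ.≤-refl))) ⟩
      mix a b s s * pick s s * a s              ∎
      where
      same : mix a b (suc s) s ≈ mix a b s s
      same = ∏<-cong s (λ i i<s → trans (pick-< (ℕ.m<n⇒m<1+n i<s)) (sym (pick-< i<s)))

  sgn : ℕ → Carrier
  sgn zero    = 1#
  sgn (suc s) = - sgn s

  oddNumber : ℕ → Carrier
  oddNumber zero    = 1#
  oddNumber (suc k) = oddNumber k + (1# + 1#)

  1-_^_ : Carrier → ℕ → Carrier
  1- x ^ n = 1# - x ^ n

  ⟨_⟩_ : Carrier → ℕ → Carrier
  ⟨ x ⟩ n = ∏< (λ i → 1- x ^ suc i) n

  odd : Carrier → ℕ → Carrier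
  odd x n = ∏< (λ i → 1- x ^ suc (2 ℕ.* i)) n

  even : Carrier → ℕ → Carrier
  even x n = ∏< (λ i → 1- x ^ suc (suc (2 ℕ.* i))) n

  module _ (x : Carrier) where

    ^-≡ : ∀ {m n} → m ≡ n → x ^ m ≈ x ^ n
    ^-≡ = ^-congʳ x

    private
      a b : ℕ → Carrier
      a i = 1- x ^ suc (2 ℕ.* i)
      b i = 1- x ^ suc (suc (2 ℕ.* i))

      rhs : ℕ → Carrier
      rhs n = Σ< (λ s → mix a b s n * x ^ (s ℕ.* suc (2 ℕ.* n))) n

    -- The method is that of Shanks, "A short proof of an identity of Euler": the difference of
    -- consecutive right-hand sides telescopes.
    gauss-finite : ∀ n → odd x n * Σ< (λ s → x ^ tri s) (2 ℕ.* n) ≈ rhs n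
    gauss-finite zero    = zeroʳ _
    gauss-finite (suc n) = begin
      odd x n * a n * Σ< t (2 ℕ.* suc n)
        ≈⟨ *-congˡ (reflexive (≡.cong (Σ< t) (ℕ.+-suc (suc n) (n ℕ.+ 0)))) ⟩
      odd x n * a n * (Σ< t (2 ℕ.* n) + x ^ tri (2 ℕ.* n) + x ^ tri (suc (2 ℕ.* n)))
        ≈⟨ *-congˡ (+-cong (+-congˡ (^-≡ (tri-even n))) (^-≡ (tri-odd n))) ⟩
      odd x n * a n * (Σ< t (2 ℕ.* n) + x ^ (n ℕ.* suc (2 ℕ.* n)) + x ^ (suc n ℕ.* suc (2 ℕ.* n)))
        ≈⟨ solve 5 (λ o A S u v → o :* A :* (S :+ u :+ v) := A :* (o :* S) :+ A :* (o :* u) :+ o :* A :* v) refl _ _ _ _ _ ⟩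
      a n * (odd x n * Σ< t (2 ℕ.* n)) + a n * (odd x n * x ^ (n ℕ.* suc (2 ℕ.* n))) + odd x n * a n * x ^ (suc n ℕ.* suc (2 ℕ.* n))
        ≈⟨ +-cong (+-cong (*-congˡ (gauss-finite n)) (*-congˡ (*-congʳ (sym (mix-diagonal a b n))))) (*-congʳ (*-congʳ (sym (mix-diagonal a b n)))) ⟩
      a n * rhs n + a n * term n + V (suc n)
        ≈⟨ solve 4 (λ A r u v → A :* r :+ A :* u :+ v := A :* (r :+ u) :+ v) refl _ _ _ _ ⟩
      a n * Σ< term (suc n) + V (suc n)
        ≈⟨ +-cong (*-Σ< (a n) term (suc n)) (sym (trans (+-congˡ -0#≈0#) (+-identityʳ _))) ⟩
      Σ< (λ s → a n * term s) (suc n) + (V (suc n) - V 0)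
        ≈⟨ +-congˡ (sym (Σ<-telescope V (suc n))) ⟩
      Σ< (λ s → a n * term s) (suc n) + Σ< (λ s → V (suc s) - V s) (suc n)
        ≈⟨ sym (Σ<-+ _ _ (suc n)) ⟩
      Σ< (λ s → a n * term s + (V (suc s) - V s)) (suc n)
        ≈⟨ Σ<-cong (suc n) (λ { s (s≤s s≤n) → sym (step s s≤n) }) ⟩
      rhs (suc n) ∎
      where
      t term V : ℕ → Carrier
      t s = x ^ tri s
      term s = mix a b s n * x ^ (s ℕ.* suc (2 ℕ.* n))
      -- The general formula continues to index 0 with the factor 1 - x^0 = 0, so that `V-swap`
      -- treats all `s` uniformly.
      V zero    = 0#
      V (suc s) = mix a b s n * a s * x ^ (suc s ℕ.* suc (2 ℕ.* n))
      V-swap : ∀ s → s ℕ.≤ n → V s ≈ mix a b s n * (1- x ^ (2 ℕ.* s)) * x ^ (s ℕ.* suc (2 ℕ.* n))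
      V-swap zero    _   = sym (trans (*-congʳ (trans (*-congˡ (-‿inverseʳ 1#)) (zeroʳ _))) (zeroˡ _))
      V-swap (suc s) s<n = *-congʳ (trans (sym (mix-swap a b s<n))
        (*-congˡ (+-congˡ (-‿cong (^-≡ (≡.sym (ℕ.+-suc (suc s) (s ℕ.+ 0))))))))
      step : ∀ s → s ℕ.≤ n → mix a b s (suc n) * x ^ (s ℕ.* suc (2 ℕ.* suc n)) ≈ a n * term s + (V (suc s) - V s)
      step s s≤n = begin
        mix a b s (suc n) * x ^ (s ℕ.* suc (2 ℕ.* suc n))
          ≈⟨ *-cong (mix-suc a b s≤n) (trans (^-≡ (exponent s n)) (^-homo-* x (s ℕ.* suc (2 ℕ.* n)) (2 ℕ.* s))) ⟩
        mix a b s n * b n * (x ^ (s ℕ.* suc (2 ℕ.* n)) * x ^ (2 ℕ.* s))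
          ≈⟨ solve 5 (λ x M y X z → M :* (:1 :- x :* y) :* (X :* z)
               := (:1 :- y) :* (M :* X) :+ (M :* (:1 :- x :* z) :* (y :* X) :- M :* (:1 :- z) :* X))
               refl x (mix a b s n) (x ^ suc (2 ℕ.* n)) (x ^ (s ℕ.* suc (2 ℕ.* n))) (x ^ (2 ℕ.* s)) ⟩
        a n * term s + (mix a b s n * a s * (x ^ suc (2 ℕ.* n) * x ^ (s ℕ.* suc (2 ℕ.* n))) - mix a b s n * (1- x ^ (2 ℕ.* s)) * x ^ (s ℕ.* suc (2 ℕ.* n)))
          ≈⟨ +-congˡ (+-cong (*-congˡ (sym (^-homo-* x (suc (2 ℕ.* n)) (s ℕ.* suc (2 ℕ.* n))))) (-‿cong (sym (V-swap s s≤n)))) ⟩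
        a n * term s + (V (suc s) - V s) ∎
        where
        exponent : ∀ s n → s ℕ.* suc (2 ℕ.* suc n) ≡ s ℕ.* suc (2 ℕ.* n) ℕ.+ 2 ℕ.* s
        exponent = ℕ-solve-∀

    private
      u v : ℕ → Carrier
      u _ = 1#
      v i = 1- x ^ suc i

    -- The exponents are m(3m - 1)/2 and m(3m + 1)/2 for m = n + 1, written with `tri` to avoid a
    -- division.
    pentagonal-sum : ℕ → Carrier
    pentagonal-sum zero    = 1#
    pentagonal-sum (suc n) = pentagonal-sum n
      + sgn (suc n) * (x ^ (suc n ℕ.* suc n ℕ.+ tri n) + x ^ (suc n ℕ.* suc n ℕ.+ tri (suc n)))

    -- Telescoping in the manner of Shanks once more. As `u` is 1, the mix is (x;x)_n / (x;x)_s; the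
    -- summand s = 0 is the full product, and all others carry a power beyond x^n, so that Euler's
    -- theorem results for large n.
    pentagonal-finite : ∀ n → pentagonal-sum n ≈ Σ< (λ s → sgn s * mix u v s n * x ^ (n ℕ.* s ℕ.+ tri s)) (suc n)
    pentagonal-finite zero    = sym (trans (+-identityˡ _) (trans (*-identityʳ _) (*-identityʳ _)))
    pentagonal-finite (suc n) = begin
      pentagonal-sum n + - sgn n * (x ^ (suc n ℕ.* suc n ℕ.+ tri n) + last)
        ≈⟨ +-congʳ (pentagonal-finite n) ⟩
      Σ< term (suc n) + - sgn n * (x ^ (suc n ℕ.* suc n ℕ.+ tri n) + last)
        ≈⟨ solve 4 (λ S s p l → S :+ :- s :* (p :+ l) := S :+ (:- s :* p) :+ :- s :* l) refl _ _ _ _ ⟩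
      Σ< term (suc n) + - sgn n * x ^ (suc n ℕ.* suc n ℕ.+ tri n) + - sgn n * last
        ≈⟨ +-cong (+-congˡ V-last) (*-congʳ (sym (trans (*-congˡ (mix-top (suc n))) (*-identityʳ _)))) ⟩
      Σ< term (suc n) + (V (suc n) - V 0) + sgn (suc n) * mix u v (suc n) (suc n) * last
        ≈⟨ +-congʳ (trans (+-congˡ (sym (Σ<-telescope V (suc n)))) (sym (Σ<-+ _ _ (suc n)))) ⟩
      Σ< (λ s → term s + (V (suc s) - V s)) (suc n) + sgn (suc n) * mix u v (suc n) (suc n) * last
        ≈⟨ +-congʳ (Σ<-cong (suc n) (λ { s (s≤s s≤n) → sym (step s s≤n) })) ⟩
      Σ< (λ s → sgn s * mix u v s (suc n) * x ^ (suc n ℕ.* s ℕ.+ tri s)) (suc (suc n)) ∎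
      where
      last : Carrier
      last = x ^ (suc n ℕ.* suc n ℕ.+ tri (suc n))
      term V : ℕ → Carrier
      term s = sgn s * mix u v s n * x ^ (n ℕ.* s ℕ.+ tri s)
      V zero    = 0#
      V (suc s) = - (sgn s * mix u v s n * x ^ (n ℕ.* suc s ℕ.+ tri (suc s)))
      mix-top : ∀ m → mix u v m m ≈ 1#
      mix-top m = trans (mix-diagonal u v m) (ones m)
        where
        ones : ∀ m → ∏< u m ≈ 1#
        ones zero    = refl
        ones (suc m) = trans (*-identityʳ _) (ones m)
      V-last : - sgn n * x ^ (suc n ℕ.* suc n ℕ.+ tri n) ≈ V (suc n) - V 0
      V-last = begin
        - sgn n * x ^ (suc n ℕ.* suc n ℕ.+ tri n)
          ≈⟨ *-congˡ (^-≡ (exponent n (tri n))) ⟩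
        - sgn n * x ^ (n ℕ.* suc n ℕ.+ tri (suc n))
          ≈⟨ solve 2 (λ s y → :- s :* y := :- (s :* :1 :* y)) refl _ _ ⟩
        - (sgn n * 1# * x ^ (n ℕ.* suc n ℕ.+ tri (suc n)))
          ≈⟨ -‿cong (*-congʳ (*-congˡ (sym (mix-top n)))) ⟩
        V (suc n)
          ≈⟨ sym (trans (+-congˡ -0#≈0#) (+-identityʳ _)) ⟩
        V (suc n) - V 0 ∎
        where
        exponent : ∀ n t → suc n ℕ.* suc n ℕ.+ t ≡ n ℕ.* suc n ℕ.+ (t ℕ.+ suc n)
        exponent = ℕ-solve-∀
      V-swap : ∀ s → s ℕ.≤ n → V s ≈ sgn s * (mix u v s n * (1- x ^ s)) * x ^ (n ℕ.* s ℕ.+ tri s)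
      V-swap zero    _   = sym (trans (*-congʳ (trans (*-congˡ (trans (*-congˡ (-‿inverseʳ 1#)) (zeroʳ _))) (zeroʳ _))) (zeroˡ _))
      V-swap (suc s) s<n = trans (-‿cong (*-congʳ (*-congˡ (trans (sym (*-identityʳ _)) (sym (mix-swap u v s<n))))))
        (solve 3 (λ s m y → :- (s :* m :* y) := :- s :* m :* y) refl _ _ _)
      step : ∀ s → s ℕ.≤ n → sgn s * mix u v s (suc n) * x ^ (suc n ℕ.* s ℕ.+ tri s) ≈ term s + (V (suc s) - V s)
      step s s≤n = begin
        sgn s * mix u v s (suc n) * x ^ (suc n ℕ.* s ℕ.+ tri s)
          ≈⟨ *-cong (*-congˡ (mix-suc u v s≤n)) (trans (^-≡ (ℕ.+-assoc s (n ℕ.* s) (tri s))) (^-homo-* x s _)) ⟩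
        sgn s * (mix u v s n * v n) * (x ^ s * x ^ (n ℕ.* s ℕ.+ tri s))
          ≈⟨ solve 5 (λ σ M Q z X → σ :* (M :* (:1 :- Q)) :* (z :* X)
               := σ :* M :* X :+ (:- (σ :* M :* (X :* (Q :* z))) :- σ :* (M :* (:1 :- z)) :* X)) refl
               (sgn s) (mix u v s n) (x ^ suc n) (x ^ s) (x ^ (n ℕ.* s ℕ.+ tri s)) ⟩
        term s + (- (sgn s * mix u v s n * (x ^ (n ℕ.* s ℕ.+ tri s) * (x ^ suc n * x ^ s))) - sgn s * (mix u v s n * (1- x ^ s)) * x ^ (n ℕ.* s ℕ.+ tri s))
          ≈⟨ +-congˡ (+-cong (-‿cong (*-congˡ (sym exponents))) (-‿cong (sym (V-swap s s≤n)))) ⟩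
        term s + (V (suc s) - V s) ∎
        where
        exponent : ∀ n s t → n ℕ.* suc s ℕ.+ (t ℕ.+ suc s) ≡ (n ℕ.* s ℕ.+ t) ℕ.+ (suc n ℕ.+ s)
        exponent = ℕ-solve-∀
        exponents : x ^ (n ℕ.* suc s ℕ.+ tri (suc s)) ≈ x ^ (n ℕ.* s ℕ.+ tri s) * (x ^ suc n * x ^ s)
        exponents = trans (^-≡ (exponent n s (tri s))) (trans (^-homo-* x (n ℕ.* s ℕ.+ tri s) (suc n ℕ.+ s)) (*-congˡ (^-homo-* x (suc n) s)))

    -- The coefficients, up to sign, of (1 - z) ∏_{1≤i≤n} (1 - z xⁱ)(1 - z⁻¹ xⁱ);
    -- those of zᵏ⁺¹ and z⁻ᵏ are opposite, so one half of them suffices.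
    jtp : ℕ → ℕ → Carrier
    jtp zero    zero    = 1#
    jtp zero    (suc k) = 0#
    jtp (suc n) zero    = (1# + x ^ suc n * x ^ suc n) * jtp n zero + x ^ suc n * (jtp n zero + jtp n 1)
    jtp (suc n) (suc k) = (1# + x ^ suc n * x ^ suc n) * jtp n (suc k) + x ^ suc n * (jtp n k + jtp n (suc (suc k)))

    jtp-vanish : ∀ n {k} → n ℕ.< k → jtp n k ≈ 0#
    jtp-vanish zero    {suc k} _         = refl
    jtp-vanish (suc n) {suc k} (s≤s n<k) = trans
      (+-cong (trans (*-congˡ (jtp-vanish n (ℕ.m<n⇒m<1+n n<k))) (zeroʳ _))
              (trans (*-congˡ (trans (+-cong (jtp-vanish n n<k) (jtp-vanish n (ℕ.m<n⇒m<1+n (ℕ.m<n⇒m<1+n n<k)))) (+-identityˡ _))) (zeroʳ _)))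
      (+-identityˡ _)

    private
      weighted : ℕ → ℕ → Carrier
      weighted n k = sgn k * oddNumber k * jtp n k

      -- With Q = x^(n+1) and c_k = 2k + 1, each `jtp n k` in the interior is collected with (1 +
      -- Q²)c_k - Q(c_(k-1) + c_(k+1)) = (1 - Q)² c_k, the minus coming from `sgn`. The special
      -- recurrence at k = 0 fits this pattern with c_(-1) = -1. Cutting off at `K` leaves the last
      -- summand, which vanishes for K > n.
      weighted-step : ∀ n K → Σ< (weighted (suc n)) (suc K) ≈ (1- x ^ suc n) * (1- x ^ suc n) * Σ< (weighted n) (suc K)
        + x ^ suc n * (sgn K * (oddNumber K * jtp n (suc K) + oddNumber (suc K) * jtp n K))
      weighted-step n zero    = solve 4 (λ z Q d e →
        z :+ :1 :* :1 :* ((:1 :+ Q :* Q) :* d :+ Q :* (d :+ e))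
        := (:1 :- Q) :* (:1 :- Q) :* (z :+ :1 :* :1 :* d) :+ Q :* (:1 :* (:1 :* e :+ (:1 :+ (:1 :+ :1)) :* d)) :+ (z :- (:1 :- Q) :* (:1 :- Q) :* z))
        refl 0# (x ^ suc n) (jtp n 0) (jtp n 1) ⟨ trans ⟩ (trans (+-congˡ (trans (+-congˡ (trans (-‿cong (zeroʳ _)) -0#≈0#)) (+-identityˡ _))) (+-identityʳ _))
      weighted-step n (suc K) = trans (+-congʳ (weighted-step n K)) (solve 7 (λ Q S σ c d e f →
        (:1 :- Q) :* (:1 :- Q) :* S :+ Q :* (σ :* (c :* e :+ (c :+ (:1 :+ :1)) :* d))
          :+ :- σ :* (c :+ (:1 :+ :1)) :* ((:1 :+ Q :* Q) :* e :+ Q :* (d :+ f))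
        := (:1 :- Q) :* (:1 :- Q) :* (S :+ :- σ :* (c :+ (:1 :+ :1)) :* e)
          :+ Q :* (:- σ :* ((c :+ (:1 :+ :1)) :* f :+ (c :+ (:1 :+ :1) :+ (:1 :+ :1)) :* e)))
        refl (x ^ suc n) (Σ< (weighted n) (suc K)) (sgn K) (oddNumber K) (jtp n K) (jtp n (suc K)) (jtp n (suc (suc K))))

    -- Linear weights are annihilated by the second difference, so each factor
    -- of the product in jtp acts on the weighted sum as multiplication by (1 - xⁿ)².
    weighted-sum : ∀ n K → n ℕ.≤ K → Σ< (weighted n) (suc K) ≈ ⟨ x ⟩ n * ⟨ x ⟩ n
    weighted-sum zero zero    _ = trans (+-identityˡ _) (*-congʳ (*-identityʳ _))
    weighted-sum zero (suc K) _ = trans (+-cong (weighted-sum zero K z≤n) (zeroʳ _)) (+-identityʳ _)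
    weighted-sum (suc n) K n<K = begin
      Σ< (weighted (suc n)) (suc K)
        ≈⟨ weighted-step n K ⟩
      (1- x ^ suc n) * (1- x ^ suc n) * Σ< (weighted n) (suc K) + x ^ suc n * (sgn K * (oddNumber K * jtp n (suc K) + oddNumber (suc K) * jtp n K))
        ≈⟨ +-cong (*-congˡ (weighted-sum n K (ℕ.<⇒≤ n<K))) (trans (*-congˡ (trans (*-congˡ (trans (+-cong
             (trans (*-congˡ (jtp-vanish n (ℕ.m<n⇒m<1+n n<K))) (zeroʳ _)) (trans (*-congˡ (jtp-vanish n n<K)) (zeroʳ _))) (+-identityˡ _))) (zeroʳ _))) (zeroʳ _)) ⟩
      (1- x ^ suc n) * (1- x ^ suc n) * (⟨ x ⟩ n * ⟨ x ⟩ n) + 0#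
        ≈⟨ trans (+-identityʳ _) (solve 2 (λ a b → a :* a :* (b :* b) := b :* a :* (b :* a)) refl _ _) ⟩
      ⟨ x ⟩ suc n * ⟨ x ⟩ suc n ∎

    private
      p : ℕ → Carrier
      p = ⟨ x ⟩_

      p-suc : ∀ {i j} → i ≡ suc j → p i ≈ p j * (1- x ^ suc j)
      p-suc ≡.refl = refl

      p-≡ : ∀ {i j} → i ≡ j → p i ≈ p j
      p-≡ ≡.refl = refl

      p-two : ∀ n → p (suc (2 ℕ.* suc n)) ≈ p (suc (2 ℕ.* n)) * (1# - x ^ suc n * x ^ suc n) * (1# - x * (x ^ suc n * x ^ suc n))
      p-two n = trans (p-≡ (double n)) (*-cong (*-congˡ (+-congˡ (-‿cong (square n)))) (+-congˡ (-‿cong (*-congˡ (square n)))))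
        where
        double : ∀ n → suc (2 ℕ.* suc n) ≡ suc (suc (suc (2 ℕ.* n)))
        double = ℕ-solve-∀
        exponent : ∀ n → suc (suc (2 ℕ.* n)) ≡ suc n ℕ.+ suc n
        exponent = ℕ-solve-∀
        square : ∀ n → x ^ suc (suc (2 ℕ.* n)) ≈ x ^ suc n * x ^ suc n
        square n = trans (^-≡ (exponent n)) (^-homo-* x (suc n) (suc n))

    -- jtp n k is x^(tri k) times a Gaussian binomial coefficient, with all denominators cleared;
    -- the factor 1 - x ^ m makes it hold also for k = n + 1.
    jtp-closed : ∀ n k m → m ℕ.+ k ≡ suc n → jtp n k * (p m * p (suc (n ℕ.+ k))) ≈ x ^ tri k * ((1- x ^ m) * p (suc (2 ℕ.* n)))
    jtp-closed n k zero k≡1+n = trans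
      (trans (*-congʳ (jtp-vanish n (ℕ.≤-reflexive (≡.sym k≡1+n)))) (zeroˡ _))
      (sym (trans (*-congˡ (trans (*-congʳ (-‿inverseʳ 1#)) (zeroˡ _))) (zeroʳ _)))
    jtp-closed zero zero (suc zero) _ = solve 1 (λ y → :1 :* (:1 :* y :* (:1 :* y)) := :1 :* (y :* (:1 :* y))) refl _
    jtp-closed zero (suc k) (suc m) eq = ⊥-elim (ℕ.m+1+n≢0 m (ℕ.suc-injective eq))
    -- At the top index only one term of the recurrence survives, the one from `jtp k k`.
    jtp-closed (suc n) (suc k) (suc zero) eq with ≡.refl ← ℕ.suc-injective (ℕ.suc-injective eq) = begin
      jtp (suc k) (suc k) * (p 1 * p (suc (suc k ℕ.+ suc k)))
        ≈⟨ *-cong only (*-congˡ (trans (p-suc (≡.cong suc (≡.cong suc (ℕ.+-suc k k)))) refl)) ⟩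
      x ^ suc k * jtp k k * (p 1 * (p (suc (k ℕ.+ k)) * (1- x ^ suc (suc (k ℕ.+ k))) * (1- x ^ suc (suc (suc (k ℕ.+ k))))))
        ≈⟨ solve 6 (λ Q D a b c d → Q :* D :* (a :* (b :* c :* d)) := D :* (a :* b) :* (Q :* c :* d)) refl _ _ _ _ _ _ ⟩
      jtp k k * (p 1 * p (suc (k ℕ.+ k))) * (x ^ suc k * (1- x ^ suc (suc (k ℕ.+ k))) * (1- x ^ suc (suc (suc (k ℕ.+ k)))))
        ≈⟨ *-congʳ (jtp-closed k k 1 ≡.refl) ⟩
      x ^ tri k * ((1- x ^ 1) * p (suc (2 ℕ.* k))) * (x ^ suc k * (1- x ^ suc (suc (k ℕ.+ k))) * (1- x ^ suc (suc (suc (k ℕ.+ k)))))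
        ≈⟨ solve 6 (λ t u P Q c d → t :* (u :* P) :* (Q :* c :* d) := t :* Q :* (u :* (P :* c :* d))) refl _ _ _ _ _ _ ⟩
      x ^ tri k * x ^ suc k * ((1- x ^ 1) * (p (suc (2 ℕ.* k)) * (1- x ^ suc (suc (k ℕ.+ k))) * (1- x ^ suc (suc (suc (k ℕ.+ k))))))
        ≈⟨ *-cong (sym (^-homo-* x (tri k) (suc k))) (*-congˡ (trans (*-congʳ (*-congʳ (p-≡ (≡.cong (suc ∘ (k ℕ.+_)) (ℕ.+-identityʳ k))))) (p-≡ {suc (suc (suc (k ℕ.+ k)))} (double k)))) ⟩
      x ^ tri (suc k) * ((1- x ^ 1) * p (suc (2 ℕ.* suc k))) ∎
      where
      double : ∀ k → suc (suc (suc (k ℕ.+ k))) ≡ suc (2 ℕ.* suc k)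
      double = ℕ-solve-∀
      only : jtp (suc k) (suc k) ≈ x ^ suc k * jtp k k
      only = trans (+-cong (trans (*-congˡ (jtp-vanish k ℕ.≤-refl)) (zeroʳ _))
        (*-congˡ (trans (+-congˡ (jtp-vanish k (ℕ.m<n⇒m<1+n ℕ.≤-refl))) (+-identityʳ _)))) (+-identityˡ _)
    jtp-closed (suc n) zero (suc zero) ()
    jtp-closed (suc n) zero (suc (suc j)) eq with ≡.refl ← ≡.trans (≡.sym (ℕ.+-identityʳ j)) (ℕ.suc-injective (ℕ.suc-injective eq)) = begin
      jtp (suc n) zero * (p (suc (suc n)) * p (suc (suc (n ℕ.+ 0))))
        ≈⟨ *-congˡ (*-congˡ (p-≡ (≡.cong (λ i → suc (suc i)) (ℕ.+-identityʳ n)))) ⟩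
      ((1# + Q * Q) * jtp n 0 + Q * (jtp n 0 + jtp n 1)) * (p n * a1 * a2 * (p n * a1 * a2))
        ≈⟨ solve 6 (λ Q D E P a b → ((:1 :+ Q :* Q) :* D :+ Q :* (D :+ E)) :* (P :* a :* b :* (P :* a :* b))
             := (:1 :+ Q :* Q :+ Q) :* (D :* (P :* a :* (P :* a))) :* (b :* b) :+ Q :* (E :* (P :* (P :* a :* b))) :* (a :* b)) refl _ _ _ _ _ _ ⟩
      (1# + Q * Q + Q) * (jtp n 0 * (p n * a1 * (p n * a1))) * (a2 * a2) + Q * (jtp n 1 * (p n * (p n * a1 * a2))) * (a1 * a2)
        ≈⟨ +-cong (*-congʳ (*-congˡ (trans (*-congˡ (*-congˡ (p-≡ (≡.cong suc (≡.sym (ℕ.+-identityʳ n)))))) (jtp-closed n 0 (suc n) (ℕ.+-identityʳ (suc n))))))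
             (*-congʳ (*-congˡ (trans (*-congˡ (*-congˡ (p-≡ (≡.cong suc (≡.sym (ℕ.+-comm n 1)))))) (jtp-closed n 1 n (ℕ.+-comm n 1))))) ⟩
      (1# + Q * Q + Q) * (1# * (a1 * P)) * (a2 * a2) + Q * (x ^ 1 * ((1- x ^ n) * P)) * (a1 * a2)
        ≈⟨ solve 3 (λ x y P → let Q = x :* y ; a1 = :1 :- Q ; a2 = :1 :- x :* Q in
             (:1 :+ Q :* Q :+ Q) :* (:1 :* (a1 :* P)) :* (a2 :* a2) :+ Q :* (x :* :1 :* ((:1 :- y) :* P)) :* (a1 :* a2)
             := :1 :* (a2 :* (P :* (:1 :- Q :* Q) :* (:1 :- x :* (Q :* Q))))) refl x (x ^ n) P ⟩
      1# * (a2 * (P * (1# - Q * Q) * (1# - x * (Q * Q))))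
        ≈⟨ *-congˡ (*-congˡ (sym (p-two n))) ⟩
      x ^ tri 0 * (a2 * p (suc (2 ℕ.* suc n))) ∎
      where
      Q a1 a2 P : Carrier
      Q = x ^ suc n
      a1 = 1- x ^ suc n
      a2 = 1- x ^ suc (suc n)
      P = p (suc (2 ℕ.* n))
    jtp-closed (suc n) (suc k) (suc (suc j)) eq with ≡.refl ← ℕ.suc-injective (ℕ.suc-injective eq) = begin
      ((1# + Q * Q) * D₁ + Q * (D₀ + D₂)) * (p j * a₁ * a₂ * p (suc (suc (n ℕ.+ suc k))))
        ≈⟨ *-congˡ (*-congˡ (p-≡ (≡.cong (λ i → suc (suc i)) (ℕ.+-suc n k)))) ⟩
      ((1# + Q * Q) * D₁ + Q * (D₀ + D₂)) * (p j * a₁ * a₂ * (p e * b₁ * b₂))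
        ≈⟨ solve 10 (λ Q D0 D1 D2 P a1 a2 E b1 b2 →
             ((:1 :+ Q :* Q) :* D1 :+ Q :* (D0 :+ D2)) :* (P :* a1 :* a2 :* (E :* b1 :* b2))
             := (:1 :+ Q :* Q) :* (D1 :* (P :* a1 :* (E :* b1))) :* (a2 :* b2)
              :+ Q :* (D0 :* (P :* a1 :* a2 :* E)) :* (b1 :* b2) :+ Q :* (D2 :* (P :* (E :* b1 :* b2))) :* (a1 :* a2))
             refl _ _ _ _ _ _ _ _ _ _ ⟩
      (1# + Q * Q) * (D₁ * (p j * a₁ * (p e * b₁))) * (a₂ * b₂)
        + Q * (D₀ * (p j * a₁ * a₂ * p e)) * (b₁ * b₂) + Q * (D₂ * (p j * (p e * b₁ * b₂))) * (a₁ * a₂)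
        ≈⟨ +-cong (+-cong
             (*-congʳ (*-congˡ (trans (*-congˡ (*-congˡ (p-≡ (≡.cong suc (≡.sym (ℕ.+-suc n k)))))) (jtp-closed n (suc k) (suc j) ≡.refl))))
             (*-congʳ (*-congˡ (jtp-closed n k (suc (suc j)) (≡.cong suc (≡.sym (ℕ.+-suc j k)))))))
             (*-congʳ (*-congˡ (trans (*-congˡ (*-congˡ (p-≡ (≡.cong suc (≡.sym (≡.trans (ℕ.+-suc n (suc k)) (≡.cong suc (ℕ.+-suc n k))))))))
               (jtp-closed n (suc (suc k)) j (ℕ.+-suc j (suc k)))))) ⟩
      (1# + Q * Q) * (x ^ tri (suc k) * (a₁ * P)) * (a₂ * b₂)
        + Q * (T * (a₂ * P)) * (b₁ * b₂) + Q * (x ^ tri (suc (suc k)) * ((1- x ^ j) * P)) * (a₁ * a₂)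
        -- Since n + 1 = (j + 1) + (k + 1), every power is a monomial in x, x^j, `B` and `T`, and a
        -- polynomial identity remains.
        ≈⟨ +-cong (+-cong (*-cong (*-cong (+-congˡ (*-cong Q≈ Q≈)) (*-congʳ T₁≈)) (*-congˡ b₂≈)) (*-cong (*-congʳ Q≈) (*-cong b₁≈ b₂≈)))
             (*-congʳ (*-cong Q≈ (*-congʳ (trans (^-homo-* x (tri (suc k)) (suc (suc k))) (*-congʳ T₁≈))))) ⟩
      (1# + C * B * (C * B)) * (T * B * (a₁ * P)) * (a₂ * (1# - x * (C * B * B)))
        + C * B * (T * (a₂ * P)) * ((1# - C * B * B) * (1# - x * (C * B * B))) + C * B * (T * B * (x * B) * ((1- x ^ j) * P)) * (a₁ * a₂)
        ≈⟨ solve 6 (λ x y B T P a2 → let C = x :* y ; a1 = :1 :- C ; b1 = :1 :- C :* B :* B ; b2 = :1 :- x :* (C :* B :* B) in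
             (:1 :+ C :* B :* (C :* B)) :* (T :* B :* (a1 :* P)) :* (a2 :* b2)
             :+ C :* B :* (T :* (a2 :* P)) :* (b1 :* b2) :+ C :* B :* (T :* B :* (x :* B) :* ((:1 :- y) :* P)) :* (a1 :* a2)
             := T :* B :* (a2 :* (P :* (:1 :- C :* B :* (C :* B)) :* (:1 :- x :* (C :* B :* (C :* B)))))) refl x (x ^ j) B T P a₂ ⟩
      T * B * (a₂ * (P * (1# - C * B * (C * B)) * (1# - x * (C * B * (C * B)))))
        ≈⟨ sym (*-cong T₁≈ (*-congˡ (trans (p-two n) (*-cong (*-congˡ (+-congˡ (-‿cong (*-cong Q≈ Q≈)))) (+-congˡ (-‿cong (*-congˡ (*-cong Q≈ Q≈)))))))) ⟩
      x ^ tri (suc k) * (a₂ * p (suc (2 ℕ.* suc n))) ∎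
      where
      e : ℕ
      e = suc (n ℕ.+ k)
      Q C B T P D₀ D₁ D₂ a₁ a₂ b₁ b₂ : Carrier
      Q = x ^ suc n
      C = x ^ suc j
      B = x ^ suc k
      T = x ^ tri k
      P = p (suc (2 ℕ.* n))
      D₀ = jtp n k
      D₁ = jtp n (suc k)
      D₂ = jtp n (suc (suc k))
      a₁ = 1- x ^ suc j
      a₂ = 1- x ^ suc (suc j)
      b₁ = 1- x ^ suc e
      b₂ = 1- x ^ suc (suc e)
      T₁≈ : x ^ tri (suc k) ≈ T * B
      T₁≈ = ^-homo-* x (tri k) (suc k)
      Q≈ : Q ≈ C * B
      Q≈ = ^-homo-* x (suc j) (suc k)
      exponent : ∀ j k → suc (suc (j ℕ.+ suc k ℕ.+ k)) ≡ suc j ℕ.+ suc k ℕ.+ suc k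
      exponent = ℕ-solve-∀
      ABB : x ^ suc e ≈ C * B * B
      ABB = trans (^-≡ (exponent j k)) (trans (^-homo-* x (suc j ℕ.+ suc k) (suc k)) (*-congʳ Q≈))
      b₁≈ : b₁ ≈ 1# - C * B * B
      b₁≈ = +-congˡ (-‿cong ABB)
      b₂≈ : b₂ ≈ 1# - x * (C * B * B)
      b₂≈ = +-congˡ (-‿cong (*-congˡ ABB))

-- Integer power series, congruences and truncation

module PowerSeries where

  open import Data.Integer using (_+_; _*_; _-_; -_)
  open import Relation.Binary.PropositionalEquality using (refl; sym; trans)
  open ≡.≡-Reasoning
  open import Data.Integer.Divisibility.Signed using (_∣_; divides; ∣m∣n⇒∣m+n; ∣m⇒∣-m; ∣n⇒∣m*n; ∣m⇒∣m*n; _∣?_)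

  infixl 7 _⊛_
  infixl 6 _⊞_
  opaque
    -- The Cauchy product, by way of f = f(0) + q g with g = `f ∘ suc`.
    _⊛_ _⊞_ : Series → Series → Series
    (f ⊛ g) zero    = f 0 * g 0
    (f ⊛ g) (suc n) = f 0 * g (suc n) + (f ∘ suc ⊛ g) n
    (f ⊞ g) n = f n + g n

    ⊟_ : Series → Series
    (⊟ f) n = - f n

    𝟘 : Series
    𝟘 _ = 0ℤ

  const : ℤ → Series
  const a zero    = a
  const a (suc _) = 0ℤ

  monomial : ℤ → ℕ → Series
  monomial a zero    n       = const a n
  monomial a (suc e) zero    = 0ℤ
  monomial a (suc e) (suc n) = monomial a e n

  opaque
    unfolding _⊛_

    ⊛-zero : ∀ (f g : Series) → (f ⊛ g) 0 ≡ f 0 * g 0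
    ⊛-zero f g = refl

    ⊛-suc : ∀ (f g : Series) n → (f ⊛ g) (suc n) ≡ f 0 * g (suc n) + (f ∘ suc ⊛ g) n
    ⊛-suc f g n = refl

    ⊞-at : ∀ (f g : Series) n → (f ⊞ g) n ≡ f n + g n
    ⊞-at f g n = refl

    ⊟-at : ∀ (f : Series) n → (⊟ f) n ≡ - f n
    ⊟-at f n = refl

    𝟘-at : ∀ n → 𝟘 n ≡ 0ℤ
    𝟘-at n = refl

    ⊛-cong-≡ : ∀ {f f′ g g′ : Series} n → (∀ i → f i ≡ f′ i) → (∀ i → g i ≡ g′ i) → (f ⊛ g) n ≡ (f′ ⊛ g′) n
    ⊛-cong-≡ zero    p q = cong₂ _*_ (p 0) (q 0)
    ⊛-cong-≡ (suc n) p q = cong₂ _+_ (cong₂ _*_ (p 0) (q (suc n))) (⊛-cong-≡ n (p ∘ suc) q)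

    ⊛-distribʳ : ∀ (f g h : Series) n → ((f ⊞ g) ⊛ h) n ≡ ((f ⊛ h) ⊞ (g ⊛ h)) n
    ⊛-distribʳ f g h zero    = ℤ.*-distribʳ-+ (h 0) (f 0) (g 0)
    ⊛-distribʳ f g h (suc n) = trans (cong₂ _+_ (ℤ.*-distribʳ-+ (h (suc n)) (f 0) (g 0)) (⊛-distribʳ (f ∘ suc) (g ∘ suc) h n)) (mid (f 0 * h (suc n)) (g 0 * h (suc n)) ((f ∘ suc ⊛ h) n) ((g ∘ suc ⊛ h) n))
      where
      mid : ∀ a b c d → a + b + (c + d) ≡ a + c + (b + d)
      mid = solve-∀

    scale-⊛ : ∀ a (f g : Series) n → ((λ i → a * f i) ⊛ g) n ≡ a * (f ⊛ g) n
    scale-⊛ a f g zero    = ℤ.*-assoc a (f 0) (g 0)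
    scale-⊛ a f g (suc n) = trans (cong₂ _+_ (ℤ.*-assoc a (f 0) (g (suc n))) (scale-⊛ a (f ∘ suc) g n)) (sym (ℤ.*-distribˡ-+ a _ _))

    ⊛-sucʳ : ∀ (f g : Series) n → (f ⊛ g) (suc n) ≡ f (suc n) * g 0 + (f ⊛ g ∘ suc) n
    ⊛-sucʳ f g zero    = ℤ.+-comm (f 0 * g 1) (f 1 * g 0)
    ⊛-sucʳ f g (suc n) = trans (cong (λ z → f 0 * g (suc (suc n)) + z) (⊛-sucʳ (f ∘ suc) g n))
      (exchange (f 0 * g (suc (suc n))) (f (suc (suc n)) * g 0) ((f ∘ suc ⊛ g ∘ suc) n))
      where
      exchange : ∀ a b c → a + (b + c) ≡ b + (a + c)
      exchange = solve-∀

    ⊛-comm : ∀ (f g : Series) n → (f ⊛ g) n ≡ (g ⊛ f) n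
    ⊛-comm f g zero    = ℤ.*-comm (f 0) (g 0)
    ⊛-comm f g (suc n) = trans (cong₂ _+_ (ℤ.*-comm (f 0) (g (suc n))) (⊛-comm (f ∘ suc) g n)) (sym (⊛-sucʳ g f n))

    ⊛-assoc : ∀ (f g h : Series) n → ((f ⊛ g) ⊛ h) n ≡ (f ⊛ (g ⊛ h)) n
    ⊛-assoc f g h zero    = ℤ.*-assoc (f 0) (g 0) (h 0)
    ⊛-assoc f g h (suc n) = begin
      f 0 * g 0 * h (suc n) + (((λ i → f 0 * g (suc i)) ⊞ (f ∘ suc ⊛ g)) ⊛ h) n
        ≡⟨ cong₂ _+_ (ℤ.*-assoc (f 0) (g 0) (h (suc n))) (⊛-distribʳ (λ i → f 0 * g (suc i)) (f ∘ suc ⊛ g) h n) ⟩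
      f 0 * (g 0 * h (suc n)) + (((λ i → f 0 * g (suc i)) ⊛ h) n + ((f ∘ suc ⊛ g) ⊛ h) n)
        ≡⟨ cong (λ z → f 0 * (g 0 * h (suc n)) + z) (cong₂ _+_ (scale-⊛ (f 0) (g ∘ suc) h n) (⊛-assoc (f ∘ suc) g h n)) ⟩
      f 0 * (g 0 * h (suc n)) + (f 0 * (g ∘ suc ⊛ h) n + (f ∘ suc ⊛ (g ⊛ h)) n)
        ≡⟨ lemma (f 0) _ _ _ ⟩
      f 0 * (g 0 * h (suc n) + (g ∘ suc ⊛ h) n) + (f ∘ suc ⊛ (g ⊛ h)) n ∎
      where
      lemma : ∀ a b c d → a * b + (a * c + d) ≡ a * (b + c) + d
      lemma = solve-∀

    𝟘-⊛ : ∀ (g : Series) n → (𝟘 ⊛ g) n ≡ 0ℤ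
    𝟘-⊛ g zero    = refl
    𝟘-⊛ g (suc n) = trans (ℤ.+-identityˡ _) (𝟘-⊛ g n)

    const-⊛ : ∀ a (g : Series) n → (const a ⊛ g) n ≡ a * g n
    const-⊛ a g zero    = refl
    const-⊛ a g (suc n) = trans (cong (λ z → a * g (suc n) + z) (𝟘-⊛ g n)) (ℤ.+-identityʳ _)

    one≡const : ∀ n → one n ≡ const 1ℤ n
    one≡const zero    = refl
    one≡const (suc _) = refl

    one-⊛ : ∀ (g : Series) n → (one ⊛ g) n ≡ g n
    one-⊛ g n = trans (⊛-cong-≡ n one≡const (λ _ → refl)) (trans (const-⊛ 1ℤ g n) (ℤ.*-identityˡ _))

    monomial-⊛-monomial : ∀ a b d e n → (monomial a d ⊛ monomial b e) n ≡ monomial (a * b) (d ℕ.+ e) n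
    monomial-⊛-monomial a b zero    e n       = trans (const-⊛ a (monomial b e) n) (lemma e n)
      where
      lemma : ∀ e n → a * monomial b e n ≡ monomial (a * b) e n
      lemma zero    zero    = refl
      lemma zero    (suc n) = ℤ.*-zeroʳ a
      lemma (suc e) zero    = ℤ.*-zeroʳ a
      lemma (suc e) (suc n) = lemma e n
    monomial-⊛-monomial a b (suc d) e zero    = refl
    monomial-⊛-monomial a b (suc d) e (suc n) = trans (ℤ.+-identityˡ _) (monomial-⊛-monomial a b d e n)


  ⊛-shift : ∀ d g k → (monomial 1ℤ (suc d) ⊛ g) (suc k) ≡ (monomial 1ℤ d ⊛ g) k
  ⊛-shift d g k = trans (⊛-suc (monomial 1ℤ (suc d)) g k) (ℤ.+-identityˡ _)

  monomial-≢ : ∀ a {e n} → ¬ e ≡ n → monomial a e n ≡ 0ℤ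
  monomial-≢ a {zero}  {zero}  e≢n with () ← e≢n refl
  monomial-≢ a {zero}  {suc n} e≢n = refl
  monomial-≢ a {suc e} {zero}  e≢n = refl
  monomial-≢ a {suc e} {suc n} e≢n = monomial-≢ a (e≢n ∘ cong suc)

  opaque
    unfolding _⊛_

    -- The bridge from the definition of `A` to ring arithmetic.
    mulFactor-⊛ : ∀ j c n → mulFactor j c n ≡ ((one ⊞ (⊟ monomial 1ℤ j)) ⊛ c) n
    mulFactor-⊛ j c n = trans (lemma j n) (sym (trans (⊛-distribʳ one (⊟ monomial 1ℤ j) c n)
      (cong₂ _+_ (one-⊛ c n) (trans (⊛-cong-≡ n (λ i → sym (ℤ.-1*i≡-i (monomial 1ℤ j i))) (λ _ → refl)) (trans (scale-⊛ (- 1ℤ) (monomial 1ℤ j) c n) (ℤ.-1*i≡-i _))))))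
      where
      shift : ∀ j n → (monomial 1ℤ j ⊛ c) n ≡ (if j ℕ.≤ᵇ n then c (n ℕ.∸ j) else 0ℤ)
      shift zero    n       = trans (const-⊛ 1ℤ c n) (ℤ.*-identityˡ _)
      shift (suc j) zero    = refl
      shift (suc j) (suc n) = trans (ℤ.+-identityˡ _) (trans (shift j n) (cong (if_then c (n ℕ.∸ j) else 0ℤ) (≤ᵇ-suc j n)))
        where
        ≤ᵇ-suc : ∀ j n → (j ℕ.≤ᵇ n) ≡ (suc j ℕ.≤ᵇ suc n)
        ≤ᵇ-suc zero    n = refl
        ≤ᵇ-suc (suc j) n = refl
      lemma : ∀ j n → mulFactor j c n ≡ c n + - (monomial 1ℤ j ⊛ c) n
      lemma j n rewrite shift j n with j ℕ.≤ᵇ n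
      ... | true  = refl
      ... | false = sym (ℤ.+-identityʳ _)

  infix 4 _≡_[mod_]
  _≡_[mod_] : ℤ → ℤ → ℤ → Set
  a ≡ b [mod m ] = m ∣ a - b

  module _ {m : ℤ} where

    ≡⇒mod : ∀ {a b} → a ≡ b → a ≡ b [mod m ]
    ≡⇒mod {a} refl = divides 0ℤ (trans (ℤ.+-inverseʳ a) (sym (ℤ.*-zeroˡ m)))

    mod-sym : ∀ {a b} → a ≡ b [mod m ] → b ≡ a [mod m ]
    mod-sym {a} {b} p = subst (m ∣_) (lemma a b) (∣m⇒∣-m p)
      where
      lemma : ∀ a b → - (a - b) ≡ b - a
      lemma = solve-∀

    mod-trans : ∀ {a b c} → a ≡ b [mod m ] → b ≡ c [mod m ] → a ≡ c [mod m ]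
    mod-trans {a} {b} {c} p q = subst (m ∣_) (lemma a b c) (∣m∣n⇒∣m+n p q)
      where
      lemma : ∀ a b c → (a - b) + (b - c) ≡ a - c
      lemma = solve-∀

    mod-+ : ∀ {a b c d} → a ≡ b [mod m ] → c ≡ d [mod m ] → a + c ≡ b + d [mod m ]
    mod-+ {a} {b} {c} {d} p q = subst (m ∣_) (lemma a b c d) (∣m∣n⇒∣m+n p q)
      where
      lemma : ∀ a b c d → (a - b) + (c - d) ≡ (a + c) - (b + d)
      lemma = solve-∀

    mod-* : ∀ {a b c d} → a ≡ b [mod m ] → c ≡ d [mod m ] → a * c ≡ b * d [mod m ]
    mod-* {a} {b} {c} {d} p q = subst (m ∣_) (lemma a b c d) (∣m∣n⇒∣m+n (∣m⇒∣m*n c p) (∣n⇒∣m*n b q))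
      where
      lemma : ∀ a b c d → (a - b) * c + b * (c - d) ≡ a * c - b * d
      lemma = solve-∀

    mod-neg : ∀ {a b} → a ≡ b [mod m ] → - a ≡ - b [mod m ]
    mod-neg {a} {b} p = subst (m ∣_) (lemma a b) (∣m⇒∣-m p)
      where
      lemma : ∀ a b → - (a - b) ≡ (- a) - (- b)
      lemma = solve-∀

    ∣⇒mod-0 : ∀ {a} → m ∣ a → a ≡ 0ℤ [mod m ]
    ∣⇒mod-0 {a} = subst (m ∣_) (sym (ℤ.+-identityʳ a))

    mod-0⇒∣ : ∀ {a} → a ≡ 0ℤ [mod m ] → m ∣ a
    mod-0⇒∣ {a} = subst (m ∣_) (ℤ.+-identityʳ a)

  opaque
    unfolding _⊛_

    ⊛-mod : ∀ {m} {f f′ g g′ : Series} n → (∀ i → i ℕ.≤ n → f i ≡ f′ i [mod m ]) → (∀ i → i ℕ.≤ n → g i ≡ g′ i [mod m ]) → (f ⊛ g) n ≡ (f′ ⊛ g′) n [mod m ]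
    ⊛-mod {m} {f} {f′} {g} {g′} zero    p q = mod-* {m} {f 0} {f′ 0} {g 0} {g′ 0} (p 0 z≤n) (q 0 z≤n)
    ⊛-mod {m} {f} {f′} {g} {g′} (suc n) p q = mod-+ {m} {f 0 * g (suc n)} {f′ 0 * g′ (suc n)} {(f ∘ suc ⊛ g) n} {(f′ ∘ suc ⊛ g′) n}
      (mod-* {m} {f 0} {f′ 0} {g (suc n)} {g′ (suc n)} (p 0 z≤n) (q (suc n) ℕ.≤-refl))
      (⊛-mod n (λ i i≤n → p (suc i) (s≤s i≤n)) (λ i i≤n → q i (ℕ.m≤n⇒m≤1+n i≤n)))

  module Truncated (m : ℤ) (N : ℕ) where

    infix 4 _≋_
    -- Equality modulo m and q^(N+1). Here almost all factors of an infinite product are 1 and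
    -- almost all terms of a theta series are 0, so finite products and sums can represent them.
    record _≋_ (f g : Series) : Set where
      constructor mk
      field at : ∀ n → n ℕ.≤ N → f n ≡ g n [mod m ]
    open _≋_ public

    exact : ∀ {f g} → (∀ n → f n ≡ g n) → f ≋ g
    exact p = mk λ n _ → ≡⇒mod (p n)

    opaque
      unfolding _⊛_

      ⊞-cong : ∀ {f f′ g g′} → f ≋ f′ → g ≋ g′ → f ⊞ g ≋ f′ ⊞ g′
      ⊞-cong {f} {f′} {g} {g′} p q = mk λ n n≤N → mod-+ {m} {f n} {f′ n} {g n} {g′ n} (at p n n≤N) (at q n n≤N)

      ⊟-cong : ∀ {f f′} → f ≋ f′ → ⊟ f ≋ ⊟ f′
      ⊟-cong {f} {f′} p = mk λ n n≤N → mod-neg {m} {f n} {f′ n} (at p n n≤N)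

      ⊞-assoc : ∀ f g h → (f ⊞ g) ⊞ h ≋ f ⊞ (g ⊞ h)
      ⊞-assoc f g h = exact λ n → ℤ.+-assoc (f n) (g n) (h n)

      ⊞-comm : ∀ f g → f ⊞ g ≋ g ⊞ f
      ⊞-comm f g = exact λ n → ℤ.+-comm (f n) (g n)

      ⊞-identityˡ : ∀ f → 𝟘 ⊞ f ≋ f
      ⊞-identityˡ f = exact λ n → ℤ.+-identityˡ (f n)

      ⊞-identityʳ : ∀ f → f ⊞ 𝟘 ≋ f
      ⊞-identityʳ f = exact λ n → ℤ.+-identityʳ (f n)

      ⊞-inverseˡ : ∀ f → (⊟ f) ⊞ f ≋ 𝟘
      ⊞-inverseˡ f = exact λ n → ℤ.+-inverseˡ (f n)

      ⊞-inverseʳ : ∀ f → f ⊞ (⊟ f) ≋ 𝟘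
      ⊞-inverseʳ f = exact λ n → ℤ.+-inverseʳ (f n)

      ⊛-distribˡ : ∀ f g h → f ⊛ (g ⊞ h) ≋ (f ⊛ g) ⊞ (f ⊛ h)
      ⊛-distribˡ f g h = exact λ n → trans (⊛-comm f (g ⊞ h) n) (trans (⊛-distribʳ g h f n) (cong₂ _+_ (⊛-comm g f n) (⊛-comm h f n)))

      ≋𝟘⇒∣ : ∀ {f} → f ≋ 𝟘 → ∀ n → n ℕ.≤ N → m ∣ f n
      ≋𝟘⇒∣ p n n≤N = mod-0⇒∣ {m} (at p n n≤N)

      ∣⇒≋𝟘 : ∀ {f} → (∀ n → n ℕ.≤ N → m ∣ f n) → f ≋ 𝟘
      ∣⇒≋𝟘 p = mk λ n n≤N → ∣⇒mod-0 {m} (p n n≤N)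

      const-+ : ∀ a b → const (a + b) ≋ const a ⊞ const b
      const-+ a b = exact λ { zero → refl ; (suc _) → refl }

      const-neg : ∀ a → const (- a) ≋ ⊟ const a
      const-neg a = exact λ { zero → refl ; (suc _) → refl }

      const-0 : const 0ℤ ≋ 𝟘
      const-0 = exact λ { zero → refl ; (suc _) → refl }

    seriesRing : CommutativeRing _ _
    seriesRing = record
      { Carrier = Series ; _≈_ = _≋_ ; _+_ = _⊞_ ; _*_ = _⊛_ ; -_ = ⊟_ ; 0# = 𝟘 ; 1# = one
      ; isCommutativeRing = record
        { isRing = record
          { +-isAbelianGroup = record
            { isGroup = record
              { isMonoid = record
                { isSemigroup = record
                  { isMagma = record
                    { isEquivalence = record
                      { refl  = exact λ _ → refl
                      ; sym   = λ {f} {g} p → mk λ n n≤N → mod-sym {m} {f n} {g n} (at p n n≤N)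
                      ; trans = λ {f} {g} {h} p q → mk λ n n≤N → mod-trans {m} {f n} {g n} {h n} (at p n n≤N) (at q n n≤N) }
                    ; ∙-cong = ⊞-cong }
                  ; assoc = ⊞-assoc }
                ; identity = ⊞-identityˡ , ⊞-identityʳ }
              ; inverse = ⊞-inverseˡ , ⊞-inverseʳ
              ; ⁻¹-cong = ⊟-cong }
            ; comm = ⊞-comm }
          ; *-cong = λ p q → mk λ n n≤N → ⊛-mod {m} n (λ i i≤n → at p i (ℕ.≤-trans i≤n n≤N)) (λ i i≤n → at q i (ℕ.≤-trans i≤n n≤N))
          ; *-assoc = λ f g h → exact (⊛-assoc f g h)
          ; *-identity = (λ f → exact (one-⊛ f)) , (λ f → exact λ n → trans (⊛-comm f one n) (one-⊛ f n))
          ; distrib = ⊛-distribˡ , (λ h f g → exact (⊛-distribʳ f g h)) }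
        ; *-comm = λ f g → exact (⊛-comm f g) } }

    -- Provides the ring solver with integer coefficients; multiples of m then show up as `const`
    -- and are removed afterwards.
    const-morphism : ℤ.+-*-rawRing -Raw-AlmostCommutative⟶ fromCommutativeRing seriesRing
    const-morphism = record
      { ⟦_⟧    = const
      ; +-homo = const-+
      ; *-homo = λ a b → exact λ n → sym (monomial-⊛-monomial a b 0 0 n)
      ; -‿homo = const-neg
      ; 0-homo = const-0
      ; 1-homo = exact λ n → sym (one≡const n) }

  opaque
    unfolding _⊛_

    ⊛-∣ : ∀ {m} (f g : Series) n → (∀ i j → i ℕ.+ j ≡ n → m ∣ f i * g j) → m ∣ (f ⊛ g) n
    ⊛-∣ f g zero    h = h 0 0 refl
    ⊛-∣ f g (suc n) h = ∣m∣n⇒∣m+n (h 0 (suc n) refl) (⊛-∣ (f ∘ suc) g n (λ i j eq → h (suc i) j (cong suc eq)))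

    -- If u is a unit whose support preserves the class C of exponents, then g vanishes on C as soon as u g does.
    ⊛-cancel-on : ∀ {m} (C : ℕ → Set) (u g : Series) N → u 0 ≡ 1ℤ →
      (∀ i j → i ℕ.+ j ℕ.≤ N → C (i ℕ.+ j) → ¬ m ∣ u i → C j) →
      (∀ n → n ℕ.≤ N → C n → m ∣ (u ⊛ g) n) → ∀ n → n ℕ.≤ N → C n → m ∣ g n
    ⊛-cancel-on {m} C u g N u0 supp h n n≤N = go n (suc n) ℕ.≤-refl n≤N
      where
      1+a-a : ∀ a b → (1ℤ * a + b) + - b ≡ a
      1+a-a = solve-∀
      go : ∀ n fuel → n ℕ.< fuel → n ℕ.≤ N → C n → m ∣ g n
      go zero    (suc fuel) n<fuel n≤N Cn = subst (m ∣_) (trans (cong (_* g 0) u0) (ℤ.*-identityˡ _)) (h 0 n≤N Cn)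
      go (suc n) (suc fuel) (s≤s n<fuel) n≤N Cn = subst (m ∣_)
        (trans (cong (λ a → (a * g (suc n) + rest) + - rest) u0) (1+a-a (g (suc n)) rest))
        (∣m∣n⇒∣m+n (h (suc n) n≤N Cn) (∣m⇒∣-m (⊛-∣ (u ∘ suc) g n λ i j eq → term i j eq (m ∣? u (suc i)))))
        where
        rest : ℤ
        rest = (u ∘ suc ⊛ g) n
        -- A term beyond the leading one dies either because m divides the coefficient of `u`, or
        -- because the support of `u` keeps `j` in `C`, where the induction applies.
        term : ∀ i j → i ℕ.+ j ≡ n → Dec (m ∣ u (suc i)) → m ∣ u (suc i) * g j
        term i j eq (yes p) = ∣m⇒∣m*n (g j) p
        term i j refl (no ¬p) = ∣n⇒∣m*n (u (suc i)) (go j fuel (ℕ.≤-trans (s≤s (ℕ.m≤n+m j i)) n<fuel)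
          (ℕ.≤-trans (ℕ.m≤n⇒m≤1+n (ℕ.m≤n+m j i)) n≤N) (supp (suc i) j n≤N Cn ¬p))

-- Theta series and their product formulas

module ThetaSeries where

  open PowerSeries
  open import Data.Integer.Divisibility.Signed using (_∣_; divides)

  -- The integers from -K to K - 1, exactly those whose `code` is below 2K.
  integers : ℕ → List ℤ
  integers zero    = []
  integers (suc K) = + K ∷ -[1+ K ] ∷ integers K

  -- code a runs over ℕ as a runs over ℤ, and e a = a (2a + 1) over the triangular numbers; pe s and po s
  -- are the generalised pentagonal numbers b (3b + 1) / 2 for b = 2s and b = 2s + 1.
  code : ℤ → ℕ
  code (+ i)    = 2 ℕ.* i
  code -[1+ i ] = suc (2 ℕ.* i)

  e pe po : ℤ → ℕ
  e a = tri (code a)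
  pe (+ i)    = 2 ℕ.* i ℕ.* (2 ℕ.* i) ℕ.+ tri (2 ℕ.* i)
  pe -[1+ i ] = suc (suc (2 ℕ.* i)) ℕ.* suc (suc (2 ℕ.* i)) ℕ.+ tri (suc (2 ℕ.* i))
  po (+ i)    = suc (2 ℕ.* i) ℕ.* suc (2 ℕ.* i) ℕ.+ tri (suc (2 ℕ.* i))
  po -[1+ i ] = suc (2 ℕ.* i) ℕ.* suc (2 ℕ.* i) ℕ.+ tri (2 ℕ.* i)

  module Theta (m : ℤ) (N : ℕ) where

    open Truncated m N public
    open FiniteIdentities seriesRing const-morphism public
    open CommutativeRing seriesRing public hiding (zero)
    open Algebra.Properties.Semiring.Exp semiring public using (_^_; ^-congˡ; ^-homo-*)
    open Algebra.Properties.Ring (CommutativeRing.ring seriesRing) public using (-0#≈0#)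
    open Relation.Binary.Reasoning.Setoid setoid

    -- Division by a series with constant term 1, the case of `⊛-cancel-on` in which the class
    -- consists of all exponents.
    unit-cancel : ∀ {u f g} → u 0 ≡ 1ℤ → u * f ≈ u * g → f ≈ g
    unit-cancel {u} {f} {g} u0 h = mk λ n n≤N → subst (m ∣_) (≡.trans (⊞-at f (- g) n) (cong (λ a → f n ℤ.+ a) (⊟-at g n)))
      (⊛-cancel-on (λ _ → ⊤) u (f - g) N u0 (λ _ _ _ _ _ → tt) (λ n n≤N _ → ≋𝟘⇒∣ zero-product n n≤N) n n≤N tt)
      where
      zero-product : u * (f - g) ≈ 0#
      zero-product = trans (solve 3 (λ u f g → u :* (f :- g) := u :* f :- u :* g) refl u f g)
        (trans (+-congʳ h) (-‿inverseʳ _))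

    monomial-vanish : ∀ a {e} → N ℕ.< e → monomial a e ≈ 0#
    monomial-vanish a {e} N<e = ∣⇒≋𝟘 λ n n≤N → subst (m ∣_) (≡.sym (monomial-≢ a {e} {n} (λ { ≡.refl → ℕ.<⇒≱ N<e n≤N }))) (divides 0ℤ ≡.refl)

    monomial-* : ∀ a b d e → monomial a d * monomial b e ≈ monomial (a ℤ.* b) (d ℕ.+ e)
    monomial-* a b d e = exact (monomial-⊛-monomial a b d e)

    q : ℕ → Series
    q = monomial 1ℤ

    q-^ : ∀ k n → q k ^ n ≈ monomial 1ℤ (n ℕ.* k)
    q-^ k zero    = exact one≡const
    q-^ k (suc n) = trans (*-congˡ (q-^ k n)) (monomial-* 1ℤ 1ℤ k (n ℕ.* k))

    q-^-≡ : ∀ {k l m n} → m ℕ.* k ≡ n ℕ.* l → q k ^ m ≈ q l ^ n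
    q-^-≡ {k} {l} {m} {n} eq = trans (q-^ k m) (trans (reflexive (cong (monomial 1ℤ) eq)) (sym (q-^ l n)))

    module _ {k} .{{_ : NonZero k}} where

      q-^-vanish : ∀ {n} → N ℕ.< n → q k ^ n ≈ 0#
      q-^-vanish {n} N<n = trans (q-^ k n) (monomial-vanish 1ℤ (ℕ.<-≤-trans N<n (ℕ.m≤m*n n k)))

      1-q-^ : ∀ {n} → N ℕ.< n → 1- q k ^ n ≈ 1#
      1-q-^ N<n = trans (+-congˡ (trans (-‿cong (q-^-vanish N<n)) -0#≈0#)) (+-identityʳ 1#)

    -- (qᵏ; qᵏ)_∞ and (qᵏ; q²ᵏ)_∞
    f O : ℕ → Series
    f k = ⟨ q k ⟩ N
    O k = odd (q k) N

    module _ (k : ℕ) .{{_ : NonZero k}} where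

      ⟨⟩-stable : ∀ n → N ℕ.≤ n → ⟨ q k ⟩ n ≈ f k
      ⟨⟩-stable = ∏<-stable (λ i N≤i → 1-q-^ (s≤s N≤i))

      odd-stable : ∀ n → N ℕ.≤ n → odd (q k) n ≈ O k
      odd-stable = ∏<-stable (λ i N≤i → 1-q-^ (s≤s (ℕ.≤-trans N≤i (ℕ.m≤m+n i (i ℕ.+ 0)))))

      even≈ : ∀ n → even (q k) n ≈ ⟨ q (2 ℕ.* k) ⟩ n
      even≈ n = ∏<-cong n (λ i _ → +-congˡ (-‿cong (q-^-≡ {k} {2 ℕ.* k} {suc (suc (2 ℕ.* i))} {suc i} (lemma i k))))
        where
        lemma : ∀ i k → suc (suc (2 ℕ.* i)) ℕ.* k ≡ suc i ℕ.* (2 ℕ.* k)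
        lemma = ℕ-solve-∀

    private
      1-q-^-constant : ∀ k .{{_ : NonZero k}} n → (1- q k ^ suc n) 0 ≡ 1ℤ
      1-q-^-constant (suc k) n = ≡.trans (⊞-at one (- (q (suc k) ^ suc n)) 0)
        (cong (λ a → 1ℤ ℤ.+ a) (≡.trans (⊟-at (q (suc k) ^ suc n) 0) (cong ℤ.-_ (⊛-zero (q (suc k)) (q (suc k) ^ n)))))

      ∏<-constant : ∀ {g : ℕ → Series} n → (∀ i → g i 0 ≡ 1ℤ) → ∏< g n 0 ≡ 1ℤ
      ∏<-constant     zero    h = ≡.refl
      ∏<-constant {g} (suc n) h = ≡.trans (⊛-zero (∏< g n) (g n)) (cong₂ ℤ._*_ (∏<-constant n h) (h n))

    ⟨⟩-unit : ∀ k .{{_ : NonZero k}} n → (⟨ q k ⟩ n) 0 ≡ 1ℤ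
    ⟨⟩-unit k n = ∏<-constant n (λ i → 1-q-^-constant k i)

    O-unit : ∀ k .{{_ : NonZero k}} → O k 0 ≡ 1ℤ
    O-unit k = ∏<-constant N (λ i → 1-q-^-constant k (2 ℕ.* i))

    -- Factors of odd and of even index; the latter make up the product in q²ᵏ.
    f-split : ∀ k .{{_ : NonZero k}} → f k ≈ O k * f (2 ℕ.* k)
    f-split k = trans (sym (⟨⟩-stable k (2 ℕ.* N) (ℕ.m≤m+n N _))) (trans (split N) (*-congˡ (even≈ k N)))
      where
      split : ∀ M → ⟨ q k ⟩ (2 ℕ.* M) ≈ odd (q k) M * even (q k) M
      split zero    = sym (*-identityˡ 1#)
      split (suc M) = begin
        ⟨ q k ⟩ (2 ℕ.* suc M)
          ≈⟨ reflexive (cong (⟨ q k ⟩_) (ℕ.+-suc (suc M) (M ℕ.+ 0))) ⟩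
        ⟨ q k ⟩ (2 ℕ.* M) * (1- q k ^ suc (2 ℕ.* M)) * (1- q k ^ suc (suc (2 ℕ.* M)))
          ≈⟨ *-congʳ (*-congʳ (split M)) ⟩
        odd (q k) M * even (q k) M * (1- q k ^ suc (2 ℕ.* M)) * (1- q k ^ suc (suc (2 ℕ.* M)))
          ≈⟨ solve 4 (λ o e a b → o :* e :* a :* b := o :* a :* (e :* b)) refl _ _ _ _ ⟩
        odd (q k) (suc M) * even (q k) (suc M) ∎

    -- Theta series

    -- Beyond ± L all the exponents used below exceed N.
    L : ℕ
    L = suc N

    Σᶻ : (ℤ → Series) → List ℤ → Series
    Σᶻ F []       = 0#
    Σᶻ F (a ∷ as) = F a + Σᶻ F as

    θ : (ℤ → ℤ) → (ℤ → ℕ) → Series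
    θ w ε = Σᶻ (λ a → monomial (w a) (ε a)) (integers L)


    Σᶻ-cong : ∀ {F G} → (∀ a → F a ≈ G a) → ∀ as → Σᶻ F as ≈ Σᶻ G as
    Σᶻ-cong h []       = refl
    Σᶻ-cong h (a ∷ as) = +-cong (h a) (Σᶻ-cong h as)

    Σ<-code : ∀ g K → Σ< g (2 ℕ.* K) ≈ Σᶻ (g ∘ code) (integers K)
    Σ<-code g zero    = refl
    Σ<-code g (suc K) = begin
      Σ< g (2 ℕ.* suc K)                                            ≈⟨ reflexive (cong (Σ< g) (ℕ.+-suc (suc K) (K ℕ.+ 0))) ⟩
      Σ< g (2 ℕ.* K) + g (2 ℕ.* K) + g (suc (2 ℕ.* K))              ≈⟨ +-congʳ (+-congʳ (Σ<-code g K)) ⟩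
      Σᶻ (g ∘ code) (integers K) + g (2 ℕ.* K) + g (suc (2 ℕ.* K))  ≈⟨ solve 3 (λ S a b → S :+ a :+ b := a :+ (b :+ S)) refl _ _ _ ⟩
      Σᶻ (g ∘ code) (integers (suc K))                              ∎

    -- `J` absorbs the sign of Jacobi's ∑ (-1)^i (2i + 1) q^(tri i) over i ≥ 0, because (-1)^i (2i +
    -- 1) = 4a + 1 for i = `code a`. `Pe` and `Po` are the parts of Euler's series with positive and
    -- with negative sign.
    ψ J Pe Po : ℕ → Series
    ψ k  = θ (λ _ → 1ℤ) (λ a → e a ℕ.* k)
    J k  = θ (λ a → + 4 ℤ.* a ℤ.+ 1ℤ) (λ a → e a ℕ.* k)
    Pe k = θ (λ _ → 1ℤ) (λ s → pe s ℕ.* k)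
    Po k = θ (λ _ → 1ℤ) (λ s → po s ℕ.* k)

    sgn-even : ∀ K → sgn (2 ℕ.* K) ≈ 1#
    sgn-even zero    = refl
    sgn-even (suc K) = trans (reflexive (cong sgn (ℕ.+-suc (suc K) (K ℕ.+ 0)))) (trans (solve 1 (λ s → :- :- s := s) refl _) (sgn-even K))

    module _ (k : ℕ) .{{_ : NonZero k}} where

      gauss : O k * ψ k ≈ f (2 ℕ.* k)
      gauss = begin
        O k * ψ k
          ≈⟨ *-cong (sym (odd-stable k L (ℕ.n≤1+n N))) (trans (Σᶻ-cong (λ a → sym (q-^ k (e a))) (integers L)) (sym (Σ<-code (λ s → q k ^ tri s) L))) ⟩
        odd (q k) L * Σ< (λ s → q k ^ tri s) (2 ℕ.* L)
          ≈⟨ gauss-finite (q k) L ⟩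
        -- For s ≥ 1 the exponent is at least 2L + 1 > N. Only s = 0 is left, where the mix consists
        -- of the even factors.
        _ ≈⟨ Σ<-stable {M = 1} (λ s 1≤s → trans (*-congˡ (q-^-vanish (large s 1≤s))) (zeroʳ _)) L (s≤s z≤n) ⟩
        _ ≈⟨ trans (+-identityˡ _) (*-identityʳ _) ⟩
        _ ≈⟨ mix-zero (λ i → 1- q k ^ suc (2 ℕ.* i)) (λ i → 1- q k ^ suc (suc (2 ℕ.* i))) L ⟩
        even (q k) L
          ≈⟨ even≈ k L ⟩
        ⟨ q (2 ℕ.* k) ⟩ L
          ≈⟨ ⟨⟩-stable (2 ℕ.* k) {{ℕ.m*n≢0 2 k}} L (ℕ.n≤1+n N) ⟩
        f (2 ℕ.* k) ∎
        where
        large : ∀ s → 1 ℕ.≤ s → N ℕ.< s ℕ.* suc (2 ℕ.* L)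
        large s 1≤s = ℕ.≤-trans (ℕ.≤-trans (ℕ.m≤m+n L (L ℕ.+ 0)) (ℕ.n≤1+n _)) (ℕ.m≤n*m _ s {{ℕ.>-nonZero 1≤s}})

      pentagonal : f k ≈ Pe k - Po k
      pentagonal = begin
        f k
          ≈⟨ sym (⟨⟩-stable k (2 ℕ.* L) (ℕ.≤-trans (ℕ.n≤1+n N) (ℕ.m≤m+n L _))) ⟩
        ⟨ q k ⟩ (2 ℕ.* L)
          ≈⟨ sym (mix-zero (λ _ → 1#) (λ i → 1- q k ^ suc i) (2 ℕ.* L)) ⟩
        _ ≈⟨ sym (trans (+-identityˡ _) (trans (*-cong (*-identityˡ _) (^-≡ (q k) (≡.trans (ℕ.+-identityʳ _) (ℕ.*-zeroʳ (2 ℕ.* L))))) (*-identityʳ _))) ⟩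
        _ ≈⟨ sym (Σ<-stable {M = 1} (λ s 1≤s → trans (*-congˡ (q-^-vanish (large s 1≤s))) (zeroʳ _)) (suc (2 ℕ.* L)) (s≤s z≤n)) ⟩
        _ ≈⟨ sym (pentagonal-finite (q k) (2 ℕ.* L)) ⟩
        pentagonal-sum (q k) (2 ℕ.* L)
          ≈⟨ regroup L ⟩
        -- The interval of summation is not symmetric: the pentagonal number of index 2L lies
        -- outside it and falls to the truncation.
        Σᶻ E (integers L) - Σᶻ D (integers L) + q k ^ pe (+ L)
          ≈⟨ trans (+-congˡ (q-^-vanish top)) (+-identityʳ _) ⟩
        Σᶻ E (integers L) - Σᶻ D (integers L)
          ≈⟨ +-cong (Σᶻ-cong (λ a → q-^ k (pe a)) (integers L)) (-‿cong (Σᶻ-cong (λ a → q-^ k (po a)) (integers L))) ⟩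
        Pe k - Po k ∎
        where
        L≤2L = ℕ.m≤m+n L (L ℕ.+ 0)
        large : ∀ s → 1 ℕ.≤ s → N ℕ.< 2 ℕ.* L ℕ.* s ℕ.+ tri s
        large s 1≤s = ℕ.≤-trans L≤2L (ℕ.≤-trans (ℕ.m≤m*n (2 ℕ.* L) s {{ℕ.>-nonZero 1≤s}}) (ℕ.m≤m+n _ (tri s)))
        top : N ℕ.< pe (+ L)
        top = ℕ.≤-trans L≤2L (ℕ.≤-trans (ℕ.m≤m*n (2 ℕ.* L) (2 ℕ.* L)) (ℕ.m≤m+n _ (tri (2 ℕ.* L))))
        E D : ℤ → Series
        E a = q k ^ pe a
        D a = q k ^ po a
        regroup : ∀ K → pentagonal-sum (q k) (2 ℕ.* K) ≈ Σᶻ E (integers K) - Σᶻ D (integers K) + q k ^ pe (+ K)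
        regroup zero    = sym (trans (+-congʳ (-‿inverseʳ 0#)) (+-identityˡ 1#))
        regroup (suc K) = begin
          pentagonal-sum (q k) (2 ℕ.* suc K)
            ≈⟨ reflexive (cong (pentagonal-sum (q k)) (ℕ.+-suc (suc K) (K ℕ.+ 0))) ⟩
          pentagonal-sum (q k) (2 ℕ.* K) + - sgn (2 ℕ.* K) * (D -[1+ K ] + D (+ K)) + - - sgn (2 ℕ.* K) * (E -[1+ K ] + next)
            ≈⟨ +-cong (+-cong (regroup K) (*-congʳ (-‿cong (sgn-even K)))) (*-cong (-‿cong (-‿cong (sgn-even K))) (+-congˡ (^-≡ (q k) (cong (λ i → i ℕ.* i ℕ.+ tri i) (≡.sym (ℕ.+-suc (suc K) (K ℕ.+ 0))))))) ⟩
          Σᶻ E (integers K) - Σᶻ D (integers K) + E (+ K) + - 1# * (D -[1+ K ] + D (+ K)) + - - 1# * (E -[1+ K ] + E (+ suc K))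
            ≈⟨ solve 7 (λ S T a b c d z → S :- T :+ a :+ :- :1 :* (d :+ c) :+ :- :- :1 :* (b :+ z) := (a :+ (b :+ S)) :- (c :+ (d :+ T)) :+ z) refl
                 (Σᶻ E (integers K)) (Σᶻ D (integers K)) (E (+ K)) (E -[1+ K ]) (D (+ K)) (D -[1+ K ]) (E (+ suc K)) ⟩
          Σᶻ E (integers (suc K)) - Σᶻ D (integers (suc K)) + E (+ suc K) ∎
          where
          next : Series
          next = q k ^ (suc (suc (2 ℕ.* K)) ℕ.* suc (suc (2 ℕ.* K)) ℕ.+ tri (suc (suc (2 ℕ.* K))))

      private
        n₀ : ℕ
        n₀ = 2 ℕ.* N

        N≤n₀ : N ℕ.≤ n₀
        N≤n₀ = ℕ.m≤m+n N (N ℕ.+ 0)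

      -- In the limit the Gaussian binomial coefficient is the inverse of `f k`. With n₀ = 2N,
      -- either i ≤ N and both products in `jtp-closed` are long enough to equal `f k`, one of which
      -- is cancelled, or i > N and both sides vanish since tri i ≥ i.
      jtp-limit : ∀ i → i ℕ.≤ n₀ → f k * jtp (q k) n₀ i ≈ q k ^ tri i
      jtp-limit i i≤n₀ with i ℕ.≤? N
      ... | yes i≤N = unit-cancel {f k} (⟨⟩-unit k N) (begin
        f k * (f k * D)
          ≈⟨ solve 2 (λ f d → f :* (f :* d) := d :* (f :* f)) refl (f k) D ⟩
        D * (f k * f k)
          ≈⟨ *-congˡ (sym (*-cong (⟨⟩-stable k M (ℕ.<⇒≤ N<M)) (⟨⟩-stable k (suc (n₀ ℕ.+ i)) (ℕ.≤-trans N≤n₀ (ℕ.m≤n⇒m≤1+n (ℕ.m≤m+n n₀ i)))))) ⟩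
        D * (⟨ q k ⟩ M * ⟨ q k ⟩ suc (n₀ ℕ.+ i))
          ≈⟨ jtp-closed (q k) n₀ i M (ℕ.m∸n+n≡m (ℕ.m≤n⇒m≤1+n i≤n₀)) ⟩
        q k ^ tri i * ((1- q k ^ M) * ⟨ q k ⟩ suc (2 ℕ.* n₀))
          ≈⟨ *-congˡ (*-cong (1-q-^ N<M) (⟨⟩-stable k (suc (2 ℕ.* n₀)) (ℕ.≤-trans N≤n₀ (ℕ.m≤n⇒m≤1+n (ℕ.m≤m+n n₀ _))))) ⟩
        q k ^ tri i * (1# * f k)
          ≈⟨ solve 2 (λ x f → x :* (:1 :* f) := f :* x) refl _ _ ⟩
        f k * q k ^ tri i ∎)
        where
        M : ℕ
        M = suc n₀ ℕ.∸ i
        D : Series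
        D = jtp (q k) n₀ i
        N<M : N ℕ.< M
        N<M = subst (ℕ._≤ M) (≡.trans (ℕ.+-∸-assoc 1 {n₀} N≤n₀) (cong suc (≡.trans (ℕ.m+n∸m≡n N (N ℕ.+ 0)) (ℕ.+-identityʳ N)))) (ℕ.∸-monoʳ-≤ (suc n₀) i≤N)
      ... | no i≰N = trans (trans (*-congˡ D≈0) (zeroʳ _)) (sym tri≈0)
        where
        M : ℕ
        M = suc n₀ ℕ.∸ i
        tri≈0 : q k ^ tri i ≈ 0#
        tri≈0 = q-^-vanish (ℕ.<-≤-trans (ℕ.≰⇒> i≰N) (n≤tri i))
        D≈0 : jtp (q k) n₀ i ≈ 0#
        D≈0 = unit-cancel {⟨ q k ⟩ M * ⟨ q k ⟩ suc (n₀ ℕ.+ i)}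
          (≡.trans (⊛-zero (⟨ q k ⟩ M) (⟨ q k ⟩ suc (n₀ ℕ.+ i))) (cong₂ ℤ._*_ (⟨⟩-unit k M) (⟨⟩-unit k (suc (n₀ ℕ.+ i)))))
          (trans (*-comm _ _) (trans (jtp-closed (q k) n₀ i M (ℕ.m∸n+n≡m (ℕ.m≤n⇒m≤1+n i≤n₀)))
            (trans (trans (*-congʳ tri≈0) (zeroˡ _)) (sym (zeroʳ _)))))

      -- Two factors `f k` become the weighted sum, and the third turns each `jtp` in it into its
      -- limit.
      jacobi : f k * f k * f k ≈ J k
      jacobi = begin
        f k * f k * f k
          ≈⟨ trans (*-comm _ _) (*-congˡ (sym (*-cong (⟨⟩-stable k n₀ N≤n₀) (⟨⟩-stable k n₀ N≤n₀)))) ⟩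
        f k * (⟨ q k ⟩ n₀ * ⟨ q k ⟩ n₀)
          ≈⟨ *-congˡ (sym (weighted-sum (q k) n₀ n₀ ℕ.≤-refl)) ⟩
        f k * Σ< (λ i → sgn i * oddNumber i * jtp (q k) n₀ i) (suc n₀)
          ≈⟨ *-Σ< (f k) _ (suc n₀) ⟩
        Σ< (λ i → f k * (sgn i * oddNumber i * jtp (q k) n₀ i)) (suc n₀)
          ≈⟨ Σ<-cong (suc n₀) (λ { i (s≤s i≤n₀) → trans (solve 3 (λ f c d → f :* (c :* d) := c :* (f :* d)) refl (f k) (sgn i * oddNumber i) (jtp (q k) n₀ i)) (*-congˡ (jtp-limit i i≤n₀)) }) ⟩
        Σ< term (suc n₀)
          ≈⟨ Σ<-stable vanish (suc n₀) (s≤s N≤n₀) ⟩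
        Σ< term L
          ≈⟨ sym (Σ<-stable vanish (2 ℕ.* L) (ℕ.m≤m+n L (L ℕ.+ 0))) ⟩
        Σ< term (2 ℕ.* L)
          ≈⟨ Σ<-code term L ⟩
        Σᶻ (term ∘ code) (integers L)
          ≈⟨ Σᶻ-cong signed (integers L) ⟩
        J k ∎
        where
        term : ℕ → Series
        term i = sgn i * oddNumber i * q k ^ tri i
        vanish : ∀ i → L ℕ.≤ i → term i ≈ 0#
        vanish i L≤i = trans (*-congˡ (q-^-vanish (ℕ.<-≤-trans L≤i (n≤tri i)))) (zeroʳ _)
        two : 1# + 1# ≈ const (+ 2)
        two = trans (+-cong (exact one≡const) (exact one≡const)) (sym (const-+ 1ℤ 1ℤ))
        oddNumber≈ : ∀ i → oddNumber i ≈ const (+ suc (2 ℕ.* i))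
        oddNumber≈ zero    = exact one≡const
        oddNumber≈ (suc i) = trans (+-cong (oddNumber≈ i) two) (trans (sym (const-+ (+ suc (2 ℕ.* i)) (+ 2)))
          (reflexive (cong (λ j → const (+ j)) (lemma i))))
          where
          lemma : ∀ i → suc (2 ℕ.* i) ℕ.+ 2 ≡ suc (2 ℕ.* suc i)
          lemma = ℕ-solve-∀
        weight : ∀ a → sgn (code a) * oddNumber (code a) ≈ const (+ 4 ℤ.* a ℤ.+ 1ℤ)
        weight (+ i) = trans (*-congʳ (sgn-even i)) (trans (*-identityˡ _) (trans (oddNumber≈ (2 ℕ.* i)) (reflexive (cong const
          (≡.trans (cong +_ (≡.trans (≡.sym (ℕ.+-comm _ 1)) (cong (ℕ._+ 1) (≡.sym (ℕ.*-assoc 2 2 i))))) (cong (λ a → a ℤ.+ 1ℤ) (ℤ.pos-* 4 i)))))))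
        weight -[1+ i ] = trans (*-cong (-‿cong (sgn-even i)) (oddNumber≈ (suc (2 ℕ.* i)))) (trans (solve 1 (λ c → :- :1 :* c := :- c) refl _)
          (trans (sym (const-neg (+ suc (2 ℕ.* suc (2 ℕ.* i))))) (reflexive (cong const (lemma i)))))
          where
          lemma : ∀ i → ℤ.- (+ suc (2 ℕ.* suc (2 ℕ.* i))) ≡ + 4 ℤ.* -[1+ i ] ℤ.+ 1ℤ
          lemma i = ≡.trans (cong (λ j → ℤ.- (+ j)) (expand i)) (≡.sym (≡.trans (cong (λ j → j ℤ.+ 1ℤ) (≡.sym (ℤ.neg-distribʳ-* (+ 4) (+ suc i)))) (≡.trans (cong (λ j → ℤ.- j ℤ.+ 1ℤ) (≡.sym (ℤ.pos-* 4 (suc i)))) (cong (λ j → ℤ.- (+ j) ℤ.+ 1ℤ) (expand′ i)))))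
            where
            expand : ∀ i → suc (2 ℕ.* suc (2 ℕ.* i)) ≡ suc (suc (suc (4 ℕ.* i)))
            expand = ℕ-solve-∀
            expand′ : ∀ i → 4 ℕ.* suc i ≡ suc (suc (suc (suc (4 ℕ.* i))))
            expand′ = ℕ-solve-∀
        signed : ∀ a → term (code a) ≈ monomial (+ 4 ℤ.* a ℤ.+ 1ℤ) (e a ℕ.* k)
        signed a = trans (*-cong (weight a) (q-^ k (e a))) (trans (monomial-* _ 1ℤ 0 (e a ℕ.* k)) (reflexive (cong (λ w → monomial w (e a ℕ.* k)) (ℤ.*-identityʳ _))))

  -- The defining product and its reductions modulo 5 and 2

  isOdd-odd : ∀ M → isOdd (suc (2 ℕ.* M)) ≡ true
  isOdd-odd M = cong (ℕ._≡ᵇ 1) (≡.trans (cong (λ i → suc i ℕ.% 2) (ℕ.*-comm 2 M)) (ℕ.[m+kn]%n≡m%n 1 M 2))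

  isOdd-even : ∀ M → isOdd (suc (suc (2 ℕ.* M))) ≡ false
  isOdd-even M = cong (ℕ._≡ᵇ 1) (≡.trans (cong (λ i → suc (suc i) ℕ.% 2) (ℕ.*-comm 2 M)) (ℕ.[m+kn]%n≡m%n 2 M 2))

  private
    block-% : ∀ r M → (r ℕ.+ 10 ℕ.* M) ℕ.% 5 ≡ r ℕ.% 5
    block-% r M = ≡.trans (cong (λ i → (r ℕ.+ i) ℕ.% 5) (lemma M)) (ℕ.[m+kn]%n≡m%n r (2 ℕ.* M) 5)
      where
      lemma : ∀ M → 10 ℕ.* M ≡ 2 ℕ.* M ℕ.* 5
      lemma = ℕ-solve-∀

    block-/ : ∀ r M → (r ℕ.+ 10 ℕ.* M) ℕ./ 5 ≡ r ℕ./ 5 ℕ.+ 2 ℕ.* M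
    block-/ r M = ≡.trans (cong (λ i → (r ℕ.+ i) ℕ./ 5) (lemma M))
      (≡.trans (ℕ.+-distrib-/-∣ʳ r (ℕ.divides-refl (2 ℕ.* M))) (cong (λ i → r ℕ./ 5 ℕ.+ i) (ℕ.m*n/n≡m (2 ℕ.* M) 5)))
      where
      lemma : ∀ M → 10 ℕ.* M ≡ 2 ℕ.* M ℕ.* 5
      lemma = ℕ-solve-∀

    isOddMultiple-block : ∀ r M → isOddMultiple 5 (r ℕ.+ 10 ℕ.* M) ≡ (r ℕ.% 5 ℕ.≡ᵇ 0) ∧ isOdd (r ℕ./ 5 ℕ.+ 2 ℕ.* M)
    isOddMultiple-block r M = cong₂ (λ a b → (a ℕ.≡ᵇ 0) ∧ isOdd b) (block-% r M) (block-/ r M)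

  module Products (m : ℤ) (N : ℕ) where

    open Theta m N public
    open Relation.Binary.Reasoning.Setoid setoid

    const-vanish : ∀ {a} → m ∣ a → const a ≈ 0#
    const-vanish m∣a = ∣⇒≋𝟘 λ { zero _ → m∣a ; (suc _) _ → divides 0ℤ ≡.refl }

    module _ (k : ℕ) .{{_ : NonZero k}} where

      -- Factor by factor, (1 - y)² = 1 - y² + 2(y² - y).
      frobenius₂ : m ∣ + 2 → f k * f k ≈ f (2 ℕ.* k)
      frobenius₂ m∣2 = trans (sym (∏<-* _ _ N)) (∏<-cong N λ i _ → begin
        (1- q k ^ suc i) * (1- q k ^ suc i)
          ≈⟨ solve 1 (λ y → (:1 :- y) :* (:1 :- y) := :1 :- y :* y :+ con (+ 2) :* (y :* y :- y)) refl (q k ^ suc i) ⟩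
        1# - q k ^ suc i * q k ^ suc i + const (+ 2) * (q k ^ suc i * q k ^ suc i - q k ^ suc i)
          ≈⟨ trans (+-congˡ (trans (*-congʳ (const-vanish m∣2)) (zeroˡ _))) (+-identityʳ _) ⟩
        1# - q k ^ suc i * q k ^ suc i
          ≈⟨ +-congˡ (-‿cong (trans (sym (^-homo-* (q k) (suc i) (suc i))) (q-^-≡ {k} {2 ℕ.* k} {suc i ℕ.+ suc i} {suc i} (lemma i k)))) ⟩
        1- q (2 ℕ.* k) ^ suc i ∎)
        where
        lemma : ∀ i k → (suc i ℕ.+ suc i) ℕ.* k ≡ suc i ℕ.* (2 ℕ.* k)
        lemma = ℕ-solve-∀

      frobenius₅ : m ∣ + 5 → f k * (f k * (f k * (f k * f k))) ≈ f (5 ℕ.* k)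
      frobenius₅ m∣5 = trans (*-congˡ (*-congˡ (*-congˡ (sym (∏<-* _ _ N))))) (trans (*-congˡ (*-congˡ (sym (∏<-* _ _ N))))
        (trans (*-congˡ (sym (∏<-* _ _ N))) (trans (sym (∏<-* _ _ N)) (∏<-cong N λ i _ → factor i))))
        where
        lemma : ∀ i k → (suc i ℕ.+ (suc i ℕ.+ (suc i ℕ.+ (suc i ℕ.+ suc i)))) ℕ.* k ≡ suc i ℕ.* (5 ℕ.* k)
        lemma = ℕ-solve-∀
        factor : ∀ i → let a = 1- q k ^ suc i in a * (a * (a * (a * a))) ≈ 1- q (5 ℕ.* k) ^ suc i
        factor i = begin
          (1# - y) * ((1# - y) * ((1# - y) * ((1# - y) * (1# - y))))
            ≈⟨ solve 1 (λ y → (:1 :- y) :* ((:1 :- y) :* ((:1 :- y) :* ((:1 :- y) :* (:1 :- y))))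
                 := :1 :- y :* (y :* (y :* (y :* y))) :+ con (+ 5) :* (y :* y :+ y :* y :+ y :* y :* (y :* y) :- y :- y :* y :* y :- y :* y :* y)) refl y ⟩
          1# - y * (y * (y * (y * y))) + const (+ 5) * (y * y + y * y + y * y * (y * y) - y - y * y * y - y * y * y)
            ≈⟨ trans (+-congˡ (trans (*-congʳ (const-vanish m∣5)) (zeroˡ _))) (+-identityʳ _) ⟩
          1# - y * (y * (y * (y * y)))
            ≈⟨ +-congˡ (-‿cong (trans (sym (trans (h 4) (*-congˡ (trans (h 3) (*-congˡ (trans (h 2) (*-congˡ (h 1)))))))) (q-^-≡ {k} {5 ℕ.* k} {suc i ℕ.+ (suc i ℕ.+ (suc i ℕ.+ (suc i ℕ.+ suc i)))} {suc i} (lemma i k)))) ⟩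
          1- q (5 ℕ.* k) ^ suc i ∎
          where
          y : Series
          y = q k ^ suc i
          times : ℕ → ℕ
          times zero          = 0
          times (suc zero)    = suc i
          times (suc (suc n)) = suc i ℕ.+ times (suc n)
          h : ∀ n → q k ^ (suc i ℕ.+ times n) ≈ y * q k ^ times n
          h n = ^-homo-* (q k) (suc i) (times n)

    private
      g : (ℕ → Bool) → ℕ → Series
      g P i = if P (suc i) then 1# - q (suc i) else 1#

      g-stable : ∀ P n → N ℕ.≤ n → ∏< (g P) n ≈ ∏< (g P) N
      g-stable P = ∏<-stable lemma
        where
        lemma : ∀ i → N ℕ.≤ i → g P i ≈ 1#
        lemma i N≤i with P (suc i)
        ... | false = refl
        ... | true  = trans (+-congˡ (trans (-‿cong (monomial-vanish 1ℤ (s≤s N≤i))) -0#≈0#)) (+-identityʳ _)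

      g-true : ∀ P i → P (suc i) ≡ true → g P i ≈ 1# - q (suc i)
      g-true P i h rewrite h = refl

      g-false : ∀ P i → P (suc i) ≡ false → g P i ≈ 1#
      g-false P i h rewrite h = refl

      ∏<-skip : ∀ P i → P (suc i) ≡ false → ∏< (g P) (suc i) ≈ ∏< (g P) i
      ∏<-skip P i h = trans (*-congˡ (g-false P i h)) (*-identityʳ _)

      1-q-suc : ∀ k {j} i → j ≡ i ℕ.* k → 1# - q j ≈ 1- q k ^ i
      1-q-suc k i eq = +-congˡ (-‿cong (trans (reflexive (cong q eq)) (sym (q-^ k i))))

      multiply : ∀ (P : ℕ → Bool) n c → (if P (suc n) then mulFactor (suc n) c else c) ≈ c * g P n
      multiply P n c with P (suc n)
      ... | true  = trans (exact (mulFactor-⊛ (suc n) c)) (*-comm _ _)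
      ... | false = sym (*-identityʳ c)

      P₁ P₅ : ℕ → Bool
      P₁ = isOdd
      P₅ = isOddMultiple 5

      partialProd≈ : ∀ n → partialProd 5 n ≈ ∏< (g P₁) n * ∏< (g P₅) n
      partialProd≈ zero    = sym (*-identityˡ 1#)
      partialProd≈ (suc n) = begin
        partialProd 5 (suc n)
          ≈⟨ multiply P₅ n (if isOdd (suc n) then mulFactor (suc n) (partialProd 5 n) else partialProd 5 n) ⟩
        (if isOdd (suc n) then mulFactor (suc n) (partialProd 5 n) else partialProd 5 n) * g P₅ n
          ≈⟨ *-congʳ (trans (multiply P₁ n (partialProd 5 n)) (*-congʳ (partialProd≈ n))) ⟩
        ∏< (g P₁) n * ∏< (g P₅) n * g P₁ n * g P₅ n
          ≈⟨ solve 4 (λ a b c d → a :* b :* c :* d := a :* c :* (b :* d)) refl _ _ _ _ ⟩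
        ∏< (g P₁) (suc n) * ∏< (g P₅) (suc n) ∎

      odd₁ : ∀ M → ∏< (g P₁) (2 ℕ.* M) ≈ odd (q 1) M
      odd₁ zero    = refl
      odd₁ (suc M) = begin
        ∏< (g P₁) (2 ℕ.* suc M)
          ≈⟨ reflexive (cong (∏< (g P₁)) (ℕ.+-suc (suc M) (M ℕ.+ 0))) ⟩
        ∏< (g P₁) (suc (suc (2 ℕ.* M)))
          ≈⟨ ∏<-skip P₁ (suc (2 ℕ.* M)) (isOdd-even M) ⟩
        ∏< (g P₁) (suc (2 ℕ.* M))
          ≈⟨ *-cong (odd₁ M) (trans (g-true P₁ (2 ℕ.* M) (isOdd-odd M)) (1-q-suc 1 (suc (2 ℕ.* M)) (≡.sym (ℕ.*-identityʳ _)))) ⟩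
        odd (q 1) (suc M) ∎

      -- Of the ten exponents from 10M + 1 to 10M + 10 only 10M + 5 is an odd multiple of 5, hence
      -- the induction by blocks of ten.
      odd₅ : ∀ M → ∏< (g P₅) (10 ℕ.* M) ≈ odd (q 5) M
      odd₅ zero    = refl
      odd₅ (suc M) = begin
        ∏< (g P₅) (10 ℕ.* suc M)
          ≈⟨ reflexive (cong (∏< (g P₅)) (ℕ.*-suc 10 M)) ⟩
        ∏< (g P₅) (10 ℕ.+ 10 ℕ.* M)
          ≈⟨ skip 9 (≡.trans (isOddMultiple-block 10 M) (isOdd-even M)) ⟩
        _ ≈⟨ skip 8 (isOddMultiple-block 9 M) ⟩
        _ ≈⟨ skip 7 (isOddMultiple-block 8 M) ⟩
        _ ≈⟨ skip 6 (isOddMultiple-block 7 M) ⟩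
        _ ≈⟨ skip 5 (isOddMultiple-block 6 M) ⟩
        ∏< (g P₅) (5 ℕ.+ 10 ℕ.* M)
          ≈⟨ *-cong (trans (skip 3 (isOddMultiple-block 4 M)) (trans (skip 2 (isOddMultiple-block 3 M)) (trans (skip 1 (isOddMultiple-block 2 M)) (trans (skip 0 (isOddMultiple-block 1 M)) (odd₅ M)))))
               (trans (g-true P₅ (4 ℕ.+ 10 ℕ.* M) (≡.trans (isOddMultiple-block 5 M) (isOdd-odd M))) (1-q-suc 5 (suc (2 ℕ.* M)) (lemma M))) ⟩
        odd (q 5) (suc M) ∎
        where
        skip : ∀ r → P₅ (suc r ℕ.+ 10 ℕ.* M) ≡ false → ∏< (g P₅) (suc r ℕ.+ 10 ℕ.* M) ≈ ∏< (g P₅) (r ℕ.+ 10 ℕ.* M)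
        skip r = ∏<-skip P₅ (r ℕ.+ 10 ℕ.* M)
        lemma : ∀ M → suc (4 ℕ.+ 10 ℕ.* M) ≡ suc (2 ℕ.* M) ℕ.* 5
        lemma = ℕ-solve-∀

    partialProd-limit : partialProd 5 N ≈ O 1 * O 5
    partialProd-limit = begin
      partialProd 5 N
        ≈⟨ partialProd≈ N ⟩
      ∏< (g P₁) N * ∏< (g P₅) N
        -- Factors beyond `N` are 1, so both products may be extended to whole blocks, of two and of
        -- ten factors.
        ≈⟨ *-cong (sym (g-stable P₁ (2 ℕ.* N) (ℕ.m≤n*m N 2))) (sym (g-stable P₅ (10 ℕ.* N) (ℕ.m≤n*m N 10))) ⟩
      ∏< (g P₁) (2 ℕ.* N) * ∏< (g P₅) (10 ℕ.* N)
        ≈⟨ *-cong (odd₁ N) (odd₅ N) ⟩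
      O 1 * O 5 ∎

    -- O 1 f₁₀ ≈ O 1 f₂⁵ ≈ f₁ f₂⁴ ≈ f₁³ ψ², using f₂ ≈ O 1 ψ twice.
    mod-5-theta : m ∣ + 5 → O 1 * O 5 * ψ 5 ≈ J 1 * (ψ 1 * ψ 1)
    mod-5-theta m∣5 = begin
      O 1 * O 5 * ψ 5
        ≈⟨ trans (*-assoc _ _ _) (*-congˡ (gauss 5)) ⟩
      O 1 * f 10
        ≈⟨ *-congˡ (sym (frobenius₅ 2 m∣5)) ⟩
      O 1 * (f 2 * (f 2 * (f 2 * (f 2 * f 2))))
        ≈⟨ solve 2 (λ o f → o :* (f :* (f :* (f :* (f :* f)))) := o :* f :* (f :* f) :* (f :* f)) refl (O 1) (f 2) ⟩
      O 1 * f 2 * (f 2 * f 2) * (f 2 * f 2)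
        ≈⟨ *-congˡ (sym (*-cong (gauss 1) (gauss 1))) ⟩
      O 1 * f 2 * (f 2 * f 2) * (O 1 * ψ 1 * (O 1 * ψ 1))
        ≈⟨ solve 3 (λ o f p → o :* f :* (f :* f) :* (o :* p :* (o :* p)) := o :* f :* (o :* f) :* (o :* f) :* (p :* p)) refl (O 1) (f 2) (ψ 1) ⟩
      O 1 * f 2 * (O 1 * f 2) * (O 1 * f 2) * (ψ 1 * ψ 1)
        ≈⟨ *-congʳ (sym (*-cong (*-cong (f-split 1) (f-split 1)) (f-split 1))) ⟩
      f 1 * f 1 * f 1 * (ψ 1 * ψ 1)
        ≈⟨ *-congʳ (jacobi 1) ⟩
      J 1 * (ψ 1 * ψ 1) ∎

    P : ℕ → Series
    P k = Pe k + Po k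

    pentagonal₂ : m ∣ + 2 → ∀ k .{{_ : NonZero k}} → f k ≈ P k
    pentagonal₂ m∣2 k = trans (pentagonal k) (trans (solve 2 (λ a b → a :- b := a :+ b :+ con (+ 2) :* (:- b)) refl (Pe k) (Po k))
      (trans (+-congˡ (trans (*-congʳ (const-vanish m∣2)) (zeroˡ _))) (+-identityʳ _)))

    -- Using f₄ ≡ f₂², O 5 f₁₀ = f₅ and O 1 f₂ = f₁ leaves f₁ f₂ f₅. Here f₁ f₂ ≡ ψ, because f₂ ≡
    -- f₁² in ψ = f₂²/f₁, and the signs of Euler's series for f₅ are invisible modulo 2.
    mod-2-theta : m ∣ + 2 → f 4 * (O 1 * O 5 * f 10) ≈ ψ 1 * P 5
    mod-2-theta m∣2 = begin
      f 4 * (O 1 * O 5 * f 10)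
        ≈⟨ *-cong (sym (frobenius₂ 2 m∣2)) (*-assoc _ _ _) ⟩
      f 2 * f 2 * (O 1 * (O 5 * f 10))
        ≈⟨ *-congˡ (*-congˡ (sym (f-split 5))) ⟩
      f 2 * f 2 * (O 1 * f 5)
        ≈⟨ solve 3 (λ o f g → f :* f :* (o :* g) := o :* f :* f :* g) refl (O 1) (f 2) (f 5) ⟩
      O 1 * f 2 * f 2 * f 5
        ≈⟨ *-cong (trans (*-congʳ (sym (f-split 1))) f₁f₂) (pentagonal₂ m∣2 5) ⟩
      ψ 1 * P 5 ∎
      where
      f₁f₂ : f 1 * f 2 ≈ ψ 1
      f₁f₂ = unit-cancel (O-unit 1) (begin
        O 1 * (f 1 * f 2)  ≈⟨ solve 3 (λ o a b → o :* (a :* b) := a :* (o :* b)) refl _ _ _ ⟩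
        f 1 * (O 1 * f 2)  ≈⟨ *-congˡ (sym (f-split 1)) ⟩
        f 1 * f 1          ≈⟨ frobenius₂ 1 m∣2 ⟩
        f 2                ≈⟨ sym (gauss 1) ⟩
        O 1 * ψ 1          ∎)

module Congruences where

  open PowerSeries
  open ThetaSeries
  open import Data.Integer using (_+_; _*_; _-_; -_; ∣_∣)
  open import Relation.Binary.PropositionalEquality using (_≢_; refl; sym; trans)
  open import Data.Integer.Divisibility.Signed using (_∣_; divides; ∣-trans; ∣m∣n⇒∣m+n; ∣m∣n⇒∣m-n; ∣m⇒∣-m; ∣m⇒∣m*n; ∣n⇒∣m*n; *-cancelʳ-∣; _∣?_; ∣⇒∣ᵤ; ∣ᵤ⇒∣)

  private variable
    X Y : Set

  -- Finite sums and changes of variables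

  Σˡ : (X → ℤ) → List X → ℤ
  Σˡ f []       = 0ℤ
  Σˡ f (x ∷ xs) = f x + Σˡ f xs

  Σˡ-cong : ∀ {f g : X → ℤ} → (∀ x → f x ≡ g x) → ∀ xs → Σˡ f xs ≡ Σˡ g xs
  Σˡ-cong h []       = refl
  Σˡ-cong h (x ∷ xs) = cong₂ _+_ (h x) (Σˡ-cong h xs)

  Σˡ-mod : ∀ {m} {f g : X → ℤ} → (∀ x → f x ≡ g x [mod m ]) → ∀ xs → Σˡ f xs ≡ Σˡ g xs [mod m ]
  Σˡ-mod {m = m} h [] = ≡⇒mod {m} {0ℤ} refl
  Σˡ-mod {m = m} {f} {g} h (x ∷ xs) = mod-+ {m} {f x} {g x} {Σˡ f xs} {Σˡ g xs} (h x) (Σˡ-mod h xs)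

  Σˡ-+ : ∀ (f g : X → ℤ) xs → Σˡ (λ x → f x + g x) xs ≡ Σˡ f xs + Σˡ g xs
  Σˡ-+ f g []       = refl
  Σˡ-+ f g (x ∷ xs) = trans (cong (λ s → f x + g x + s) (Σˡ-+ f g xs)) (lemma (f x) (g x) (Σˡ f xs) (Σˡ g xs))
    where
    lemma : ∀ a b c d → a + b + (c + d) ≡ a + c + (b + d)
    lemma = solve-∀

  Σˡ-* : ∀ c (f : X → ℤ) xs → Σˡ (λ x → c * f x) xs ≡ c * Σˡ f xs
  Σˡ-* c f []       = sym (ℤ.*-zeroʳ c)
  Σˡ-* c f (x ∷ xs) = trans (cong (λ s → c * f x + s) (Σˡ-* c f xs)) (sym (ℤ.*-distribˡ-+ c (f x) (Σˡ f xs)))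

  Σˡ-++ : ∀ (f : X → ℤ) xs ys → Σˡ f (xs ++ ys) ≡ Σˡ f xs + Σˡ f ys
  Σˡ-++ f []       ys = sym (ℤ.+-identityˡ _)
  Σˡ-++ f (x ∷ xs) ys = trans (cong (λ s → f x + s) (Σˡ-++ f xs ys)) (sym (ℤ.+-assoc (f x) _ _))

  Σˡ-map : ∀ (f : X → ℤ) (φ : Y → X) ys → Σˡ f (map φ ys) ≡ Σˡ (f ∘ φ) ys
  Σˡ-map f φ []       = refl
  Σˡ-map f φ (y ∷ ys) = cong (λ s → f (φ y) + s) (Σˡ-map f φ ys)

  Σˡ-↭ : ∀ (f : X → ℤ) {xs ys} → xs ↭ ys → Σˡ f xs ≡ Σˡ f ys
  Σˡ-↭ f Perm.refl         = refl
  Σˡ-↭ f (Perm.prep x p)   = cong (λ s → f x + s) (Σˡ-↭ f p)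
  Σˡ-↭ f (Perm.swap {xs} {ys} x y p) = trans (cong (λ s → f x + (f y + s)) (Σˡ-↭ f p)) (lemma (f x) (f y) (Σˡ f ys))
    where
    lemma : ∀ a b c → a + (b + c) ≡ b + (a + c)
    lemma = solve-∀
  Σˡ-↭ f (Perm.trans p q)  = trans (Σˡ-↭ f p) (Σˡ-↭ f q)

  nonzero? : (f : X → ℤ) → ∀ x → Dec (f x ≢ 0ℤ)
  nonzero? f x = ¬? (f x ℤ.≟ 0ℤ)

  Σˡ-filter : ∀ (f : X → ℤ) xs → Σˡ f xs ≡ Σˡ f (filter (nonzero? f) xs)
  Σˡ-filter f []       = refl
  Σˡ-filter f (x ∷ xs) with f x ℤ.≟ 0ℤ
  ... | yes fx≡0 = trans (cong (λ a → a + Σˡ f xs) fx≡0) (trans (ℤ.+-identityˡ _) (Σˡ-filter f xs))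
  ... | no  _    = cong (λ s → f x + s) (Σˡ-filter f xs)

  -- Both sums are restricted to their supports, between which φ is a bijection. So boxes can be
  -- compared although φ does not map one onto the other.
  reindex : ∀ (f : X → ℤ) (φ : Y → X) {xs ys} → Unique xs → Unique ys →
    (∀ {y y′} → φ y ≡ φ y′ → y ≡ y′) →
    (∀ x → f x ≢ 0ℤ → ∃ λ y → y ∈ ys × φ y ≡ x) →
    (∀ y → f (φ y) ≢ 0ℤ → φ y ∈ xs) →
    Σˡ f xs ≡ Σˡ (f ∘ φ) ys
  reindex f φ {xs} {ys} uxs uys inj onto into = trans (Σˡ-filter f xs) (trans (Σˡ-↭ f perm)
    (trans (Σˡ-map f φ (filter (nonzero? (f ∘ φ)) ys)) (sym (Σˡ-filter (f ∘ φ) ys))))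
    where
    perm : filter (nonzero? f) xs ↭ map φ (filter (nonzero? (f ∘ φ)) ys)
    perm = ∼bag⇒↭ (unique∧set⇒bag (Unique.filter⁺ (nonzero? f) uxs) (Unique.map⁺ inj (Unique.filter⁺ (nonzero? (f ∘ φ)) uys)) (mk⇔ to from))
      where
      to : ∀ {x} → x ∈ filter (nonzero? f) xs → x ∈ map φ (filter (nonzero? (f ∘ φ)) ys)
      to {x} x∈ with ∈-filter⁻ (nonzero? f) {xs = xs} x∈
      ... | _ , fx≢0 with onto x fx≢0
      ... | y , y∈ys , refl = ∈-map⁺ φ (∈-filter⁺ (nonzero? (f ∘ φ)) y∈ys fx≢0)
      from : ∀ {x} → x ∈ map φ (filter (nonzero? (f ∘ φ)) ys) → x ∈ filter (nonzero? f) xs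
      from x∈ with ∈-map⁻ φ x∈
      ... | y , y∈ , refl with ∈-filter⁻ (nonzero? (f ∘ φ)) {xs = ys} y∈
      ... | y∈ys , fφy≢0 = ∈-filter⁺ (nonzero? f) (into y fφy≢0) fφy≢0

  -- Boxes of integers

  ∈-integers : ∀ K {a} → ∣ a ∣ ℕ.< K → a ∈ integers K
  ∈-integers K {+ i} i<K = nonNegative K i<K
    where
    nonNegative : ∀ K → i ℕ.< K → + i ∈ integers K
    nonNegative (suc K) (s≤s i≤K) with ℕ.m≤n⇒m<n∨m≡n i≤K
    ... | inj₁ i<K  = there (there (nonNegative K i<K))
    ... | inj₂ refl = here refl
  ∈-integers K { -[1+ i ]} 1+i<K = negative K (ℕ.<⇒≤ 1+i<K)
    where
    negative : ∀ K → i ℕ.< K → -[1+ i ] ∈ integers K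
    negative (suc K) (s≤s i≤K) with ℕ.m≤n⇒m<n∨m≡n i≤K
    ... | inj₁ i<K  = there (there (negative K i<K))
    ... | inj₂ refl = there (here refl)

  integers-< : ∀ K {a} → a ∈ integers K → code a ℕ.< 2 ℕ.* K
  integers-< (suc K) {a} a∈ = subst (code a ℕ.<_) (sym (ℕ.*-suc 2 K)) (go a∈)
    where
    go : ∀ {a} → a ∈ integers (suc K) → code a ℕ.< 2 ℕ.+ 2 ℕ.* K
    go (here refl)         = ℕ.m≤n+m _ 1
    go (there (here refl)) = ℕ.≤-refl
    go (there (there p))   = ℕ.m<n⇒m<1+n (ℕ.m<n⇒m<1+n (integers-< K p))

  integers-unique : ∀ K → Unique (integers K)
  integers-unique zero    = []
  integers-unique (suc K) = ((λ ()) ∷ All.tabulate (λ {a} p eq → ℕ.<-irrefl (cong code (sym eq)) (integers-< K p)))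
    ∷ All.tabulate (λ {a} p eq → ℕ.<⇒≱ (ℕ.m<n⇒m<1+n (integers-< K p)) (ℕ.≤-reflexive (cong code eq))) ∷ integers-unique K

  box : ℕ → List (ℤ × ℤ)
  box K = cartesianProduct (integers K) (integers K)

  box-unique : ∀ K → Unique (box K)
  box-unique K = Unique.cartesianProduct⁺ (integers-unique K) (integers-unique K)

  ∈-box : ∀ {K a b} → ∣ a ∣ ℕ.< K → ∣ b ∣ ℕ.< K → (a , b) ∈ box K
  ∈-box {K} p r = ∈-cartesianProduct⁺ (∈-integers K p) (∈-integers K r)

  -- The exponents as polynomials

  private
    pos-2i : ∀ i → + (2 ℕ.* i) ≡ + 2 * + i
    pos-2i = ℤ.pos-* 2

    pos-suc-2i : ∀ i → + suc (2 ℕ.* i) ≡ 1ℤ + + 2 * + i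
    pos-suc-2i i = cong (λ a → 1ℤ + a) (pos-2i i)

    square : ∀ {n a} → + n ≡ a → + (n ℕ.* n) ≡ a * a
    square {n} refl = ℤ.pos-* n n

  e-≡ : ∀ a → + e a ≡ a * (+ 2 * a + 1ℤ)
  e-≡ (+ i) = trans (cong +_ (tri-even i)) (trans (ℤ.pos-* i (suc (2 ℕ.* i))) (cong (λ z → + i * z) (trans (pos-suc-2i i) (ℤ.+-comm 1ℤ (+ 2 * + i)))))
  e-≡ -[1+ i ] = trans (cong +_ (tri-odd i)) (trans (ℤ.pos-* (suc i) (suc (2 ℕ.* i))) (trans (cong (λ z → + suc i * z) (pos-suc-2i i)) (lemma (+ i))))
    where
    lemma : ∀ i → (1ℤ + i) * (1ℤ + + 2 * i) ≡ - (1ℤ + i) * (+ 2 * (- (1ℤ + i)) + 1ℤ)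
    lemma = solve-∀

  pe-≡ : ∀ s → + pe s ≡ s * (+ 6 * s + 1ℤ)
  pe-≡ (+ i) = trans (cong₂ _+_ (square (pos-2i i)) (e-≡ (+ i))) (lemma (+ i))
    where
    lemma : ∀ i → + 2 * i * (+ 2 * i) + i * (+ 2 * i + 1ℤ) ≡ i * (+ 6 * i + 1ℤ)
    lemma = solve-∀
  pe-≡ -[1+ i ] = trans (cong₂ _+_ (square {suc (suc (2 ℕ.* i))} (cong (λ a → 1ℤ + a) (pos-suc-2i i))) (e-≡ -[1+ i ])) (lemma (+ i))
    where
    lemma : ∀ i → (1ℤ + (1ℤ + + 2 * i)) * (1ℤ + (1ℤ + + 2 * i)) + - (1ℤ + i) * (+ 2 * (- (1ℤ + i)) + 1ℤ) ≡ - (1ℤ + i) * (+ 6 * (- (1ℤ + i)) + 1ℤ)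
    lemma = solve-∀

  po-≡ : ∀ s → + po s ≡ (+ 2 * s + 1ℤ) * (+ 3 * s + + 2)
  po-≡ (+ i) = trans (cong₂ _+_ (square {suc (2 ℕ.* i)} (pos-suc-2i i)) (e-≡ -[1+ i ])) (lemma (+ i))
    where
    lemma : ∀ i → (1ℤ + + 2 * i) * (1ℤ + + 2 * i) + - (1ℤ + i) * (+ 2 * (- (1ℤ + i)) + 1ℤ) ≡ (+ 2 * i + 1ℤ) * (+ 3 * i + + 2)
    lemma = solve-∀
  po-≡ -[1+ i ] = trans (cong₂ _+_ (square {suc (2 ℕ.* i)} (pos-suc-2i i)) (e-≡ (+ i))) (lemma (+ i))
    where
    lemma : ∀ i → (1ℤ + + 2 * i) * (1ℤ + + 2 * i) + i * (+ 2 * i + 1ℤ) ≡ (+ 2 * - (1ℤ + i) + 1ℤ) * (+ 3 * - (1ℤ + i) + + 2)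
    lemma = solve-∀

  -- Bounds of this kind confine all solutions of exponent at most N to finite boxes, so that
  -- truncating the theta series loses nothing.
  ∣a∣≤e : ∀ a → ∣ a ∣ ℕ.≤ e a
  ∣a∣≤e (+ i)    = ℕ.≤-trans (ℕ.m≤m+n i (i ℕ.+ 0)) (n≤tri (2 ℕ.* i))
  ∣a∣≤e -[1+ i ] = ℕ.≤-trans (s≤s (ℕ.m≤m+n i (i ℕ.+ 0))) (n≤tri (suc (2 ℕ.* i)))

  ∣s∣≤pe : ∀ s → ∣ s ∣ ℕ.≤ pe s
  ∣s∣≤pe (+ i)    = ℕ.≤-trans (∣a∣≤e (+ i)) (ℕ.m≤n+m (e (+ i)) (2 ℕ.* i ℕ.* (2 ℕ.* i)))
  ∣s∣≤pe -[1+ i ] = ℕ.≤-trans (∣a∣≤e -[1+ i ]) (ℕ.m≤n+m (e -[1+ i ]) (suc (suc (2 ℕ.* i)) ℕ.* suc (suc (2 ℕ.* i))))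

  ∣s∣≤po : ∀ s → ∣ s ∣ ℕ.≤ po s
  ∣s∣≤po (+ i)    = ℕ.≤-trans (ℕ.n≤1+n i) (ℕ.≤-trans (∣a∣≤e -[1+ i ]) (ℕ.m≤n+m (e -[1+ i ]) (suc (2 ℕ.* i) ℕ.* suc (2 ℕ.* i))))
  ∣s∣≤po -[1+ i ] = ℕ.≤-trans (s≤s (ℕ.m≤m+n i (i ℕ.+ 0))) (ℕ.≤-trans (ℕ.m≤m*n (suc (2 ℕ.* i)) (suc (2 ℕ.* i))) (ℕ.m≤m+n _ (tri (2 ℕ.* i))))

  -- Coefficients of theta series

  -- The Kronecker delta, taken as a coefficient of q^E so that theta series need no conversion.
  [_≐_] : ℕ → ℕ → ℤ
  [ E ≐ n ] = monomial 1ℤ E n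

  ≐-≡ : ∀ E n → [ E ≐ n ] ≢ 0ℤ → E ≡ n
  ≐-≡ E n h with E ℕ.≟ n
  ... | yes p = p
  ... | no ¬p = ⊥-elim (h (monomial-≢ 1ℤ ¬p))

  monomial-scale : ∀ a E n → monomial a E n ≡ a * [ E ≐ n ]
  monomial-scale a zero    zero    = sym (ℤ.*-identityʳ a)
  monomial-scale a zero    (suc n) = sym (ℤ.*-zeroʳ a)
  monomial-scale a (suc E) zero    = sym (ℤ.*-zeroʳ a)
  monomial-scale a (suc E) (suc n) = monomial-scale a E n

  module Coefficients (m : ℤ) (N : ℕ) where

    open Theta m N using (Σᶻ; θ; L)

    Σᶻ-at : ∀ F as n → Σᶻ F as n ≡ Σˡ (λ a → F a n) as
    Σᶻ-at F []       n = 𝟘-at n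
    Σᶻ-at F (a ∷ as) n = trans (⊞-at (F a) (Σᶻ F as) n) (cong (λ s → F a n + s) (Σᶻ-at F as n))

    ⊛-Σᶻ-at : ∀ f G bs n → (f ⊛ Σᶻ G bs) n ≡ Σˡ (λ b → (f ⊛ G b) n) bs
    ⊛-Σᶻ-at f G []       n = trans (⊛-comm f 𝟘 n) (𝟘-⊛ f n)
    ⊛-Σᶻ-at f G (b ∷ bs) n = trans (⊛-comm f (G b ⊞ Σᶻ G bs) n) (trans (⊛-distribʳ (G b) (Σᶻ G bs) f n) (trans (⊞-at (G b ⊛ f) (Σᶻ G bs ⊛ f) n)
      (cong₂ _+_ (⊛-comm (G b) f n) (trans (⊛-comm (Σᶻ G bs) f n) (⊛-Σᶻ-at f G bs n)))))

    Σᶻ-⊛-at : ∀ F G as bs n → (Σᶻ F as ⊛ Σᶻ G bs) n ≡ Σˡ (λ (a , b) → (F a ⊛ G b) n) (cartesianProduct as bs)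
    Σᶻ-⊛-at F G []       bs n = 𝟘-⊛ (Σᶻ G bs) n
    Σᶻ-⊛-at F G (a ∷ as) bs n = trans (⊛-distribʳ (F a) (Σᶻ F as) (Σᶻ G bs) n) (trans (⊞-at (F a ⊛ Σᶻ G bs) (Σᶻ F as ⊛ Σᶻ G bs) n) (trans
      (cong₂ _+_ (⊛-Σᶻ-at (F a) G bs n) (Σᶻ-⊛-at F G as bs n))
      (sym (trans (Σˡ-++ (λ (a , b) → (F a ⊛ G b) n) (map (λ b → a , b) bs) (cartesianProduct as bs)) (cong (λ s → s + _) (Σˡ-map (λ (a , b) → (F a ⊛ G b) n) (λ b → a , b) bs))))))

    θ-at : ∀ w ε n → θ w ε n ≡ Σˡ (λ a → w a * [ ε a ≐ n ]) (integers L)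
    θ-at w ε n = trans (Σᶻ-at _ (integers L) n) (Σˡ-cong (λ a → monomial-scale (w a) (ε a) n) (integers L))

    monomial-⊛-θ-at : ∀ d w ε n → (monomial 1ℤ d ⊛ θ w ε) n ≡ Σˡ (λ a → w a * [ d ℕ.+ ε a ≐ n ]) (integers L)
    monomial-⊛-θ-at d w ε n = trans (⊛-Σᶻ-at (monomial 1ℤ d) (λ a → monomial (w a) (ε a)) (integers L) n) (Σˡ-cong (λ a → trans (monomial-⊛-monomial 1ℤ (w a) d (ε a) n)
      (trans (monomial-scale (1ℤ * w a) (d ℕ.+ ε a) n) (cong (λ z → z * [ d ℕ.+ ε a ≐ n ]) (ℤ.*-identityˡ (w a))))) (integers L))

    θ-⊛-at : ∀ w ε w′ ε′ n → (θ w ε ⊛ θ w′ ε′) n ≡ Σˡ (λ (a , b) → w a * w′ b * [ ε a ℕ.+ ε′ b ≐ n ]) (box L)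
    θ-⊛-at w ε w′ ε′ n = trans (Σᶻ-⊛-at _ _ (integers L) (integers L) n)
      (Σˡ-cong (λ (a , b) → trans (monomial-⊛-monomial (w a) (w′ b) (ε a) (ε′ b) n) (monomial-scale (w a * w′ b) (ε a ℕ.+ ε′ b) n)) (box L))

    Σˡ-∣ : ∀ (f : X → ℤ) → (∀ x → m ∣ f x) → ∀ xs → m ∣ Σˡ f xs
    Σˡ-∣ f h []       = divides 0ℤ refl
    Σˡ-∣ f h (x ∷ xs) = ∣m∣n⇒∣m+n (h x) (Σˡ-∣ f h xs)

    private
      supported : ∀ {w} E n → (E ≡ n → m ∣ w) → m ∣ w * [ E ≐ n ]
      supported {w} E n h with E ℕ.≟ n
      ... | yes p = ∣m⇒∣m*n [ E ≐ n ] (h p)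
      ... | no ¬p = subst (m ∣_) (sym (trans (cong (λ z → w * z) (monomial-≢ 1ℤ ¬p)) (ℤ.*-zeroʳ w))) (divides 0ℤ refl)

    θ-∣ : ∀ w ε n → (∀ a → ε a ≡ n → m ∣ w a) → m ∣ θ w ε n
    θ-∣ w ε n h = subst (m ∣_) (sym (θ-at w ε n)) (Σˡ-∣ _ (λ a → supported (ε a) n (h a)) (integers L))

    θ-⊛-∣ : ∀ w ε w′ ε′ n → (∀ a b → ε a ℕ.+ ε′ b ≡ n → m ∣ w a * w′ b) → m ∣ (θ w ε ⊛ θ w′ ε′) n
    θ-⊛-∣ w ε w′ ε′ n h = subst (m ∣_) (sym (θ-⊛-at w ε w′ ε′ n)) (Σˡ-∣ _ (λ (a , b) → supported (ε a ℕ.+ ε′ b) n (h a b)) (box L))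

    monomial-⊛-θ-∣ : ∀ d w ε n → (∀ a → d ℕ.+ ε a ≡ n → m ∣ w a) → m ∣ (monomial 1ℤ d ⊛ θ w ε) n
    monomial-⊛-θ-∣ d w ε n h = subst (m ∣_) (sym (monomial-⊛-θ-at d w ε n)) (Σˡ-∣ _ (λ a → supported (d ℕ.+ ε a) n (h a)) (integers L))

  χ : {P : Set} → Dec P → ℤ
  χ (yes _) = 1ℤ
  χ (no _)  = 0ℤ

  χ-true : {P : Set} (d : Dec P) → P → χ d ≡ 1ℤ
  χ-true (yes _) p = refl
  χ-true (no ¬p) p = ⊥-elim (¬p p)

  χ-*-≢0 : {P : Set} (d : Dec P) {a : ℤ} → χ d * a ≢ 0ℤ → P × a ≢ 0ℤ
  χ-*-≢0 (yes p) {a} h = p , λ a≡0 → h (trans (ℤ.*-identityˡ a) a≡0)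
  χ-*-≢0 (no _)      h = ⊥-elim (h refl)

  *-≢0 : ∀ a {b : ℤ} → a * b ≢ 0ℤ → b ≢ 0ℤ
  *-≢0 a h refl = h (ℤ.*-zeroʳ a)

  euclid₅ : ∀ x y → + 5 ∣ x * y → (+ 5 ∣ x) ⊎ (+ 5 ∣ y)
  euclid₅ x y p = Sum.map ∣ᵤ⇒∣ ∣ᵤ⇒∣ (euclidsLemma ∣ x ∣ ∣ y ∣ (from-yes (prime? 5)) (subst (5 ℕ.∣_) (ℤ.abs-* x y) (∣⇒∣ᵤ p)))

  cast : ∀ {d a b} → a ≡ b → d ∣ a → d ∣ b
  cast {d} = subst (d ∣_)

  -- The Hecke relation at the prime 5

  w : ℤ → ℤ
  w a = + 4 * a + 1ℤ

  module Hecke (N : ℕ) where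

    open Theta (+ 5) N using (J; ψ; L)
    open Coefficients (+ 5) N

    module _ (n : ℕ) (n≤N : n ℕ.≤ N) (n≡1 : + n ≡ 1ℤ [mod + 5 ]) where

      private
        E : ℤ × ℤ → ℕ
        E (b , a) = e b ℕ.* 1 ℕ.+ e a ℕ.* 1

        E₅ : ℤ × ℤ → ℕ
        E₅ (d , c) = suc (e d ℕ.* 5 ℕ.+ e c ℕ.* 5)

        E-≡ : ∀ b a → + E (b , a) ≡ b * (+ 2 * b + 1ℤ) + a * (+ 2 * a + 1ℤ)
        E-≡ b a = cong₂ _+_ (trans (cong +_ (ℕ.*-identityʳ (e b))) (e-≡ b)) (trans (cong +_ (ℕ.*-identityʳ (e a))) (e-≡ a))

        E₅-≡ : ∀ d c → + E₅ (d , c) ≡ 1ℤ + (d * (+ 2 * d + 1ℤ) * + 5 + c * (+ 2 * c + 1ℤ) * + 5)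
        E₅-≡ d c = cong (λ z → 1ℤ + z) (cong₂ _+_ (trans (ℤ.pos-* (e d) 5) (cong (λ z → z * + 5) (e-≡ d))) (trans (ℤ.pos-* (e c) 5) (cong (λ z → z * + 5) (e-≡ c))))

        f f₁ f₂ M : ℤ × ℤ → ℤ
        f (b , a) = w b * 1ℤ * [ E (b , a) ≐ n ]
        f₁ (b , a) = χ (+ 5 ∣? (a - + 2 * b + 1ℤ)) * f (b , a)
        f₂ (b , a) = χ (+ 5 ∣? (a + + 2 * b + + 2)) * f (b , a)
        M p = [ E₅ p ≐ n ]

        -- Multiplication of a Gaussian integer by the two primes above 5, in the coordinates w.
        φ₁ φ₂ : ℤ × ℤ → ℤ × ℤ
        φ₁ (d , c) = + 2 * d - c , - (+ 2 * c) - d - 1ℤ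
        φ₂ (d , c) = - (+ 2 * d) - c - 1ℤ , + 2 * c - d

        -- With x = 4b + 1 and y = 4a + 1 the exponent is n when x² + y² = 8n + 2, which is
        -- divisible by 5. So y ≡ 2x or y ≡ -2x modulo 5, and these are the conditions in `f₁` and
        -- `f₂`.
        f-split : ∀ p → f p ≡ f₁ p + f₂ p [mod + 5 ]
        f-split (b , a) with + 5 ∣? (a - + 2 * b + 1ℤ) | + 5 ∣? (a + + 2 * b + + 2)
        -- Both conditions together force 5 to divide the weight 4b + 1, so counting the term twice
        -- is harmless.
        ... | yes p | yes r = cast (sym (lemma (f (b , a)))) (∣m⇒∣-m (∣m⇒∣m*n [ E (b , a) ≐ n ] (∣m⇒∣m*n 1ℤ (cast (lemma′ a b) (∣m∣n⇒∣m-n r p)))))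
          where
          lemma : ∀ x → x - (1ℤ * x + 1ℤ * x) ≡ - x
          lemma = solve-∀
          lemma′ : ∀ a b → (a + + 2 * b + + 2) - (a - + 2 * b + 1ℤ) ≡ + 4 * b + 1ℤ
          lemma′ = solve-∀
        ... | yes _ | no _  = ≡⇒mod (lemma (f (b , a)))
          where
          lemma : ∀ x → x ≡ 1ℤ * x + 0ℤ * x
          lemma = solve-∀
        ... | no _  | yes _ = ≡⇒mod (lemma (f (b , a)))
          where
          lemma : ∀ x → x ≡ 0ℤ * x + 1ℤ * x
          lemma = solve-∀
        ... | no ¬p | no ¬r = ≡⇒mod (trans f≡0 (sym (trans (cong₂ (λ x y → 0ℤ * x + 0ℤ * y) f≡0 f≡0) refl)))
          where
          f≡0 : f (b , a) ≡ 0ℤ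
          f≡0 with E (b , a) ℕ.≟ n
          ... | no E≢n = trans (cong (λ z → w b * 1ℤ * z) (monomial-≢ 1ℤ E≢n)) (ℤ.*-zeroʳ (w b * 1ℤ))
          -- Modulo 5, 3(E - 1) is the product of the linear forms in the two conditions.
          ... | yes E≡n with euclid₅ (a - + 2 * b + 1ℤ) (a + + 2 * b + + 2)
               (cast (lemma a b) (∣m∣n⇒∣m-n (∣n⇒∣m*n (+ 3) (cast (cong (λ z → z - 1ℤ) (trans (sym (cong +_ E≡n)) (E-≡ b a))) n≡1)) (divides (a * a + + 2 * (b * b) + b - 1ℤ) refl)))
            where
            lemma : ∀ a b → + 3 * (b * (+ 2 * b + 1ℤ) + a * (+ 2 * a + 1ℤ) - 1ℤ) - (a * a + + 2 * (b * b) + b - 1ℤ) * + 5 ≡ (a - + 2 * b + 1ℤ) * (a + + 2 * b + + 2)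
            lemma = solve-∀
          ... | inj₁ p = ⊥-elim (¬p p)
          ... | inj₂ r = ⊥-elim (¬r r)

        -- Multiplication by a Gaussian prime of norm 5 multiplies x² + y² by 5, which sends the
        -- exponent e d + e c to 5(e d + e c) + 1. Conjugation and signs are chosen so that both
        -- coordinates stay 1 modulo 4.
        φ₁-energy : ∀ y → E (φ₁ y) ≡ E₅ y
        φ₁-energy (d , c) = ℤ.+-injective (trans (E-≡ (+ 2 * d - c) (- (+ 2 * c) - d - 1ℤ)) (trans (lemma d c) (sym (E₅-≡ d c))))
          where
          lemma : ∀ d c → (+ 2 * d - c) * (+ 2 * (+ 2 * d - c) + 1ℤ) + (- (+ 2 * c) - d - 1ℤ) * (+ 2 * (- (+ 2 * c) - d - 1ℤ) + 1ℤ) ≡ 1ℤ + (d * (+ 2 * d + 1ℤ) * + 5 + c * (+ 2 * c + 1ℤ) * + 5)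
          lemma = solve-∀

        φ₂-energy : ∀ y → E (φ₂ y) ≡ E₅ y
        φ₂-energy (d , c) = ℤ.+-injective (trans (E-≡ (- (+ 2 * d) - c - 1ℤ) (+ 2 * c - d)) (trans (lemma d c) (sym (E₅-≡ d c))))
          where
          lemma : ∀ d c → (- (+ 2 * d) - c - 1ℤ) * (+ 2 * (- (+ 2 * d) - c - 1ℤ) + 1ℤ) + (+ 2 * c - d) * (+ 2 * (+ 2 * c - d) + 1ℤ) ≡ 1ℤ + (d * (+ 2 * d + 1ℤ) * + 5 + c * (+ 2 * c + 1ℤ) * + 5)
          lemma = solve-∀

        ∈-E : ∀ {p} → E p ≡ n → p ∈ box L
        ∈-E {b , a} refl = ∈-box
          (s≤s (ℕ.≤-trans (∣a∣≤e b) (ℕ.≤-trans (ℕ.≤-reflexive (sym (ℕ.*-identityʳ (e b)))) (ℕ.≤-trans (ℕ.m≤m+n _ _) n≤N))))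
          (s≤s (ℕ.≤-trans (∣a∣≤e a) (ℕ.≤-trans (ℕ.≤-reflexive (sym (ℕ.*-identityʳ (e a)))) (ℕ.≤-trans (ℕ.m≤n+m _ (e b ℕ.* 1)) n≤N))))

        ∈-E₅ : ∀ {y} → E₅ y ≡ n → y ∈ box L
        ∈-E₅ {d , c} refl = ∈-box
          (s≤s (ℕ.≤-trans (∣a∣≤e d) (ℕ.≤-trans (ℕ.m≤m*n (e d) 5) (ℕ.≤-trans (ℕ.m≤m+n _ _) (ℕ.≤-trans (ℕ.n≤1+n _) n≤N)))))
          (s≤s (ℕ.≤-trans (∣a∣≤e c) (ℕ.≤-trans (ℕ.m≤m*n (e c) 5) (ℕ.≤-trans (ℕ.m≤n+m _ (e d ℕ.* 5)) (ℕ.≤-trans (ℕ.n≤1+n _) n≤N)))))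

        φ₁-injective : ∀ {y y′} → φ₁ y ≡ φ₁ y′ → y ≡ y′
        φ₁-injective {d , c} {d′ , c′} eq = cong₂ _,_ d≡ c≡
          where
          5d : ∀ d c → + 5 * d ≡ + 2 * (+ 2 * d - c) - (- (+ 2 * c) - d - 1ℤ) - 1ℤ
          5d = solve-∀
          1c : ∀ d c → c ≡ + 2 * d - (+ 2 * d - c)
          1c = solve-∀
          d≡ : d ≡ d′
          d≡ = ℤ.*-cancelˡ-≡ (+ 5) d d′ (trans (5d d c) (trans (cong (λ (b , a) → + 2 * b - a - 1ℤ) eq) (sym (5d d′ c′))))
          c≡ : c ≡ c′
          c≡ = trans (1c d c) (trans (cong₂ (λ d p → + 2 * d - proj₁ p) d≡ eq) (sym (1c d′ c′)))

        φ₂-injective : ∀ {y y′} → φ₂ y ≡ φ₂ y′ → y ≡ y′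
        φ₂-injective {d , c} {d′ , c′} eq = cong₂ _,_ d≡ c≡
          where
          5d : ∀ d c → + 5 * d ≡ - (+ 2 * (- (+ 2 * d) - c - 1ℤ) + (+ 2 * c - d) + + 2)
          5d = solve-∀
          1c : ∀ d c → c ≡ - (+ 2 * d) - 1ℤ - (- (+ 2 * d) - c - 1ℤ)
          1c = solve-∀
          d≡ : d ≡ d′
          d≡ = ℤ.*-cancelˡ-≡ (+ 5) d d′ (trans (5d d c) (trans (cong (λ (b , a) → - (+ 2 * b + a + + 2)) eq) (sym (5d d′ c′))))
          c≡ : c ≡ c′
          c≡ = trans (1c d c) (trans (cong₂ (λ d p → - (+ 2 * d) - 1ℤ - proj₁ p) d≡ eq) (sym (1c d′ c′)))

        f-energy : ∀ p → f p ≢ 0ℤ → E p ≡ n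
        f-energy (b , a) h = ≐-≡ (E (b , a)) n (*-≢0 (w b * 1ℤ) h)

        sum₁ : Σˡ f₁ (box L) ≡ Σˡ (f₁ ∘ φ₁) (box L)
        sum₁ = reindex f₁ φ₁ (box-unique L) (box-unique L) φ₁-injective onto
          (λ y h → ∈-E (f-energy (φ₁ y) (proj₂ (χ-*-≢0 (+ 5 ∣? (proj₂ (φ₁ y) - + 2 * proj₁ (φ₁ y) + 1ℤ)) h))))
          where
          onto : ∀ p → f₁ p ≢ 0ℤ → ∃ λ y → y ∈ box L × φ₁ y ≡ p
          onto (b , a) h with χ-*-≢0 (+ 5 ∣? (a - + 2 * b + 1ℤ)) h
          ... | divides k eq , fp≢0 = y , ∈-E₅ (trans (sym (φ₁-energy y)) (trans (cong E φy≡) (f-energy (b , a) fp≢0))) , φy≡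
            where
            y : ℤ × ℤ
            y = - k , + 2 * - k - b
            lemma₁ : ∀ k b → + 2 * - k - (+ 2 * - k - b) ≡ b
            lemma₁ = solve-∀
            lemma₂ : ∀ k b → - (+ 2 * (+ 2 * - k - b)) - - k - 1ℤ ≡ k * + 5 + + 2 * b - 1ℤ
            lemma₂ = solve-∀
            lemma₃ : ∀ a b → a - + 2 * b + 1ℤ + + 2 * b - 1ℤ ≡ a
            lemma₃ = solve-∀
            φy≡ : φ₁ y ≡ (b , a)
            φy≡ = cong₂ _,_ (lemma₁ k b) (trans (lemma₂ k b) (trans (cong (λ z → z + + 2 * b - 1ℤ) (sym eq)) (lemma₃ a b)))

        sum₂ : Σˡ f₂ (box L) ≡ Σˡ (f₂ ∘ φ₂) (box L)
        sum₂ = reindex f₂ φ₂ (box-unique L) (box-unique L) φ₂-injective onto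
          (λ y h → ∈-E (f-energy (φ₂ y) (proj₂ (χ-*-≢0 (+ 5 ∣? (proj₂ (φ₂ y) + + 2 * proj₁ (φ₂ y) + + 2)) h))))
          where
          onto : ∀ p → f₂ p ≢ 0ℤ → ∃ λ y → y ∈ box L × φ₂ y ≡ p
          onto (b , a) h with χ-*-≢0 (+ 5 ∣? (a + + 2 * b + + 2)) h
          ... | divides k eq , fp≢0 = y , ∈-E₅ (trans (sym (φ₂-energy y)) (trans (cong E φy≡) (f-energy (b , a) fp≢0))) , φy≡
            where
            y : ℤ × ℤ
            y = - k , + 2 * k - b - 1ℤ
            lemma₁ : ∀ k b → - (+ 2 * - k) - (+ 2 * k - b - 1ℤ) - 1ℤ ≡ b
            lemma₁ = solve-∀
            lemma₂ : ∀ k b → + 2 * (+ 2 * k - b - 1ℤ) - - k ≡ k * + 5 - + 2 * b - + 2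
            lemma₂ = solve-∀
            lemma₃ : ∀ a b → a + + 2 * b + + 2 - + 2 * b - + 2 ≡ a
            lemma₃ = solve-∀
            φy≡ : φ₂ y ≡ (b , a)
            φy≡ = cong₂ _,_ (lemma₁ k b) (trans (lemma₂ k b) (trans (cong (λ z → z - + 2 * b - + 2) (sym eq)) (lemma₃ a b)))

        wd wc : ℤ × ℤ → ℤ
        wd (d , c) = w d * 1ℤ * M (d , c)
        wc (d , c) = w c * 1ℤ * M (d , c)

        -- In terms of X = 4d + 1 and Y = 4c + 1 the weight is x = 2X - Y, while it is x = -2X - Y
        -- for `φ₂`; the terms in X cancel when the two sums are added.
        value₁ : ∀ y → f₁ (φ₁ y) ≡ + 2 * wd y + - 1ℤ * wc y
        value₁ (d , c) = trans (cong₂ _*_ (χ-true (+ 5 ∣? _) (divides (- d) (lemma d c))) (cong (λ i → w (+ 2 * d - c) * 1ℤ * [ i ≐ n ]) (φ₁-energy (d , c)))) (lemma′ d c (M (d , c)))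
          where
          lemma : ∀ d c → - (+ 2 * c) - d - 1ℤ - + 2 * (+ 2 * d - c) + 1ℤ ≡ - d * + 5
          lemma = solve-∀
          lemma′ : ∀ d c m → 1ℤ * ((+ 4 * (+ 2 * d - c) + 1ℤ) * 1ℤ * m) ≡ + 2 * ((+ 4 * d + 1ℤ) * 1ℤ * m) + - 1ℤ * ((+ 4 * c + 1ℤ) * 1ℤ * m)
          lemma′ = solve-∀

        value₂ : ∀ y → f₂ (φ₂ y) ≡ - + 2 * wd y + - 1ℤ * wc y
        value₂ (d , c) = trans (cong₂ _*_ (χ-true (+ 5 ∣? _) (divides (- d) (lemma d c))) (cong (λ i → w (- (+ 2 * d) - c - 1ℤ) * 1ℤ * [ i ≐ n ]) (φ₂-energy (d , c)))) (lemma′ d c (M (d , c)))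
          where
          lemma : ∀ d c → + 2 * c - d + + 2 * (- (+ 2 * d) - c - 1ℤ) + + 2 ≡ - d * + 5
          lemma = solve-∀
          lemma′ : ∀ d c m → 1ℤ * ((+ 4 * (- (+ 2 * d) - c - 1ℤ) + 1ℤ) * 1ℤ * m) ≡ - + 2 * ((+ 4 * d + 1ℤ) * 1ℤ * m) + - 1ℤ * ((+ 4 * c + 1ℤ) * 1ℤ * m)
          lemma′ = solve-∀

        linear : ∀ a (g h : ℤ × ℤ → ℤ) → Σˡ (λ y → a * g y + - 1ℤ * h y) (box L) ≡ a * Σˡ g (box L) + - 1ℤ * Σˡ h (box L)
        linear a g h = trans (Σˡ-+ (λ y → a * g y) (λ y → - 1ℤ * h y) (box L)) (cong₂ _+_ (Σˡ-* a g (box L)) (Σˡ-* (- 1ℤ) h (box L)))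

        S : ℤ
        S = Σˡ wd (box L)

        -- The exponent is symmetric in d and c, so Y may be replaced by X.
        symmetric : Σˡ wc (box L) ≡ S
        symmetric = trans (reindex wc swap (box-unique L) (box-unique L) (λ eq → cong swap eq)
            (λ (d , c) h → (c , d) , ∈-E₅ (trans (E₅-swap c d) (M-energy (d , c) h)) , refl)
            (λ (d , c) h → ∈-E₅ (M-energy (c , d) h)))
          (Σˡ-cong (λ (d , c) → cong (λ i → w d * 1ℤ * [ i ≐ n ]) (E₅-swap c d)) (box L))
          where
          E₅-swap : ∀ d c → E₅ (d , c) ≡ E₅ (c , d)
          E₅-swap d c = cong suc (ℕ.+-comm (e d ℕ.* 5) (e c ℕ.* 5))
          M-energy : ∀ y → wc y ≢ 0ℤ → E₅ y ≡ n
          M-energy (d , c) h = ≐-≡ (E₅ (d , c)) n (*-≢0 (w c * 1ℤ) h)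

      -- η(4τ)²η(8τ)² has complex multiplication by ℚ(i) and eigenvalue -2 at the prime 5.
      hecke : (J 1 ⊛ ψ 1) n ≡ - + 2 * (monomial 1ℤ 1 ⊛ (J 5 ⊛ ψ 5)) n [mod + 5 ]
      hecke = subst (λ z → (J 1 ⊛ ψ 1) n ≡ - + 2 * z [mod + 5 ]) (sym (shifted n refl)) (cast (cong (λ z → z - - + 2 * S) (sym (θ-⊛-at w (λ a → e a ℕ.* 1) (λ _ → 1ℤ) (λ a → e a ℕ.* 1) n)))
        (mod-trans {+ 5} {Σˡ f (box L)} {Σˡ (λ p → f₁ p + f₂ p) (box L)} { - + 2 * S} (Σˡ-mod {m = + 5} {f = f} {g = λ p → f₁ p + f₂ p} f-split (box L))
          (≡⇒mod (trans (Σˡ-+ f₁ f₂ (box L)) (trans (cong₂ _+_ sum₁ sum₂) (trans (cong₂ _+_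
            (trans (Σˡ-cong value₁ (box L)) (linear (+ 2) wd wc)) (trans (Σˡ-cong value₂ (box L)) (linear (- + 2) wd wc)))
            (trans (cong (λ z → + 2 * S + - 1ℤ * z + (- + 2 * S + - 1ℤ * z)) symmetric) (lemma S))))))))
        where
        lemma : ∀ s → + 2 * s + - 1ℤ * s + (- + 2 * s + - 1ℤ * s) ≡ - + 2 * s
        lemma = solve-∀
        shifted : ∀ k → k ≡ n → (monomial 1ℤ 1 ⊛ (J 5 ⊛ ψ 5)) k ≡ S
        shifted zero    refl = ⊥-elim (from-no (+ 5 ∣? - 1ℤ) n≡1)
        shifted (suc k) refl = trans (⊛-shift 0 (J 5 ⊛ ψ 5) k) (trans (const-⊛ 1ℤ (J 5 ⊛ ψ 5) k) (trans (ℤ.*-identityˡ _)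
          (θ-⊛-at w (λ a → e a ℕ.* 5) (λ _ → 1ℤ) (λ a → e a ℕ.* 5) k)))

  -- The congruences modulo 5

  infix 4 _∈₅_
  _∈₅_ : ℕ → List ℤ → Set
  n ∈₅ S = Any (λ s → + n ≡ s [mod + 5 ]) S

  infixl 6 _⊕_
  _⊕_ : List ℤ → List ℤ → List ℤ
  _⊕_ = cartesianProductWith _+_

  residue₅ : ∀ a → ∃ λ t → a ≡ t [mod + 5 ] × t ∈ (+ 0 ∷ + 1 ∷ + 2 ∷ + 3 ∷ + 4 ∷ [])
  residue₅ a with a ℤ.%ℕ 5 | ℤ.n%ℕd<d a 5 | ℤ.a≡a%ℕn+[a/ℕn]*n a 5
  ... | r | r<5 | eq = + r , divides (a ℤ./ℕ 5) (trans (cong (λ z → z - + r) eq) (lemma (+ r) ((a ℤ./ℕ 5) * + 5))) , mem r r<5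
    where
    lemma : ∀ r x → r + x - r ≡ x
    lemma = solve-∀
    mem : ∀ r → r ℕ.< 5 → + r ∈ (+ 0 ∷ + 1 ∷ + 2 ∷ + 3 ∷ + 4 ∷ [])
    mem 0 _ = here refl
    mem 1 _ = there (here refl)
    mem 2 _ = there (there (here refl))
    mem 3 _ = there (there (there (here refl)))
    mem 4 _ = there (there (there (there (here refl))))
    mem (suc (suc (suc (suc (suc _))))) (s≤s (s≤s (s≤s (s≤s (s≤s ())))))

  e-mod₅ : ∀ a t → a ≡ t [mod + 5 ] → + e a ≡ t * (+ 2 * t + 1ℤ) [mod + 5 ]
  e-mod₅ a t p = cast (sym (trans (cong (λ z → z - t * (+ 2 * t + 1ℤ)) (e-≡ a)) (lemma a t))) (∣m⇒∣m*n (+ 2 * a + + 2 * t + 1ℤ) p)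
    where
    lemma : ∀ a t → a * (+ 2 * a + 1ℤ) - t * (+ 2 * t + 1ℤ) ≡ (a - t) * (+ 2 * a + + 2 * t + 1ℤ)
    lemma = solve-∀

  shift-mod : ∀ {x} s t → (+ 5 ∣ s - t) → x ≡ s [mod + 5 ] → x ≡ t [mod + 5 ]
  shift-mod {x} s t p r = mod-trans {+ 5} {x} {s} {t} r p

  -- As 8 e a + 1 = (4a + 1)², the class 3 is the one where 5 divides 4a + 1, that is a ≡ 1. Hence
  -- `J` has no class 3 modulo 5, and that of `ψ` comes from a = 5b + 1.
  e-classes : ∀ a → (e a ∈₅ (+ 0 ∷ + 1 ∷ [])) ⊎ ((+ e a ≡ + 3 [mod + 5 ]) × (a ≡ 1ℤ [mod + 5 ]))
  e-classes a with residue₅ a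
  ... | _ , p , here refl                                 = inj₁ (here (e-mod₅ a (+ 0) p))
  ... | _ , p , there (here refl)                         = inj₂ (e-mod₅ a (+ 1) p , p)
  ... | _ , p , there (there (here refl))                 = inj₁ (here (shift-mod {+ e a} (+ 10) (+ 0) (divides (+ 2) refl) (e-mod₅ a (+ 2) p)))
  ... | _ , p , there (there (there (here refl)))         = inj₁ (there (here (shift-mod {+ e a} (+ 21) (+ 1) (divides (+ 4) refl) (e-mod₅ a (+ 3) p))))
  ... | _ , p , there (there (there (there (here refl)))) = inj₁ (there (here (shift-mod {+ e a} (+ 36) (+ 1) (divides (+ 7) refl) (e-mod₅ a (+ 4) p))))

  w-∣ : ∀ a → a ≡ 1ℤ [mod + 5 ] → + 5 ∣ w a
  w-∣ a p = cast (lemma a) (∣m∣n⇒∣m+n (∣n⇒∣m*n (+ 4) p) (divides 1ℤ refl))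
    where
    lemma : ∀ a → + 4 * (a - 1ℤ) + + 5 ≡ + 4 * a + 1ℤ
    lemma = solve-∀

  module Modulo5 (N : ℕ) where

    open Products (+ 5) N hiding (_+_; _*_; _-_; -_; refl; sym; trans; _^_; f)
    module R = Products (+ 5) N
    open Coefficients (+ 5) N
    open Hecke N

    Supported : List ℤ → Series → Set
    Supported S f = ∀ n → n ℕ.≤ N → n ∈₅ S ⊎ (+ 5 ∣ f n)

    ⊛-supported : ∀ {S T f g} → Supported S f → Supported T g → Supported (S ⊕ T) (f ⊛ g)
    ⊛-supported {S} {T} {f} {g} F G n n≤N with any? (λ s → + 5 ∣? (+ n - s)) (S ⊕ T)
    ... | yes p = inj₁ p
    ... | no ¬p = inj₂ (⊛-∣ f g n term)
      where
      term : ∀ i j → i ℕ.+ j ≡ n → + 5 ∣ f i * g j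
      term i j refl with F i (ℕ.≤-trans (ℕ.m≤m+n i j) n≤N) | G j (ℕ.≤-trans (ℕ.m≤n+m j i) n≤N)
      ... | inj₂ p | _      = ∣m⇒∣m*n (g j) p
      ... | inj₁ _ | inj₂ r = ∣n⇒∣m*n (f i) r
      ... | inj₁ p | inj₁ r = ⊥-elim (¬p (AnyP.cartesianProductWith⁺ _+_
        (λ {s} {t} u v → mod-+ {+ 5} {+ i} {s} {+ j} {t} u v) p r))

    -- The parts of ψ in the class 3 and in the classes 0, 1 of exponents modulo 5.
    ψb ψa : Series
    ψb = monomial 1ℤ 3 ⊛ ψ 25
    ψa = ψ 1 ⊞ (⊟ ψb)

    J-supported : Supported (+ 0 ∷ + 1 ∷ []) (J 1)
    J-supported n _ with any? (λ s → + 5 ∣? (+ n - s)) (+ 0 ∷ + 1 ∷ [])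
    ... | yes p = inj₁ p
    ... | no ¬p = inj₂ (θ-∣ w (λ a → e a ℕ.* 1) n term)
      where
      term : ∀ a → e a ℕ.* 1 ≡ n → + 5 ∣ w a
      term a refl with e-classes a
      ... | inj₁ q       = ⊥-elim (¬p (subst (_∈₅ _) (sym (ℕ.*-identityʳ (e a))) q))
      ... | inj₂ (_ , q) = w-∣ a q

    -- Outside the classes 0 and 1 only a = 5b + 1 contributes, and e (5b + 1) = 25 e b + 3
    -- identifies this contribution with `ψb`.
    ψa-supported : Supported (+ 0 ∷ + 1 ∷ []) ψa
    ψa-supported n n≤N with any? (λ s → + 5 ∣? (+ n - s)) (+ 0 ∷ + 1 ∷ [])
    ... | yes p = inj₁ p
    ... | no ¬p = inj₂ (cast (sym (trans (⊞-at (ψ 1) (⊟ ψb) n) (trans (cong₂ _+_ ψ≡ψb (⊟-at ψb n)) (ℤ.+-inverseʳ (ψb n))))) (divides 0ℤ refl))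
      where
      f : ℤ → ℤ
      f a = 1ℤ * [ e a ℕ.* 1 ≐ n ]
      φ : ℤ → ℤ
      φ a = + 5 * a + 1ℤ
      energy : ∀ a → e (φ a) ℕ.* 1 ≡ 3 ℕ.+ e a ℕ.* 25
      energy a = ℤ.+-injective (trans (cong +_ (ℕ.*-identityʳ (e (φ a)))) (trans (e-≡ (φ a)) (trans (lemma a)
        (cong (λ z → + 3 + z) (sym (trans (ℤ.pos-* (e a) 25) (cong (λ z → z * + 25) (e-≡ a))))))))
        where
        lemma : ∀ a → (+ 5 * a + 1ℤ) * (+ 2 * (+ 5 * a + 1ℤ) + 1ℤ) ≡ + 3 + a * (+ 2 * a + 1ℤ) * + 25
        lemma = solve-∀
      f-energy : ∀ a → f a ≢ 0ℤ → e a ℕ.* 1 ≡ n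
      f-energy a h = ≐-≡ (e a ℕ.* 1) n (*-≢0 1ℤ h)
      injective : ∀ {a b} → φ a ≡ φ b → a ≡ b
      injective {a} {b} eq = ℤ.*-cancelˡ-≡ (+ 5) a b (trans (sym (drop (+ 5 * a))) (trans (cong (λ z → z - 1ℤ) eq) (drop (+ 5 * b))))
        where
        drop : ∀ x → x + 1ℤ - 1ℤ ≡ x
        drop = solve-∀
      onto : ∀ a → f a ≢ 0ℤ → ∃ λ b → b ∈ integers L × φ b ≡ a
      onto a h with e-classes a
      ... | inj₁ q = ⊥-elim (¬p (subst (_∈₅ _) (trans (sym (ℕ.*-identityʳ (e a))) (f-energy a h)) q))
      ... | inj₂ (_ , divides b eq) = b , ∈-integers L (s≤s bound) , φb≡a
        where
        add : ∀ a → a ≡ a - 1ℤ + 1ℤ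
        add = solve-∀
        φb≡a : φ b ≡ a
        φb≡a = sym (trans (add a) (cong (λ z → z + 1ℤ) (trans eq (ℤ.*-comm b (+ 5)))))
        bound : ∣ b ∣ ℕ.≤ N
        bound = ℕ.≤-trans (∣a∣≤e b) (ℕ.≤-trans (ℕ.m≤m*n (e b) 25) (ℕ.≤-trans (ℕ.m≤n+m _ 3)
          (ℕ.≤-trans (ℕ.≤-reflexive (trans (sym (energy b)) (trans (cong (λ a → e a ℕ.* 1) φb≡a) (f-energy a h)))) n≤N)))
      into : ∀ b → f (φ b) ≢ 0ℤ → φ b ∈ integers L
      into b h = ∈-integers L (s≤s (ℕ.≤-trans (∣a∣≤e (φ b)) (ℕ.≤-trans (ℕ.≤-reflexive (trans (sym (ℕ.*-identityʳ (e (φ b)))) (f-energy (φ b) h))) n≤N)))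
      ψ≡ψb : ψ 1 n ≡ ψb n
      ψ≡ψb = trans (θ-at (λ _ → 1ℤ) (λ a → e a ℕ.* 1) n) (trans (reindex f φ (integers-unique L) (integers-unique L) injective onto into)
        (trans (Σˡ-cong (λ a → cong (λ i → 1ℤ * [ i ≐ n ]) (energy a)) (integers L)) (sym (monomial-⊛-θ-at 3 (λ _ → 1ℤ) (λ a → e a ℕ.* 25) n))))

    ψb-supported : Supported (+ 3 ∷ []) ψb
    ψb-supported n _ with any? (λ s → + 5 ∣? (+ n - s)) (+ 3 ∷ [])
    ... | yes p = inj₁ p
    ... | no ¬p = inj₂ (monomial-⊛-θ-∣ 3 (λ _ → 1ℤ) (λ a → e a ℕ.* 25) n term)
      where
      term : ∀ a → 3 ℕ.+ e a ℕ.* 25 ≡ n → + 5 ∣ 1ℤ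
      term a refl = ⊥-elim (¬p (here (divides (+ e a * + 5) (trans (cong (λ z → + 3 + z - + 3) (ℤ.pos-* (e a) 25)) (lemma (+ e a))))))
        where
        lemma : ∀ x → + 3 + x * + 25 - + 3 ≡ x * + 5 * + 5
        lemma = solve-∀

    -- By `hecke`, `D` is J ψ freed of its class 1 modulo 5. `K` compares `F` with the series that
    -- is to be its class 4.
    JΨ D F K : Series
    JΨ = monomial 1ℤ 1 ⊛ (J 5 ⊛ ψ 5)
    D = (J 1 ⊛ ψ 1) ⊞ (const (+ 2) ⊛ JΨ)
    F = O 1 ⊛ O 5
    K = F ⊞ (⊟ (monomial 1ℤ 1 ⊛ (ψb ⊛ J 5)))

    D-supported : Supported (+ 0 ∷ + 2 ∷ + 3 ∷ + 4 ∷ []) D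
    D-supported n n≤N with residue₅ (+ n)
    ... | _ , p , here refl                                 = inj₁ (here p)
    ... | _ , p , there (there (here refl))                 = inj₁ (there (here p))
    ... | _ , p , there (there (there (here refl)))         = inj₁ (there (there (here p)))
    ... | _ , p , there (there (there (there (here refl)))) = inj₁ (there (there (there (here p))))
    ... | _ , p , there (here refl)                         = inj₂ (cast
      (sym (trans (⊞-at (J 1 ⊛ ψ 1) (const (+ 2) ⊛ JΨ) n) (trans (cong (λ z → (J 1 ⊛ ψ 1) n + z) (const-⊛ (+ 2) JΨ n)) (lemma ((J 1 ⊛ ψ 1) n) (JΨ n)))))
      (hecke n n≤N p))
      where
      lemma : ∀ a x → a + + 2 * x ≡ a - - + 2 * x
      lemma = solve-∀

    -- That 4 is missing from the list of classes is decided by evaluation, through the implicit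
    -- argument.
    vanish-at-4 : ∀ {S f} {4∉S : False (any? (λ s → + 5 ∣? (+ 4 - s)) S)} → Supported S f → ∀ n → n ℕ.≤ N → + n ≡ + 4 [mod + 5 ] → + 5 ∣ f n
    vanish-at-4 {4∉S = 4∉S} supp n n≤N n≡4 with supp n n≤N
    ... | inj₂ p = p
    ... | inj₁ p = ⊥-elim (toWitnessFalse 4∉S (Any.map (λ {s} q → mod-trans {+ 5} {+ 4} {+ n} {s} (mod-sym {+ 5} {+ n} {+ 4} n≡4) q) p))

    T₁ T₂ T₃ T₄ : Series
    T₁ = J 1 ⊛ (ψa ⊛ ψa)
    T₂ = D ⊛ ψb
    T₃ = J 1 ⊛ (ψb ⊛ ψb)
    T₄ = JΨ ⊛ ψb

    -- With ψ = ψa + ψb, J ψ² is J ψa² + 2 J ψ ψb - J ψb²; then J ψ = D - 2 JΨ is substituted. The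
    -- resulting -4 JΨ ψb joins the -JΨ ψb coming from `K` to form a multiple of 5.
    decomposition : ψ 5 ⊛ K ≈ ((T₁ ⊞ const (+ 2) ⊛ T₂) ⊞ (⊟ T₃)) ⊞ (⊟ (const (+ 5) ⊛ T₄))
    decomposition = R.trans (solve 5 (λ p F c b j → p :* (F :+ :- (c :* (b :* j))) := F :* p :+ :- (c :* (j :* p) :* b)) R.refl (ψ 5) F (monomial 1ℤ 1) ψb (J 5))
      (R.trans (R.+-congʳ (mod-5-theta (divides 1ℤ refl)))
      (solve 4 (λ j p b x → j :* (p :* p) :+ :- (x :* b)
        := (((j :* ((p :+ :- b) :* (p :+ :- b))) :+ con (+ 2) :* ((j :* p :+ con (+ 2) :* x) :* b)) :+ :- (j :* (b :* b))) :+ :- (con (+ 5) :* (x :* b)))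
        R.refl (J 1) (ψ 1) ψb JΨ))

    -- The classes of `T₁` are 0 to 3, those of `T₂` are 3 plus 0, 2, 3, 4, and those of `T₃` are 6
    -- plus 0, 1: never 4.
    ψK-vanish : ∀ n → n ℕ.≤ N → + n ≡ + 4 [mod + 5 ] → + 5 ∣ (ψ 5 ⊛ K) n
    ψK-vanish n n≤N n≡4 = cast (sub-add ((ψ 5 ⊛ K) n) (rhs n)) (∣m∣n⇒∣m+n (at decomposition n n≤N) rhs-∣)
      where
      rhs : Series
      rhs = ((T₁ ⊞ const (+ 2) ⊛ T₂) ⊞ (⊟ T₃)) ⊞ (⊟ (const (+ 5) ⊛ T₄))
      sub-add : ∀ a b → a - b + b ≡ a
      sub-add = solve-∀
      T₁-∣ : + 5 ∣ T₁ n
      T₁-∣ = vanish-at-4 (⊛-supported J-supported (⊛-supported ψa-supported ψa-supported)) n n≤N n≡4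
      T₂-∣ : + 5 ∣ T₂ n
      T₂-∣ = vanish-at-4 (⊛-supported D-supported ψb-supported) n n≤N n≡4
      T₃-∣ : + 5 ∣ T₃ n
      T₃-∣ = vanish-at-4 (⊛-supported J-supported (⊛-supported ψb-supported ψb-supported)) n n≤N n≡4
      neg-∣ : ∀ f → + 5 ∣ f n → + 5 ∣ (⊟ f) n
      neg-∣ f p = cast (sym (⊟-at f n)) (∣m⇒∣-m p)
      add-∣ : ∀ f g → + 5 ∣ f n → + 5 ∣ g n → + 5 ∣ (f ⊞ g) n
      add-∣ f g p r = cast (sym (⊞-at f g n)) (∣m∣n⇒∣m+n p r)
      rhs-∣ : + 5 ∣ rhs n
      rhs-∣ = add-∣ ((T₁ ⊞ const (+ 2) ⊛ T₂) ⊞ (⊟ T₃)) (⊟ (const (+ 5) ⊛ T₄))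
        (add-∣ (T₁ ⊞ const (+ 2) ⊛ T₂) (⊟ T₃) (add-∣ T₁ (const (+ 2) ⊛ T₂) T₁-∣ (cast (sym (const-⊛ (+ 2) T₂ n)) (∣n⇒∣m*n (+ 2) T₂-∣))) (neg-∣ T₃ T₃-∣))
        (neg-∣ (const (+ 5) ⊛ T₄) (cast (sym (const-⊛ (+ 5) T₄ n)) (∣m⇒∣m*n (T₄ n) (divides 1ℤ refl))))

    ψ-unit : ψ 5 0 ≡ 1ℤ
    ψ-unit = trans (θ-at (λ _ → 1ℤ) (λ a → e a ℕ.* 5) 0) (go N)
      where
      zero-term : ∀ a → ∣ a ∣ ≢ 0 → 1ℤ * [ e a ℕ.* 5 ≐ 0 ] ≡ 0ℤ
      zero-term a a≢0 = cong (λ z → 1ℤ * z) (monomial-≢ 1ℤ {e a ℕ.* 5} {0} λ eq → a≢0 (ℕ.n≤0⇒n≡0 (ℕ.≤-trans (∣a∣≤e a) (ℕ.≤-trans (ℕ.m≤m*n (e a) 5) (ℕ.≤-reflexive eq)))))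
      go : ∀ K → Σˡ (λ a → 1ℤ * [ e a ℕ.* 5 ≐ 0 ]) (integers (suc K)) ≡ 1ℤ
      go zero    = refl
      go (suc K) = cong₂ _+_ (zero-term (+ suc K) (λ ())) (cong₂ _+_ (zero-term -[1+ suc K ] (λ ())) (go K))

    -- All exponents of `ψ 5` are multiples of 5, so it can be cancelled within one class modulo 5.
    K-vanish : ∀ n → n ℕ.≤ N → + n ≡ + 4 [mod + 5 ] → + 5 ∣ K n
    K-vanish = ⊛-cancel-on (λ n → + n ≡ + 4 [mod + 5 ]) (ψ 5) K N ψ-unit supp ψK-vanish
      where
      supp : ∀ i j → i ℕ.+ j ℕ.≤ N → + (i ℕ.+ j) ≡ + 4 [mod + 5 ] → ¬ + 5 ∣ ψ 5 i → + j ≡ + 4 [mod + 5 ]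
      supp i j _ p ψi≢0 with + 5 ∣? + i
      ... | yes q = cast (lemma (+ i) (+ j)) (∣m∣n⇒∣m-n p q)
        where
        lemma : ∀ i j → (i + j - + 4) - i ≡ j - + 4
        lemma = solve-∀
      ... | no ¬q = ⊥-elim (ψi≢0 (θ-∣ (λ _ → 1ℤ) (λ a → e a ℕ.* 5) i (λ { a refl → ⊥-elim (¬q (divides (+ e a) (ℤ.pos-* (e a) 5))) })))

    -- On the class 4, `F` agrees with q⁴ ψ(q²⁵) J(q⁵). The exponent 25k + 5s + 4 requires e b ≡ s
    -- modulo 5 in `J`, and when s avoids the classes 0 and 1 the weight 4b + 1 is divisible by 5.
    A₅-∣ : ∀ k s → N ≡ 25 ℕ.* k ℕ.+ 5 ℕ.* s ℕ.+ 4 → ¬ (+ s ≡ 0ℤ [mod + 5 ]) → ¬ (+ s ≡ 1ℤ [mod + 5 ]) → + 5 ∣ partialProd 5 N N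
    A₅-∣ k s N≡ s≢0 s≢1 = cast (lemma (partialProd 5 N N) (F N) (G N) (G′ N)) (∣m∣n⇒∣m+n (∣m∣n⇒∣m+n (∣m∣n⇒∣m+n
      (at partialProd-limit N ℕ.≤-refl)
      (cast (trans (⊞-at F (⊟ G) N) (cong (λ z → F N + z) (⊟-at G N))) (K-vanish N ℕ.≤-refl N≡4)))
      (at G≈G′ N ℕ.≤-refl)) G′-∣)
      where
      lemma : ∀ a f g h → a - f + (f - g) + (g - h) + h ≡ a
      lemma = solve-∀
      G G′ : Series
      G  = monomial 1ℤ 1 ⊛ (ψb ⊛ J 5)
      G′ = monomial 1ℤ 4 ⊛ (ψ 25 ⊛ J 5)
      G≈G′ : G ≈ G′
      G≈G′ = R.trans (solve 4 (λ a b c d → a :* ((b :* c) :* d) := (a :* b) :* (c :* d)) R.refl (monomial 1ℤ 1) (monomial 1ℤ 3) (ψ 25) (J 5))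
        (R.*-congʳ (monomial-* 1ℤ 1ℤ 1 3))
      N-≡ : + N ≡ + 25 * + k + + 5 * + s + + 4
      N-≡ = trans (cong +_ N≡) (cong (λ z → z + + 4) (cong₂ _+_ (ℤ.pos-* 25 k) (ℤ.pos-* 5 s)))
      N≡4 : + N ≡ + 4 [mod + 5 ]
      N≡4 = divides (+ 5 * + k + + s) (trans (cong (λ z → z - + 4) N-≡) (collect (+ k) (+ s)))
        where
        collect : ∀ k s → + 25 * k + + 5 * s + + 4 - + 4 ≡ (+ 5 * k + s) * + 5
        collect = solve-∀
      G′-∣ : + 5 ∣ G′ N
      G′-∣ = ⊛-∣ (monomial 1ℤ 4) (ψ 25 ⊛ J 5) N term
        where
        term : ∀ i j → i ℕ.+ j ≡ N → + 5 ∣ monomial 1ℤ 4 i * (ψ 25 ⊛ J 5) j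
        term i j i+j≡N with 4 ℕ.≟ i
        ... | no 4≢i = cast (sym (cong (λ z → z * (ψ 25 ⊛ J 5) j) (monomial-≢ 1ℤ 4≢i))) (divides 0ℤ refl)
        ... | yes refl = ∣n⇒∣m*n (monomial 1ℤ 4 4) (θ-⊛-∣ (λ _ → 1ℤ) (λ a → e a ℕ.* 25) w (λ b → e b ℕ.* 5) j λ a b eq → ∣n⇒∣m*n 1ℤ (weight a b eq))
          where
          same-class : ∀ a b → e a ℕ.* 25 ℕ.+ e b ℕ.* 5 ≡ j → + s ≡ + e b [mod + 5 ]
          same-class a b eq = *-cancelʳ-∣ (+ 5) (divides (+ e a - + k) (trans (collect (+ k) (+ s) (+ e a) (+ e b)) (trans (cong (λ z → z - (+ 4 + (+ e a * + 25 + + e b * + 5)) + (+ e a - + k) * (+ 5 * + 5)) total) (cancel (+ 4 + (+ e a * + 25 + + e b * + 5)) ((+ e a - + k) * (+ 5 * + 5))))))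
            where
            total : + 25 * + k + + 5 * + s + + 4 ≡ + 4 + (+ e a * + 25 + + e b * + 5)
            total = trans (sym N-≡) (trans (sym (cong +_ i+j≡N)) (cong (λ z → + 4 + z) (trans (sym (cong +_ eq)) (cong₂ _+_ (ℤ.pos-* (e a) 25) (ℤ.pos-* (e b) 5)))))
            collect : ∀ k s a b → (s - b) * + 5 ≡ (+ 25 * k + + 5 * s + + 4) - (+ 4 + (a * + 25 + b * + 5)) + (a - k) * (+ 5 * + 5)
            collect = solve-∀
            cancel : ∀ x y → x - x + y ≡ y
            cancel = solve-∀
          weight : ∀ a b → e a ℕ.* 25 ℕ.+ e b ℕ.* 5 ≡ j → + 5 ∣ w b
          weight a b eq with e-classes b
          ... | inj₂ (_ , q) = w-∣ b q
          ... | inj₁ (here q)         = ⊥-elim (s≢0 (mod-trans {+ 5} {+ s} {+ e b} {0ℤ} s≡e q))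
            where s≡e = same-class a b eq
          ... | inj₁ (there (here q)) = ⊥-elim (s≢1 (mod-trans {+ 5} {+ s} {+ e b} {1ℤ} s≡e q))
            where s≡e = same-class a b eq

  -- The parity of ψ(q) P(q⁵) on even exponents

  χ-false : {P : Set} (d : Dec P) → ¬ P → χ d ≡ 0ℤ
  χ-false (yes p) ¬p = ⊥-elim (¬p p)
  χ-false (no _)  ¬p = refl

  χ-⇔ : {P Q : Set} (d : Dec P) (d′ : Dec Q) → (P → Q) → (Q → P) → χ d ≡ χ d′
  χ-⇔ (yes p) d′ f g = sym (χ-true d′ (f p))
  χ-⇔ (no ¬p) d′ f g = sym (χ-false d′ (¬p ∘ g))

  even-or-odd : ∀ x → (+ 2 ∣ x) ⊎ (+ 2 ∣ x - 1ℤ)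
  even-or-odd x with x ℤ.%ℕ 2 | ℤ.n%ℕd<d x 2 | ℤ.a≡a%ℕn+[a/ℕn]*n x 2
  ... | 0 | _ | eq = inj₁ (divides (x ℤ./ℕ 2) (trans eq (ℤ.+-identityˡ _)))
  ... | 1 | _ | eq = inj₂ (divides (x ℤ./ℕ 2) (trans (cong (λ z → z - 1ℤ) eq) (lemma (x ℤ./ℕ 2))))
    where
    lemma : ∀ q → 1ℤ + q * + 2 - 1ℤ ≡ q * + 2
    lemma = solve-∀
  ... | suc (suc _) | s≤s (s≤s ()) | _

  χ-mod-4 : ∀ x v → (v ≢ 0ℤ → + 2 ∣ x) → v ≡ χ (+ 4 ∣? (x - + 2)) * v + χ (+ 4 ∣? x) * v
  χ-mod-4 x v h with v ℤ.≟ 0ℤ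
  ... | yes refl = sym (cong₂ _+_ (ℤ.*-zeroʳ (χ (+ 4 ∣? (x - + 2)))) (ℤ.*-zeroʳ (χ (+ 4 ∣? x))))
  ... | no v≢0 with h v≢0
  ... | divides y refl with even-or-odd y
  ... | inj₁ (divides t refl) = trans (lemma v) (cong₂ (λ a b → a * v + b * v)
    (sym (χ-false (+ 4 ∣? (t * + 2 * + 2 - + 2)) λ p → from-no (+ 4 ∣? + 2) (cast (cancel t) (∣m∣n⇒∣m-n (divides t refl) p))))
    (sym (χ-true (+ 4 ∣? (t * + 2 * + 2)) (divides t (assoc t)))))
    where
    lemma : ∀ v → v ≡ 0ℤ * v + 1ℤ * v
    lemma = solve-∀
    cancel : ∀ t → t * + 4 - (t * + 2 * + 2 - + 2) ≡ + 2
    cancel = solve-∀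
    assoc : ∀ t → t * + 2 * + 2 ≡ t * + 4
    assoc = solve-∀
  ... | inj₂ (divides t eq) = trans (lemma v) (cong₂ (λ a b → a * v + b * v)
    (sym (χ-true (+ 4 ∣? (y * + 2 - + 2)) 4∣))
    (sym (χ-false (+ 4 ∣? (y * + 2)) λ p → from-no (+ 4 ∣? + 2) (cast (cancel y) (∣m∣n⇒∣m-n p 4∣)))))
    where
    lemma : ∀ v → v ≡ 1ℤ * v + 0ℤ * v
    lemma = solve-∀
    cancel : ∀ y → y * + 2 - (y * + 2 - + 2) ≡ + 2
    cancel = solve-∀
    factor : ∀ y → y * + 2 - + 2 ≡ (y - 1ℤ) * + 2
    factor = solve-∀
    assoc : ∀ t → t * + 2 * + 2 ≡ t * + 4
    assoc = solve-∀
    4∣ : + 4 ∣ y * + 2 - + 2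
    4∣ = divides t (trans (factor y) (trans (cong (λ z → z * + 2) eq) (assoc t)))

  module Parity (N : ℕ) where

    open Products (+ 2) N using (ψ; Pe; Po; P; L)
    open Coefficients (+ 2) N

    -- Room for the parameters: 4t is a form a + c s + d with c at most 3 and d at most 2 in
    -- absolute value, in coordinates bounded by N, hence at most 4N + 2.
    K : ℕ
    K = 4 ℕ.* suc N

    Ee Eo : ℤ × ℤ → ℕ
    Ee (a , s) = e a ℕ.* 1 ℕ.+ pe s ℕ.* 5
    Eo (a , s) = e a ℕ.* 1 ℕ.+ po s ℕ.* 5

    Ee-≡ : ∀ a s → + Ee (a , s) ≡ a * (+ 2 * a + 1ℤ) + s * (+ 6 * s + 1ℤ) * + 5
    Ee-≡ a s = cong₂ _+_ (trans (cong +_ (ℕ.*-identityʳ (e a))) (e-≡ a)) (trans (ℤ.pos-* (pe s) 5) (cong (λ z → z * + 5) (pe-≡ s)))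

    Eo-≡ : ∀ a s → + Eo (a , s) ≡ a * (+ 2 * a + 1ℤ) + (+ 2 * s + 1ℤ) * (+ 3 * s + + 2) * + 5
    Eo-≡ a s = cong₂ _+_ (trans (cong +_ (ℕ.*-identityʳ (e a))) (e-≡ a)) (trans (ℤ.pos-* (po s) 5) (cong (λ z → z * + 5) (po-≡ s)))

    module _ (n : ℕ) (n≤N : n ℕ.≤ N) (2∣n : + 2 ∣ + n) where

      Small : ℤ × ℤ → Set
      Small (a , s) = ∣ a ∣ ℕ.≤ N × ∣ s ∣ ℕ.≤ N

      Ee-small : ∀ p → Ee p ≡ n → Small p
      Ee-small (a , s) refl =
        ℕ.≤-trans (∣a∣≤e a) (ℕ.≤-trans (ℕ.m≤m*n (e a) 1) (ℕ.≤-trans (ℕ.m≤m+n _ _) n≤N)) ,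
        ℕ.≤-trans (∣s∣≤pe s) (ℕ.≤-trans (ℕ.m≤m*n (pe s) 5) (ℕ.≤-trans (ℕ.m≤n+m _ (e a ℕ.* 1)) n≤N))

      Eo-small : ∀ p → Eo p ≡ n → Small p
      Eo-small (a , s) refl =
        ℕ.≤-trans (∣a∣≤e a) (ℕ.≤-trans (ℕ.m≤m*n (e a) 1) (ℕ.≤-trans (ℕ.m≤m+n _ _) n≤N)) ,
        ℕ.≤-trans (∣s∣≤po s) (ℕ.≤-trans (ℕ.m≤m*n (po s) 5) (ℕ.≤-trans (ℕ.m≤n+m _ (e a ℕ.* 1)) n≤N))

      ∈-box-L : ∀ {p} → Small p → p ∈ box L
      ∈-box-L (p , r) = ∈-box (s≤s p) (s≤s r)

      quarter : ∀ a s t c d → ∣ a ∣ ℕ.≤ N → ∣ s ∣ ℕ.≤ N → t * + 4 ≡ a + c * s + d → ∣ c ∣ ℕ.≤ 3 → ∣ d ∣ ℕ.≤ 2 → ∣ t ∣ ℕ.< K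
      quarter a s t c d a≤ s≤ eq c≤ d≤ = ℕ.≤-trans (s≤s (ℕ.≤-trans (ℕ.m≤m*n ∣ t ∣ 4) (ℕ.≤-trans (ℕ.≤-reflexive (trans (sym (ℤ.abs-* t (+ 4))) (cong ∣_∣ eq)))
        (ℕ.≤-trans (ℤ.∣i+j∣≤∣i∣+∣j∣ (a + c * s) d) (ℕ.+-mono-≤ (ℕ.≤-trans (ℤ.∣i+j∣≤∣i∣+∣j∣ a (c * s)) (ℕ.+-mono-≤ a≤ (ℕ.≤-trans (ℕ.≤-reflexive (ℤ.abs-* c s)) (ℕ.*-mono-≤ c≤ s≤)))) d≤)))))
        (ℕ.≤-trans (ℕ.≤-reflexive (lemma N)) (ℕ.n≤1+n _))
        where
        lemma : ∀ N → suc (N ℕ.+ 3 ℕ.* N ℕ.+ 2) ≡ N ℕ.+ 3 ℕ.* suc N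
        lemma = ℕ-solve-∀

      small⇒K : ∀ {i} → i ℕ.≤ N → i ℕ.< K
      small⇒K i≤N = ℕ.≤-trans (s≤s i≤N) (ℕ.m≤n*m (suc N) 4)

      -- Parametrises a congruence sector by `φ`, so that the condition disappears from the sum.
      sector : (E : ℤ × ℤ → ℕ) (C : ℤ × ℤ → Set) (C? : ∀ p → Dec (C p)) (φ : ℤ × ℤ → ℤ × ℤ) →
        (∀ p → E p ≡ n → Small p) → (∀ y → C (φ y)) → (∀ {y y′} → φ y ≡ φ y′ → y ≡ y′) →
        (∀ p → C p → Small p → ∃ λ y → y ∈ box K × φ y ≡ p) →
        Σˡ (λ p → χ (C? p) * [ E p ≐ n ]) (box L) ≡ Σˡ (λ y → [ E (φ y) ≐ n ]) (box K)
      sector E C C? φ small hit injective onto = trans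
        (reindex (λ p → χ (C? p) * [ E p ≐ n ]) φ (box-unique L) (box-unique K) injective
          (λ p h → let Cp , ≢0 = χ-*-≢0 (C? p) h in onto p Cp (small p (≐-≡ (E p) n ≢0)))
          (λ y h → ∈-box-L (small (φ y) (≐-≡ (E (φ y)) n (proj₂ (χ-*-≢0 (C? (φ y)) h))))))
        (Σˡ-cong (λ y → trans (cong (λ z → z * [ E (φ y) ≐ n ]) (χ-true (C? (φ y)) (hit y))) (ℤ.*-identityˡ _)) (box K))

      -- The involution pairs the terms with t > 0 and t < 0, so modulo 2 only t = 0 remains.
      reflection : (H : ℤ × ℤ → ℕ) (σ : ℤ × ℤ → ℤ × ℤ) → (∀ y → H y ≡ n → y ∈ box K) →
        (∀ y → σ (σ y) ≡ y) → (∀ y → H (σ y) ≡ H y) → (∀ y → proj₂ (σ y) ≡ - proj₂ y) →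
        Σˡ (λ y → [ H y ≐ n ]) (box K) ≡ Σˡ (λ s → [ H (s , 0ℤ) ≐ n ]) (integers K) [mod + 2 ]
      reflection H σ bound invol invar neg = cast (cong (λ z → z - Z) (sym total)) (divides P₊ (lemma P₊ Z))
        where
        lemma : ∀ p z → p + p + z - z ≡ p * + 2
        lemma = solve-∀
        h pos neg′ nul : ℤ × ℤ → ℤ
        h y = [ H y ≐ n ]
        pos y = χ (0ℤ ℤ.<? proj₂ y) * h y
        neg′ y = χ (proj₂ y ℤ.<? 0ℤ) * h y
        nul y = χ (proj₂ y ℤ.≟ 0ℤ) * h y
        P₊ Z : ℤ
        P₊ = Σˡ pos (box K)
        Z = Σˡ (λ s → [ H (s , 0ℤ) ≐ n ]) (integers K)
        split : ∀ y → h y ≡ pos y + neg′ y + nul y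
        split y@(s , t) with ℤ.<-cmp t 0ℤ
        ... | tri< a ¬b ¬c rewrite χ-true (t ℤ.<? 0ℤ) a | χ-false (t ℤ.≟ 0ℤ) ¬b | χ-false (0ℤ ℤ.<? t) ¬c = go (h y)
          where
          go : ∀ v → v ≡ 0ℤ * v + 1ℤ * v + 0ℤ * v
          go = solve-∀
        ... | tri≈ ¬a b ¬c rewrite χ-false (t ℤ.<? 0ℤ) ¬a | χ-true (t ℤ.≟ 0ℤ) b | χ-false (0ℤ ℤ.<? t) ¬c = go (h y)
          where
          go : ∀ v → v ≡ 0ℤ * v + 0ℤ * v + 1ℤ * v
          go = solve-∀
        ... | tri> ¬a ¬b c rewrite χ-false (t ℤ.<? 0ℤ) ¬a | χ-false (t ℤ.≟ 0ℤ) ¬b | χ-true (0ℤ ℤ.<? t) c = go (h y)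
          where
          go : ∀ v → v ≡ 1ℤ * v + 0ℤ * v + 0ℤ * v
          go = solve-∀
        h-bound : ∀ y → h y ≢ 0ℤ → y ∈ box K
        h-bound y ≢0 = bound y (≐-≡ (H y) n ≢0)
        h-invar : ∀ y → h (σ y) ≡ h y
        h-invar y = cong (λ i → [ i ≐ n ]) (invar y)
        neg≡pos : Σˡ neg′ (box K) ≡ P₊
        neg≡pos = trans (reindex neg′ σ (box-unique K) (box-unique K)
            (λ {y} {y′} eq → trans (sym (invol y)) (trans (cong σ eq) (invol y′)))
            (λ y ≢0 → σ y , h-bound (σ y) (λ eq → proj₂ (χ-*-≢0 (proj₂ y ℤ.<? 0ℤ) ≢0) (trans (sym (h-invar y)) eq)) , invol y)
            (λ y ≢0 → h-bound (σ y) (proj₂ (χ-*-≢0 (proj₂ (σ y) ℤ.<? 0ℤ) ≢0))))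
          (Σˡ-cong (λ y → cong₂ _*_ (χ-⇔ (proj₂ (σ y) ℤ.<? 0ℤ) (0ℤ ℤ.<? proj₂ y)
            (λ p → subst (0ℤ ℤ.<_) (ℤ.neg-involutive (proj₂ y)) (ℤ.neg-mono-< (subst (ℤ._< 0ℤ) (neg y) p)))
            (λ p → subst (ℤ._< 0ℤ) (sym (neg y)) (ℤ.neg-mono-< p))) (h-invar y)) (box K))
        nul≡Z : Σˡ nul (box K) ≡ Z
        nul≡Z = trans (reindex nul (λ s → s , 0ℤ) (box-unique K) (integers-unique K) (cong proj₁) onto (λ s ≢0 → h-bound (s , 0ℤ) (proj₂ (χ-*-≢0 (0ℤ ℤ.≟ 0ℤ) ≢0))))
          (Σˡ-cong (λ s → ℤ.*-identityˡ (h (s , 0ℤ))) (integers K))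
          where
          onto : ∀ y → nul y ≢ 0ℤ → ∃ λ s → s ∈ integers K × (s , 0ℤ) ≡ y
          onto (s , t) ≢0 with χ-*-≢0 (t ℤ.≟ 0ℤ) ≢0
          ... | refl , ≢0′ = s , proj₁ (∈-cartesianProduct⁻ (integers K) (integers K) (h-bound (s , 0ℤ) ≢0′)) , refl
        total : Σˡ h (box K) ≡ P₊ + P₊ + Z
        total = trans (Σˡ-cong split (box K)) (trans (Σˡ-+ (λ y → pos y + neg′ y) nul (box K)) (cong₂ _+_ (trans (Σˡ-+ pos neg′ (box K)) (cong (λ z → P₊ + z) neg≡pos)) nul≡Z))

      -- For x = 4a + 1 and y = 12s + 1, respectively y = 12s + 7, these are (x - y)/4 and (x +
      -- y)/4. On even exponents they are even, and their residue modulo 4 decides whether the new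
      -- first coordinate, (x - 5y)/4 respectively (x + 5y)/4, is 1 or -1 modulo 4. In the second
      -- case its sign must be changed, which turns the automorphism into an involution.
      xe xo : ℤ × ℤ → ℤ
      xe (a , s) = a - + 3 * s
      xo (a , s) = a + + 3 * s + + 2

      divide : ∀ (E : ℤ × ℤ → ℕ) (x : ℤ × ℤ → ℤ) → (∀ p → E p ≡ n → + 2 ∣ x p) →
        Σˡ (λ p → [ E p ≐ n ]) (box L) ≡ Σˡ (λ p → χ (+ 4 ∣? (x p - + 2)) * [ E p ≐ n ]) (box L) + Σˡ (λ p → χ (+ 4 ∣? x p) * [ E p ≐ n ]) (box L)
      divide E x h = trans (Σˡ-cong (λ p → χ-mod-4 (x p) [ E p ≐ n ] (λ ≢0 → h p (≐-≡ (E p) n ≢0))) (box L)) (Σˡ-+ (λ p → χ (+ 4 ∣? (x p - + 2)) * [ E p ≐ n ]) (λ p → χ (+ 4 ∣? x p) * [ E p ≐ n ]) (box L))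

      -- The exponent has the parity of a + s, hence of a - 3s.
      2∣xe : ∀ p → Ee p ≡ n → + 2 ∣ xe p
      2∣xe (a , s) eq = cast (lemma a s) (∣m∣n⇒∣m-n (cast (trans (sym (cong +_ eq)) (Ee-≡ a s)) 2∣n) (divides (a * a + + 15 * (s * s) + + 4 * s) refl))
        where
        lemma : ∀ a s → a * (+ 2 * a + 1ℤ) + s * (+ 6 * s + 1ℤ) * + 5 - (a * a + + 15 * (s * s) + + 4 * s) * + 2 ≡ a - + 3 * s
        lemma = solve-∀

      2∣xo : ∀ p → Eo p ≡ n → + 2 ∣ xo p
      2∣xo (a , s) eq = cast (lemma a s) (∣m∣n⇒∣m-n (cast (trans (sym (cong +_ eq)) (Eo-≡ a s)) 2∣n) (divides (a * a + + 15 * (s * s) + + 16 * s + + 4) refl))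
        where
        lemma : ∀ a s → a * (+ 2 * a + 1ℤ) + (+ 2 * s + 1ℤ) * (+ 3 * s + + 2) * + 5 - (a * a + + 15 * (s * s) + + 16 * s + + 4) * + 2 ≡ a + + 3 * s + + 2
        lemma = solve-∀

      -- With x = 4a + 1 and y = 6b + 1, where b = 2s or b = 2s + 1, the exponent is (3x² + 5y² - 8) / 24.
      -- Multiplication by (1 + √-15) / 4, of norm one, matches αe with αo and gives the reflections of βe and βo.
      αe αo βe βo : ℤ × ℤ → ℤ × ℤ
      αe (s , t) = + 3 * s + + 4 * t + + 2 , s
      αo (s , t) = t - + 3 * s , s + t
      βe (s , t) = + 3 * s + + 4 * t , s
      βo (s , t) = + 4 * t - + 3 * s - + 2 , s

      cancel₄ : ∀ {t t′ u v} → + 4 * t ≡ u → + 4 * t′ ≡ v → u ≡ v → t ≡ t′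
      cancel₄ {t} {t′} p r eq = ℤ.*-cancelˡ-≡ (+ 4) t t′ (trans p (trans eq (sym r)))

      sum-αe : Σˡ (λ p → χ (+ 4 ∣? (xe p - + 2)) * [ Ee p ≐ n ]) (box L) ≡ Σˡ (λ y → [ Ee (αe y) ≐ n ]) (box K)
      sum-αe = sector Ee (λ p → + 4 ∣ xe p - + 2) (λ p → + 4 ∣? (xe p - + 2)) αe Ee-small
        (λ (s , t) → divides t (hit s t))
        (λ {y} {y′} eq → cong₂ _,_ (cong proj₂ eq) (cancel₄ {u = proj₁ (αe y) - + 3 * proj₂ (αe y) - + 2} (4t (proj₁ y) (proj₂ y)) (4t (proj₁ y′) (proj₂ y′)) (cong (λ p → proj₁ p - + 3 * proj₂ p - + 2) eq)))
        onto
        where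
        hit : ∀ s t → + 3 * s + + 4 * t + + 2 - + 3 * s - + 2 ≡ t * + 4
        hit = solve-∀
        4t : ∀ s t → + 4 * t ≡ + 3 * s + + 4 * t + + 2 - + 3 * s - + 2
        4t = solve-∀
        onto : ∀ p → + 4 ∣ xe p - + 2 → Small p → ∃ λ y → y ∈ box K × αe y ≡ p
        onto (a , s) (divides t eq) small = (s , t) , ∈-box (small⇒K (proj₂ small)) t<K ,
          cong (_, s) (trans (cong (λ z → + 3 * s + z + + 2) (trans (ℤ.*-comm (+ 4) t) (sym eq))) (back a s))
          where
          back : ∀ a s → + 3 * s + (a - + 3 * s - + 2) + + 2 ≡ a
          back = solve-∀
          minus : ∀ a s → a - + 3 * s - + 2 ≡ a + - + 3 * s + - + 2
          minus = solve-∀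
          t<K : ∣ t ∣ ℕ.< K
          t<K = quarter a s t (- + 3) (- + 2) (proj₁ small) (proj₂ small) (trans (sym eq) (minus a s)) ℕ.≤-refl ℕ.≤-refl

      sum-αo : Σˡ (λ p → χ (+ 4 ∣? (xo p - + 2)) * [ Eo p ≐ n ]) (box L) ≡ Σˡ (λ y → [ Eo (αo y) ≐ n ]) (box K)
      sum-αo = sector Eo (λ p → + 4 ∣ xo p - + 2) (λ p → + 4 ∣? (xo p - + 2)) αo Eo-small
        (λ (s , t) → divides t (hit s t))
        (λ {y} {y′} eq → cong₂ _,_
          (cancel₄ {u = proj₂ (αo y) - proj₁ (αo y)} (4s (proj₁ y) (proj₂ y)) (4s (proj₁ y′) (proj₂ y′)) (cong (λ p → proj₂ p - proj₁ p) eq))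
          (cancel₄ {u = proj₁ (αo y) + + 3 * proj₂ (αo y)} (4t (proj₁ y) (proj₂ y)) (4t (proj₁ y′) (proj₂ y′)) (cong (λ p → proj₁ p + + 3 * proj₂ p) eq)))
        onto
        where
        hit : ∀ s t → t - + 3 * s + + 3 * (s + t) + + 2 - + 2 ≡ t * + 4
        hit = solve-∀
        4s : ∀ s t → + 4 * s ≡ s + t - (t - + 3 * s)
        4s = solve-∀
        4t : ∀ s t → + 4 * t ≡ t - + 3 * s + + 3 * (s + t)
        4t = solve-∀
        onto : ∀ p → + 4 ∣ xo p - + 2 → Small p → ∃ λ y → y ∈ box K × αo y ≡ p
        -- `αo` is parametrised through its partner `αe`, so its second coordinate is not itself a
        -- parameter; solving for the parameters gives s - t, which needs a bound of its own.
        onto (a , s) (divides t eq) small = (s - t , t) , ∈-box s-t<K t<K ,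
          cong₂ _,_ (trans (first s t) (trans (cong (λ z → z - + 3 * s) (sym eq)) (back a s))) (second s t)
          where
          first : ∀ s t → t - + 3 * (s - t) ≡ t * + 4 - + 3 * s
          first = solve-∀
          second : ∀ s t → s - t + t ≡ s
          second = solve-∀
          back : ∀ a s → a + + 3 * s + + 2 - + 2 - + 3 * s ≡ a
          back = solve-∀
          minus : ∀ a s → a + + 3 * s + + 2 - + 2 ≡ a + + 3 * s + 0ℤ
          minus = solve-∀
          difference : ∀ a s → s * + 4 - (a + + 3 * s + + 2 - + 2) ≡ s + - 1ℤ * a + 0ℤ
          difference = solve-∀
          distrib : ∀ s t → (s - t) * + 4 ≡ s * + 4 - t * + 4
          distrib = solve-∀
          t<K : ∣ t ∣ ℕ.< K
          t<K = quarter a s t (+ 3) 0ℤ (proj₁ small) (proj₂ small) (trans (sym eq) (minus a s)) ℕ.≤-refl z≤n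
          s-t<K : ∣ s - t ∣ ℕ.< K
          s-t<K = quarter s a (s - t) (- 1ℤ) 0ℤ (proj₂ small) (proj₁ small) (trans (distrib s t) (trans (cong (λ z → s * + 4 - z) (sym eq)) (difference a s))) (s≤s z≤n) z≤n

      sum-βe : Σˡ (λ p → χ (+ 4 ∣? xe p) * [ Ee p ≐ n ]) (box L) ≡ Σˡ (λ y → [ Ee (βe y) ≐ n ]) (box K)
      sum-βe = sector Ee (λ p → + 4 ∣ xe p) (λ p → + 4 ∣? xe p) βe Ee-small
        (λ (s , t) → divides t (hit s t))
        (λ {y} {y′} eq → cong₂ _,_ (cong proj₂ eq) (cancel₄ {u = proj₁ (βe y) - + 3 * proj₂ (βe y)} (4t (proj₁ y) (proj₂ y)) (4t (proj₁ y′) (proj₂ y′)) (cong (λ p → proj₁ p - + 3 * proj₂ p) eq)))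
        onto
        where
        hit : ∀ s t → + 3 * s + + 4 * t - + 3 * s ≡ t * + 4
        hit = solve-∀
        4t : ∀ s t → + 4 * t ≡ + 3 * s + + 4 * t - + 3 * s
        4t = solve-∀
        onto : ∀ p → + 4 ∣ xe p → Small p → ∃ λ y → y ∈ box K × βe y ≡ p
        onto (a , s) (divides t eq) small = (s , t) , ∈-box (small⇒K (proj₂ small)) (quarter a s t (- + 3) 0ℤ (proj₁ small) (proj₂ small) (trans (sym eq) (minus a s)) ℕ.≤-refl z≤n) ,
          cong (_, s) (trans (cong (λ z → + 3 * s + z) (trans (ℤ.*-comm (+ 4) t) (sym eq))) (back a s))
          where
          back : ∀ a s → + 3 * s + (a - + 3 * s) ≡ a
          back = solve-∀
          minus : ∀ a s → a - + 3 * s ≡ a + - + 3 * s + 0ℤ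
          minus = solve-∀

      sum-βo : Σˡ (λ p → χ (+ 4 ∣? xo p) * [ Eo p ≐ n ]) (box L) ≡ Σˡ (λ y → [ Eo (βo y) ≐ n ]) (box K)
      sum-βo = sector Eo (λ p → + 4 ∣ xo p) (λ p → + 4 ∣? xo p) βo Eo-small
        (λ (s , t) → divides t (hit s t))
        (λ {y} {y′} eq → cong₂ _,_ (cong proj₂ eq) (cancel₄ {u = proj₁ (βo y) + + 3 * proj₂ (βo y) + + 2} (4t (proj₁ y) (proj₂ y)) (4t (proj₁ y′) (proj₂ y′)) (cong (λ p → proj₁ p + + 3 * proj₂ p + + 2) eq)))
        onto
        where
        hit : ∀ s t → + 4 * t - + 3 * s - + 2 + + 3 * s + + 2 ≡ t * + 4
        hit = solve-∀
        4t : ∀ s t → + 4 * t ≡ + 4 * t - + 3 * s - + 2 + + 3 * s + + 2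
        4t = solve-∀
        onto : ∀ p → + 4 ∣ xo p → Small p → ∃ λ y → y ∈ box K × βo y ≡ p
        onto (a , s) (divides t eq) small = (s , t) , ∈-box (small⇒K (proj₂ small)) (quarter a s t (+ 3) (+ 2) (proj₁ small) (proj₂ small) (sym eq) ℕ.≤-refl ℕ.≤-refl) ,
          cong (_, s) (trans (cong (λ z → z - + 3 * s - + 2) (trans (ℤ.*-comm (+ 4) t) (sym eq))) (back a s))
          where
          back : ∀ a s → a + + 3 * s + + 2 - + 3 * s - + 2 ≡ a
          back = solve-∀

      -- In the coordinates x and y, the automorphism (x, y) ↦ ((x - 5y)/4, (3x + y)/4) of 3x² + 5y²
      -- sends `αe (s , t)` to `αo (s , t)`.
      sum-α : Σˡ (λ y → [ Ee (αe y) ≐ n ]) (box K) ≡ Σˡ (λ y → [ Eo (αo y) ≐ n ]) (box K)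
      sum-α = Σˡ-cong (λ (s , t) → cong (λ i → [ i ≐ n ]) (ℤ.+-injective (trans (Ee-≡ (+ 3 * s + + 4 * t + + 2) s) (trans (lemma s t) (sym (Eo-≡ (t - + 3 * s) (s + t))))))) (box K)
        where
        lemma : ∀ s t → (+ 3 * s + + 4 * t + + 2) * (+ 2 * (+ 3 * s + + 4 * t + + 2) + 1ℤ) + s * (+ 6 * s + 1ℤ) * + 5
          ≡ (t - + 3 * s) * (+ 2 * (t - + 3 * s) + 1ℤ) + (+ 2 * (s + t) + 1ℤ) * (+ 3 * (s + t) + + 2) * + 5
        lemma = solve-∀

      -- For t = 0 one has x² = y², so the exponent is 8 times a generalised pentagonal number; only
      -- the interval has to be cut back from `K` to `L`.
      sum-8 : ∀ (H : ℤ × ℤ → ℕ) (ε : ℤ → ℕ) → (∀ s → ∣ s ∣ ℕ.≤ ε s) → (∀ s → H (s , 0ℤ) ≡ ε s ℕ.* 8) →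
        Σˡ (λ s → [ H (s , 0ℤ) ≐ n ]) (integers K) ≡ Σˡ (λ s → 1ℤ * [ ε s ℕ.* 8 ≐ n ]) (integers L)
      sum-8 H ε bound H≡ = trans (Σˡ-cong (λ s → trans (cong (λ i → [ i ≐ n ]) (H≡ s)) (sym (ℤ.*-identityˡ _))) (integers K))
        (reindex (λ s → 1ℤ * [ ε s ℕ.* 8 ≐ n ]) id (integers-unique K) (integers-unique L) id
          (λ s ≢0 → s , ∈-integers L (s≤s (small s ≢0)) , refl) (λ s ≢0 → ∈-integers K (small⇒K (small s ≢0))))
        where
        small : ∀ s → 1ℤ * [ ε s ℕ.* 8 ≐ n ] ≢ 0ℤ → ∣ s ∣ ℕ.≤ N
        small s ≢0 = ℕ.≤-trans (bound s) (ℕ.≤-trans (ℕ.m≤m*n (ε s) 8) (ℕ.≤-trans (ℕ.≤-reflexive (≐-≡ (ε s ℕ.* 8) n (*-≢0 1ℤ ≢0))) n≤N))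

      -- The involution is (x, y) ↦ ((5y - x)/4, (3x + y)/4), whose fixed points are x = y.
      sum-8e : Σˡ (λ y → [ Ee (βe y) ≐ n ]) (box K) ≡ Pe 8 n [mod + 2 ]
      sum-8e = cast (cong (λ z → Σˡ (λ y → [ Ee (βe y) ≐ n ]) (box K) - z) (trans (sum-8 (Ee ∘ βe) pe ∣s∣≤pe eightfold) (sym (θ-at (λ _ → 1ℤ) (λ s → pe s ℕ.* 8) n))))
        (reflection (Ee ∘ βe) (λ (s , t) → s + t , - t)
          (λ (s , t) eq → let small = Ee-small (βe (s , t)) eq in ∈-box (small⇒K (proj₂ small)) (quarter (+ 3 * s + + 4 * t) s t (- + 3) 0ℤ (proj₁ small) (proj₂ small) (bound s t) ℕ.≤-refl z≤n))
          (λ (s , t) → cong₂ _,_ (twice s t) (ℤ.neg-involutive t))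
          (λ (s , t) → ℤ.+-injective (trans (Ee-≡ (+ 3 * (s + t) + + 4 * - t) (s + t)) (trans (invariant s t) (sym (Ee-≡ (+ 3 * s + + 4 * t) s)))))
          (λ _ → refl))
        where
        bound : ∀ s t → t * + 4 ≡ + 3 * s + + 4 * t + - + 3 * s + 0ℤ
        bound = solve-∀
        twice : ∀ s t → s + t + - t ≡ s
        twice = solve-∀
        invariant : ∀ s t → (+ 3 * (s + t) + + 4 * - t) * (+ 2 * (+ 3 * (s + t) + + 4 * - t) + 1ℤ) + (s + t) * (+ 6 * (s + t) + 1ℤ) * + 5
          ≡ (+ 3 * s + + 4 * t) * (+ 2 * (+ 3 * s + + 4 * t) + 1ℤ) + s * (+ 6 * s + 1ℤ) * + 5
        invariant = solve-∀
        eightfold : ∀ s → Ee (βe (s , 0ℤ)) ≡ pe s ℕ.* 8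
        eightfold s = ℤ.+-injective (trans (Ee-≡ (+ 3 * s + + 4 * 0ℤ) s) (trans (lemma s) (sym (trans (ℤ.pos-* (pe s) 8) (cong (λ z → z * + 8) (pe-≡ s))))))
          where
          lemma : ∀ s → (+ 3 * s + + 4 * 0ℤ) * (+ 2 * (+ 3 * s + + 4 * 0ℤ) + 1ℤ) + s * (+ 6 * s + 1ℤ) * + 5 ≡ s * (+ 6 * s + 1ℤ) * + 8
          lemma = solve-∀

      -- The involution is (x, y) ↦ (-(x + 5y)/4, (y - 3x)/4), whose fixed points are x = -y.
      sum-8o : Σˡ (λ y → [ Eo (βo y) ≐ n ]) (box K) ≡ Po 8 n [mod + 2 ]
      sum-8o = cast (cong (λ z → Σˡ (λ y → [ Eo (βo y) ≐ n ]) (box K) - z) (trans (sum-8 (Eo ∘ βo) po ∣s∣≤po eightfold) (sym (θ-at (λ _ → 1ℤ) (λ s → po s ℕ.* 8) n))))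
        (reflection (Eo ∘ βo) (λ (s , t) → s - t , - t)
          (λ (s , t) eq → let small = Eo-small (βo (s , t)) eq in ∈-box (small⇒K (proj₂ small)) (quarter (+ 4 * t - + 3 * s - + 2) s t (+ 3) (+ 2) (proj₁ small) (proj₂ small) (bound s t) ℕ.≤-refl ℕ.≤-refl))
          (λ (s , t) → cong₂ _,_ (twice s t) (ℤ.neg-involutive t))
          (λ (s , t) → ℤ.+-injective (trans (Eo-≡ (+ 4 * - t - + 3 * (s - t) - + 2) (s - t)) (trans (invariant s t) (sym (Eo-≡ (+ 4 * t - + 3 * s - + 2) s)))))
          (λ _ → refl))
        where
        bound : ∀ s t → t * + 4 ≡ + 4 * t - + 3 * s - + 2 + + 3 * s + + 2
        bound = solve-∀
        twice : ∀ s t → s - t - - t ≡ s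
        twice = solve-∀
        invariant : ∀ s t → (+ 4 * - t - + 3 * (s - t) - + 2) * (+ 2 * (+ 4 * - t - + 3 * (s - t) - + 2) + 1ℤ) + (+ 2 * (s - t) + 1ℤ) * (+ 3 * (s - t) + + 2) * + 5
          ≡ (+ 4 * t - + 3 * s - + 2) * (+ 2 * (+ 4 * t - + 3 * s - + 2) + 1ℤ) + (+ 2 * s + 1ℤ) * (+ 3 * s + + 2) * + 5
        invariant = solve-∀
        eightfold : ∀ s → Eo (βo (s , 0ℤ)) ≡ po s ℕ.* 8
        eightfold s = ℤ.+-injective (trans (Eo-≡ (+ 4 * 0ℤ - + 3 * s - + 2) s) (trans (lemma s) (sym (trans (ℤ.pos-* (po s) 8) (cong (λ z → z * + 8) (po-≡ s))))))
          where
          lemma : ∀ s → (+ 4 * 0ℤ - + 3 * s - + 2) * (+ 2 * (+ 4 * 0ℤ - + 3 * s - + 2) + 1ℤ) + (+ 2 * s + 1ℤ) * (+ 3 * s + + 2) * + 5 ≡ (+ 2 * s + 1ℤ) * (+ 3 * s + + 2) * + 8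
          lemma = solve-∀

      -- The two sectors `αe` and `αo` have equal sums and cancel modulo 2, while the other two
      -- reduce to their fixed points.
      parity : (ψ 1 ⊛ P 5) n ≡ P 8 n [mod + 2 ]
      parity = cast (trans (sym (regroup Ae Be Bo (Pe 8 n) (Po 8 n))) (cong₂ _-_ (sym product) (sym (⊞-at (Pe 8) (Po 8) n))))
        (∣m∣n⇒∣m+n (∣m∣n⇒∣m+n (divides Ae refl) sum-8e) sum-8o)
        where
        Ae Be Bo : ℤ
        Ae = Σˡ (λ y → [ Ee (αe y) ≐ n ]) (box K)
        Be = Σˡ (λ y → [ Ee (βe y) ≐ n ]) (box K)
        Bo = Σˡ (λ y → [ Eo (βo y) ≐ n ]) (box K)
        regroup : ∀ a b c p r → (a + b) + (a + c) - (p + r) ≡ a * + 2 + (b - p) + (c - r)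
        regroup = solve-∀
        one-one : ∀ x → 1ℤ * 1ℤ * x ≡ x
        one-one = solve-∀
        product : (ψ 1 ⊛ P 5) n ≡ (Ae + Be) + (Ae + Bo)
        product = trans (⊛-comm (ψ 1) (P 5) n) (trans (⊛-distribʳ (Pe 5) (Po 5) (ψ 1) n) (trans (⊞-at (Pe 5 ⊛ ψ 1) (Po 5 ⊛ ψ 1) n) (cong₂ _+_
          (trans (⊛-comm (Pe 5) (ψ 1) n) (trans (θ-⊛-at (λ _ → 1ℤ) (λ a → e a ℕ.* 1) (λ _ → 1ℤ) (λ s → pe s ℕ.* 5) n)
            (trans (Σˡ-cong (λ p → one-one [ Ee p ≐ n ]) (box L)) (trans (divide Ee xe 2∣xe) (cong₂ _+_ sum-αe sum-βe)))))
          (trans (⊛-comm (Po 5) (ψ 1) n) (trans (θ-⊛-at (λ _ → 1ℤ) (λ a → e a ℕ.* 1) (λ _ → 1ℤ) (λ s → po s ℕ.* 5) n)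
            (trans (Σˡ-cong (λ p → one-one [ Eo p ≐ n ]) (box L)) (trans (divide Eo xo 2∣xo) (cong₂ _+_ (trans sum-αo (sym sum-α)) sum-βo))))))))

  -- The values of 4n for generalised pentagonal n avoid the classes 1 and 2 modulo 5.
  pentagonal-classes : List ℤ
  pentagonal-classes = + 0 ∷ + 3 ∷ + 4 ∷ []

  private
    Class : ℤ → Set
    Class x = Any (λ c → x ≡ c [mod + 5 ]) pentagonal-classes

  pe-classes : ∀ s → Class (+ pe s * + 4)
  pe-classes s = subst (λ x → Class (x * + 4)) (sym (pe-≡ s)) (go (residue₅ s))
    where
    factor : ∀ s t → s * (+ 6 * s + 1ℤ) * + 4 - t * (+ 6 * t + 1ℤ) * + 4 ≡ (s - t) * (+ 24 * s + + 24 * t + + 4)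
    factor = solve-∀
    reduce : ∀ t c → s ≡ t [mod + 5 ] → t * (+ 6 * t + 1ℤ) * + 4 ≡ c [mod + 5 ] → s * (+ 6 * s + 1ℤ) * + 4 ≡ c [mod + 5 ]
    reduce t c p r = mod-trans {+ 5} {s * (+ 6 * s + 1ℤ) * + 4} {t * (+ 6 * t + 1ℤ) * + 4} {c} (cast (sym (factor s t)) (∣m⇒∣m*n (+ 24 * s + + 24 * t + + 4) p)) r
    go : _ → Class (s * (+ 6 * s + 1ℤ) * + 4)
    go (_ , p , here refl)                                 = here (reduce (+ 0) (+ 0) p (divides 0ℤ refl))
    go (_ , p , there (here refl))                         = there (here (reduce (+ 1) (+ 3) p (divides (+ 5) refl)))
    go (_ , p , there (there (here refl)))                 = there (there (here (reduce (+ 2) (+ 4) p (divides (+ 20) refl))))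
    go (_ , p , there (there (there (here refl))))         = there (here (reduce (+ 3) (+ 3) p (divides (+ 45) refl)))
    go (_ , p , there (there (there (there (here refl))))) = here (reduce (+ 4) (+ 0) p (divides (+ 80) refl))

  po-classes : ∀ s → Class (+ po s * + 4)
  po-classes s = subst (λ x → Class (x * + 4)) (sym (po-≡ s)) (go (residue₅ s))
    where
    factor : ∀ s t → (+ 2 * s + 1ℤ) * (+ 3 * s + + 2) * + 4 - (+ 2 * t + 1ℤ) * (+ 3 * t + + 2) * + 4 ≡ (s - t) * (+ 24 * s + + 24 * t + + 28)
    factor = solve-∀
    reduce : ∀ t c → s ≡ t [mod + 5 ] → (+ 2 * t + 1ℤ) * (+ 3 * t + + 2) * + 4 ≡ c [mod + 5 ] → (+ 2 * s + 1ℤ) * (+ 3 * s + + 2) * + 4 ≡ c [mod + 5 ]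
    reduce t c p r = mod-trans {+ 5} {(+ 2 * s + 1ℤ) * (+ 3 * s + + 2) * + 4} {(+ 2 * t + 1ℤ) * (+ 3 * t + + 2) * + 4} {c} (cast (sym (factor s t)) (∣m⇒∣m*n (+ 24 * s + + 24 * t + + 28) p)) r
    go : _ → Class ((+ 2 * s + 1ℤ) * (+ 3 * s + + 2) * + 4)
    go (_ , p , here refl)                                 = there (here (reduce (+ 0) (+ 3) p (divides (+ 1) refl)))
    go (_ , p , there (here refl))                         = here (reduce (+ 1) (+ 0) p (divides (+ 12) refl))
    go (_ , p , there (there (here refl)))                 = here (reduce (+ 2) (+ 0) p (divides (+ 32) refl))
    go (_ , p , there (there (there (here refl))))         = there (here (reduce (+ 3) (+ 3) p (divides (+ 61) refl)))
    go (_ , p , there (there (there (there (here refl))))) = there (there (here (reduce (+ 4) (+ 4) p (divides (+ 100) refl))))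

  -- The congruences modulo 2

  module Modulo2 (N : ℕ) where

    open Products (+ 2) N hiding (_+_; _*_; _-_; -_; refl; sym; trans; _^_)
    module R = Products (+ 2) N
    open Coefficients (+ 2) N
    open Parity N using (parity)

    F V : Series
    F = O 1 ⊛ O 5
    V = (F ⊛ f 10) ⊞ (⊟ f 4)

    2∣2 : + 2 ∣ + 2
    2∣2 = divides 1ℤ refl

    ≈-∣ : ∀ {f g} → f ≈ g → ∀ n → n ℕ.≤ N → + 2 ∣ g n → + 2 ∣ f n
    ≈-∣ {f} {g} p n n≤N h = cast (lemma (f n) (g n)) (∣m∣n⇒∣m+n (at p n n≤N) h)
      where
      lemma : ∀ a b → a - b + b ≡ a
      lemma = solve-∀

    f-∣ : ∀ k .{{_ : NonZero k}} n → n ℕ.≤ N → (∀ s → pe s ℕ.* k ≢ n) → (∀ s → po s ℕ.* k ≢ n) → + 2 ∣ f k n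
    f-∣ k n n≤N pe≢ po≢ = ≈-∣ (pentagonal₂ 2∣2 k) n n≤N (cast (sym (⊞-at (Pe k) (Po k) n))
      (∣m∣n⇒∣m+n (θ-∣ (λ _ → 1ℤ) (λ s → pe s ℕ.* k) n (λ s eq → ⊥-elim (pe≢ s eq))) (θ-∣ (λ _ → 1ℤ) (λ s → po s ℕ.* k) n (λ s eq → ⊥-elim (po≢ s eq)))))

    f-supported : ∀ k .{{_ : NonZero k}} n → n ℕ.≤ N → ¬ + 2 ∣ f k n → + k ∣ + n
    f-supported k n n≤N fn≢0 with + k ∣? + n
    ... | yes p = p
    ... | no ¬p = ⊥-elim (fn≢0 (f-∣ k n n≤N (λ s eq → ¬p (divides (+ pe s) (trans (sym (cong +_ eq)) (ℤ.pos-* (pe s) k))))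
      (λ s eq → ¬p (divides (+ po s) (trans (sym (cong +_ eq)) (ℤ.pos-* (po s) k))))))

    drop-multiple : ∀ {d r i j} → + (i ℕ.+ j) ≡ r [mod d ] → d ∣ + i → + j ≡ r [mod d ]
    drop-multiple {d} {r} {i} {j} p q = cast (lemma (+ i) (+ j) r) (∣m∣n⇒∣m-n p q)
      where
      lemma : ∀ i j r → i + j - r - i ≡ j - r
      lemma = solve-∀

    -- By f₄² ≡ f₈ ≡ P(q⁸), f₄ V ≡ ψ P(q⁵) - P(q⁸), which vanishes on even exponents. Cancelling
    -- `f 4` respects parity, as modulo 2 its exponents are multiples of 4.
    V-vanish : ∀ n → n ℕ.≤ N → + n ≡ 0ℤ [mod + 2 ] → + 2 ∣ V n
    V-vanish = ⊛-cancel-on (λ n → + n ≡ 0ℤ [mod + 2 ]) (f 4) V N (⟨⟩-unit 4 N)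
      (λ i j i+j≤N p fi≢0 → drop-multiple {+ 2} {0ℤ} {i} {j} p (∣-trans (divides (+ 2) refl) (f-supported 4 i (ℕ.≤-trans (ℕ.m≤m+n i j) i+j≤N) fi≢0)))
      (λ n n≤N even → ≈-∣ fV n n≤N (cast (sym (trans (⊞-at (ψ 1 ⊛ P 5) (⊟ P 8) n) (cong (λ z → (ψ 1 ⊛ P 5) n + z) (⊟-at (P 8) n)))) (parity n n≤N (mod-0⇒∣ {+ 2} even))))
      where
      fV : f 4 ⊛ V ≈ (ψ 1 ⊛ P 5) ⊞ (⊟ P 8)
      fV = R.trans (solve 2 (λ f g → f :* (g :+ :- f) := f :* g :+ :- (f :* f)) R.refl (f 4) (F ⊛ f 10))
        (R.+-cong (mod-2-theta 2∣2) (R.-‿cong (R.trans (frobenius₂ 4 2∣2) (pentagonal₂ 2∣2 8))))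

    module _ (r : ℤ) (2∣r : + 2 ∣ r) (r∉ : ¬ Class r) where

      -- In F f₁₀ = V + f₄, the evenness of `r` disposes of `V`, and f₄ has modulo 2 no exponent in
      -- the class of `r` modulo 5.
      Ff-vanish : ∀ n → n ℕ.≤ N → + n ≡ r [mod + 10 ] → + 2 ∣ (f 10 ⊛ F) n
      Ff-vanish n n≤N p = cast (trans (cong (λ z → z + f 4 n) (trans (⊞-at (F ⊛ f 10) (⊟ f 4) n) (cong (λ z → (F ⊛ f 10) n + z) (⊟-at (f 4) n))))
        (trans (lemma ((F ⊛ f 10) n) (f 4 n)) (⊛-comm F (f 10) n)))
        (∣m∣n⇒∣m+n (V-vanish n n≤N (∣⇒mod-0 {+ 2} (cast (back (+ n) r) (∣m∣n⇒∣m+n (∣-trans (divides (+ 5) refl) p) 2∣r))))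
          (f-∣ 4 n n≤N (λ s eq → r∉ (class (pe s) eq (pe-classes s))) (λ s eq → r∉ (class (po s) eq (po-classes s)))))
        where
        lemma : ∀ a b → a + - b + b ≡ a
        lemma = solve-∀
        back : ∀ n r → n - r + r ≡ n
        back = solve-∀
        class : ∀ i → i ℕ.* 4 ≡ n → Class (+ i * + 4) → Class r
        class i eq = Any.map (λ {c} q → mod-trans {+ 5} {r} {+ n} {c} (mod-sym {+ 5} {+ n} {r} (∣-trans (divides (+ 2) refl) p))
          (cast (cong (λ z → z - c) (trans (sym (ℤ.pos-* i 4)) (cong +_ eq))) q))

      -- Modulo 2 the exponents of `f 10` are multiples of 10, so it can be cancelled within one
      -- class modulo 10.
      A₂-∣ : + N ≡ r [mod + 10 ] → + 2 ∣ partialProd 5 N N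
      A₂-∣ p = ≈-∣ partialProd-limit N ℕ.≤-refl (⊛-cancel-on (λ n → + n ≡ r [mod + 10 ]) (f 10) F N (⟨⟩-unit 10 N)
        (λ i j i+j≤N p fi≢0 → drop-multiple {+ 10} {r} {i} {j} p (f-supported 10 i (ℕ.≤-trans (ℕ.m≤m+n i j) i+j≤N) fi≢0))
        Ff-vanish N ℕ.≤-refl p)

open import Data.Nat using (_+_; _*_)
open import Data.Integer.Divisibility using (_∣_)

theorem1p7 : (n : ℕ) →
    ((+ 2) ∣ A 5 (10 * n + 2)) × ((+ 2) ∣ A 5 (10 * n + 6))
    × ((+ 5) ∣ A 5 (25 * n + 14)) × ((+ 5) ∣ A 5 (25 * n + 19))
    × ((+ 5) ∣ A 5 (25 * n + 24))
theorem1p7 n = mod2 2 (divides 1ℤ ≡.refl) (from-no (any? (λ c → + 5 ∣? (+ 2 ℤ.- c)) pentagonal-classes))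
  , mod2 6 (divides (+ 3) ≡.refl) (from-no (any? (λ c → + 5 ∣? (+ 6 ℤ.- c)) pentagonal-classes))
  , mod5 2 (from-no (+ 5 ∣? + 2)) (from-no (+ 5 ∣? + 1))
  , mod5 3 (from-no (+ 5 ∣? + 3)) (from-no (+ 5 ∣? + 2))
  , mod5 4 (from-no (+ 5 ∣? + 4)) (from-no (+ 5 ∣? + 3))
  where
  open import Data.Integer.Divisibility.Signed using (divides; _∣?_; ∣⇒∣ᵤ)
  open Congruences using (module Modulo2; module Modulo5; pentagonal-classes)
  -- The classes 2 and 6 are the even ones modulo 10 that are 2 or 1 modulo 5.
  mod2 : ∀ r 2∣r r∉ → (+ 2) ∣ A 5 (10 * n + r)
  mod2 r 2∣r r∉ = ∣⇒∣ᵤ (Modulo2.A₂-∣ (10 * n + r) (+ r) 2∣r r∉ (divides (+ n) (≡.trans (cong (ℤ._- + r) (cong (ℤ._+ + r) (ℤ.pos-* 10 n))) (cancel (+ n) (+ r)))))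
    where
    cancel : ∀ n r → + 10 ℤ.* n ℤ.+ r ℤ.- r ≡ n ℤ.* + 10
    cancel = solve-∀
  -- The classes 14, 19 and 24 are 5s + 4 for s = 2, 3, 4.
  mod5 : ∀ s s≢0 s≢1 → (+ 5) ∣ A 5 (25 * n + (5 * s + 4))
  mod5 s s≢0 s≢1 = ∣⇒∣ᵤ (Modulo5.A₅-∣ (25 * n + (5 * s + 4)) n s (≡.sym (ℕ.+-assoc (25 * n) (5 * s) 4)) s≢0 s≢1)
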